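{- Let $T$ be an LR tableau with shape $\lambda/\mu$ and right LR companion tableau $G=\iota(T)$. Then (a) $\iota(T^e)=G^{\mathrm a}$, $\iota(\rho(T))=\iota(T^{e\bullet})=G^{\mathrm a\bullet}=\mathrm{evac}\,G$, and $\iota(\varrho(T))=\iota(T^{e\bullet\,\mathrm{ot}})=\mathrm{ot}\,\mathrm{evac}\,G$, i.e. the diagram $T\overset{e}{\leftrightarrow}T^e\overset{\bullet}{\leftrightarrow}T^{e\bullet}\overset{\mathrm{ot}}{\leftrightarrow}T^{e\bullet\,\mathrm{ot}}$ over $G\leftrightarrow G^{\mathrm a}\leftrightarrow \mathrm{evac}\,G\leftrightarrow\mathrm{ot}\,\mathrm{evac}\,G$ with vertical maps $\iota$ commutes; (b) on companion tableaux the involutions translate as $\rho:\mathrm{LR}_{\nu,\lambda/\mu}\to\mathrm{LR}_{\nu,(\lambda/\mu)^\bullet}$, $G\mapsto\mathrm{evac}\,G$, with $\mathrm{evac}\,\iota(T)=\iota(\rho(T))$; and $\varrho:\mathrm{LR}_{\nu,\lambda/\mu}\to\mathrm{LR}_{\nu^t,(\lambda/\mu)^t}$, $G\mapsto\mathrm{ot}\,\mathrm{evac}\,G=\mathrm{evac}\,\mathrm{ot}\,G$, with $\mathrm{evac}\,\mathrm{ot}\,\iota(T)=\iota(\varrho(T))$.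
   Context: For an LR tableau $T$ of shape $\lambda/\mu$ and content $\nu$ inside a $d\times(n-d)$ rectangle, its right LR companion $G=\iota(T)$ is the semistandard tableau of shape $\nu$ and content $\lambda/\mu$ whose $i$-th row lists the rows of $T$ containing the entries $i$ (its recording matrix is the transpose of that of $T$); $\mathrm{LR}_{\nu,\lambda/\mu}$ denotes the set of such companions, and $\iota$ is a linear bijection. For opposite LR tableaux the companion is defined analogously (an anti-normal-shape tableau). $G^{\mathrm a}$ is the anti-normal form of $G$, $\mathrm{evac}$ is Schützenberger evacuation ($\mathrm{evac}\,G=G^{\mathrm a\bullet}$), $\bullet$ is rotation by $\pi$ with entries $i\mapsto d-i+1$, and $e$ is the reversal of $T$ (the unique tableau dual Knuth equivalent to $T$ and Knuth equivalent to $\bullet T$). $\mathrm{ot}$ is the orthogonal transpose: on an LR tableau $T$ of shape $\lambda/\mu$ with Yamanouchi word $w$ of weight $\nu$ it gives the LR tableau of shape $(\lambda/\mu)^{t\bullet}$ whose column word replaces, for each $i$, the subword of letters $i$ by $12\cdots\nu_i$; on companion tableaux $\mathrm{ot}$ is the map with $\mathrm{ot}(\iota(T))=\iota(\mathrm{ot}(T))$ (explicitly: transpose $G$, then for each $i$ relabel the vertical strip of $i$'s from southeast to northwest by consecutive integers starting at $\lambda_{d-i+1}+1$). $\rho=\bullet e$ is the LR commuter $\mathrm{LR}(\mu,\nu,\lambda)\to\mathrm{LR}(\lambda,\nu,\mu)$ and $\varrho=\mathrm{ot}\,\rho$ the LR transposer $\mathrm{LR}(\mu,\nu,\lambda)\to\mathrm{LR}(\mu^t,\nu^t,\lambda^t)$.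 The proof uses Lascoux's double crystal structure: the crystal reflection operators $\sigma_i$ acting on $T$ correspond under $\iota$ to cocrystal operators $\theta_i$ on $G$, with $\iota(\sigma_0T)=\theta_0 G=G^{\mathrm a}$. -}

module Defs where

-- Conventions:
--  * A (skew) tableau is a list of rows, top to bottom; a row is
--    (offset , entries): the row occupies columns offset+1 .. offset+length.
--    So row i has inner part mu_i = offset and outer part lambda_i = offset+length.
--    Empty rows still carry their offset (shape information).
--  * Rows are numbered 1,2,... from the top, columns 1,2,... from the left.

open import Data.Nat using (ℕ; zero; suc; _+_; _∸_; _≤_; _<_; _≤?_; _<?_; _≟_; _≡ᵇ_)
open import Data.Bool using (if_then_else_)
open import Data.List using (List; []; _∷_; _++_; length; map; concat; concatMap;
  reverse; filter; take; zipWith; upTo; replicate; applyDownFrom)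
open import Data.Maybe using (Maybe; just; nothing)
open import Data.Product using (_×_; _,_; proj₁; proj₂; Σ)
open import Relation.Binary.PropositionalEquality using (_≡_)
open import Relation.Binary.Construct.Closure.Equivalence using (EqClosure)
open import Relation.Nullary using (yes; no)
open import Data.Unit using (⊤)

Row : Set
Row = ℕ × List ℕ

Tab : Set
Tab = List Row

nth : {A : Set} → List A → ℕ → Maybe A
nth []       _       = nothing
nth (x ∷ xs) zero    = just x
nth (x ∷ xs) (suc k) = nth xs k

cell : Row → ℕ → Maybe ℕ
cell (off , es) j with off <? j
... | yes _ = nth es (j ∸ suc off)
... | no  _ = nothing

-- entry of T in row r (0-indexed from the top), column j (1-indexed)
entry : Tab → ℕ → ℕ → Maybe ℕ
entry T r j with nth T r
... | just row = cell row j
... | nothing  = nothing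

Semistandard : Tab → Set
Semistandard T =
  (∀ r j x y → entry T r j ≡ just x → entry T r (suc j) ≡ just y → x ≤ y) ×
  (∀ r j x y → entry T r j ≡ just x → entry T (suc r) j ≡ just y → x < y)

Decr : List ℕ → Set
Decr []           = ⊤
Decr (x ∷ [])     = ⊤
Decr (x ∷ y ∷ xs) = (y ≤ x) × Decr (y ∷ xs)

Incr : List ℕ → Set
Incr []           = ⊤
Incr (x ∷ [])     = ⊤
Incr (x ∷ y ∷ xs) = (x ≤ y) × Incr (y ∷ xs)

AllL : List ℕ → (ℕ → Set) → Set
AllL []       P = ⊤
AllL (x ∷ xs) P = P x × AllL xs P

inner : Tab → List ℕ
inner T = map proj₁ T

outer : Tab → List ℕ
outer T = map (λ row → proj₁ row + length (proj₂ row)) T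

shape : Tab → List (ℕ × ℕ)
shape T = map (λ row → (proj₁ row , proj₁ row + length (proj₂ row))) T

entries : Tab → List ℕ
entries T = concatMap proj₂ T

SkewInBox : ℕ → ℕ → Tab → Set
SkewInBox d m T = (length T ≡ d) × Decr (inner T) × Decr (outer T) × AllL (outer T) (λ x → x ≤ m)

count : ℕ → List ℕ → ℕ
count a w = length (filter (_≟ a) w)

rowWord : Tab → List ℕ
rowWord T = concat (reverse (map proj₂ T))

yam : Tab → List ℕ
yam T = concatMap (λ row → reverse (proj₂ row)) T

Lattice : List ℕ → Set
Lattice w = ∀ k i → count (suc (suc i)) (take k w) ≤ count (suc i) (take k w)

IsLRTab : ℕ → ℕ → Tab → Set
IsLRTab d m T = SkewInBox d m T × Semistandard T × AllL (entries T) (λ x → 1 ≤ x) × Lattice (yam T)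

-- rotation by pi inside a box with c columns (rows reversed), entries i ↦ a - i + 1
bullet : ℕ → ℕ → Tab → Tab
bullet c a T = reverse (map rot T)
  where
  rot : Row → Row
  rot (off , es) = (c ∸ (off + length es) , reverse (map (λ x → suc a ∸ x) es))

data KnuthStep : List ℕ → List ℕ → Set where
  k1 : ∀ u v {x y z} → x < y → y ≤ z →
       KnuthStep (u ++ y ∷ z ∷ x ∷ v) (u ++ y ∷ x ∷ z ∷ v)
  k2 : ∀ u v {x y z} → x ≤ y → y < z →
       KnuthStep (u ++ x ∷ z ∷ y ∷ v) (u ++ z ∷ x ∷ y ∷ v)

KnuthEq : List ℕ → List ℕ → Set
KnuthEq = EqClosure KnuthStep

-- standardization of a word (equal letters numbered left to right)
std : List ℕ → List ℕ
std w = zipWith (λ k a → suc (length (filter (_<? a) w) + count a (take k w)))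
                (upTo (length w)) w

indexOf : ℕ → List ℕ → ℕ
indexOf v []       = 0
indexOf v (x ∷ xs) = if x ≡ᵇ v then 0 else suc (indexOf v xs)

-- inverse of a permutation of 1..N given in one-line notation
inv : List ℕ → List ℕ
inv p = map (λ k → suc (indexOf (suc k) p)) (upTo (length p))

-- dual Knuth equivalence of tableaux: same shape and dual equivalent reading
-- words (inverses of the standardized reading words are Knuth equivalent)
DualKnuthEq : Tab → Tab → Set
DualKnuthEq T U = (shape T ≡ shape U) × KnuthEq (inv (std (rowWord T))) (inv (std (rowWord U)))

-- Te is the reversal T^e of T (T in a d × m box, entries in 1..d):
-- a tableau dual Knuth equivalent to T and Knuth equivalent to bullet T
IsReversal : ℕ → ℕ → Tab → Tab → Set
IsReversal d m T Te = Semistandard Te × DualKnuthEq T Te × KnuthEq (rowWord Te) (rowWord (bullet m d T))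

compRow : Tab → ℕ → List ℕ
compRow T k = concat (zipWith (λ i row → replicate (count k (proj₂ row)) (suc i)) (upTo (length T)) T)

ι : Tab → Tab
ι T = map (λ k → (0 , compRow T (suc k))) (upTo (length T))

-- companion of an opposite LR tableau: anti-normal shape in a box with c columns
ιop : ℕ → Tab → Tab
ιop c T = map (λ k → (c ∸ length (compRow T (suc k)) , compRow T (suc k))) (upTo (length T))

IsAntiNormalForm : ℕ → ℕ → Tab → Tab → Set
IsAntiNormalForm r c G H =
  (length H ≡ r) × AllL (outer H) (λ x → x ≡ c) × Incr (map (λ row → length (proj₂ row)) H) ×
  Semistandard H × KnuthEq (rowWord H) (rowWord G)

-- evac G = G^{a bullet}, for G in the r × c box with entries in 1..r
IsEvac : ℕ → ℕ → Tab → Tab → Set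
IsEvac r c G E = Σ Tab (λ H → IsAntiNormalForm r c G H × (E ≡ bullet c r H))

colWord : ℕ → Tab → List ℕ
colWord c V = concatMap (λ j → concatMap (λ row → toL (cell row j)) V) (applyDownFrom suc c)
  where
  toL : Maybe ℕ → List ℕ
  toL (just x) = x ∷ []
  toL nothing  = []

relabel : List ℕ → List ℕ
relabel w = zipWith (λ k a → suc (count a (take k w))) (upTo (length w)) w

countGe : ℕ → List ℕ → ℕ
countGe j xs = length (filter (j ≤?_) xs)

-- the shape (lambda/mu)^{t bullet} in the m × d box, for U in the d × m box
otShape : ℕ → ℕ → Tab → List (ℕ × ℕ)
otShape d m U = applyDownFrom (λ k → (d ∸ countGe (suc k) (outer U) , d ∸ countGe (suc k) (inner U))) m

IsOt : ℕ → ℕ → Tab → Tab → Set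
IsOt d m U V = (shape V ≡ otShape d m U) × (colWord d V ≡ relabel (yam U))

-- orthogonal transpose on companions relative to the shape S:
-- ot (ι U) = ι (ot U) for U an LR tableau of shape S
IsOtComp : ℕ → ℕ → List (ℕ × ℕ) → Tab → Tab → Set
IsOtComp d m S G H = ∀ U → IsLRTab d m U → shape U ≡ S → ι U ≡ G →
                     ∀ V → IsOt d m U V → ι V ≡ H

{-# OPTIONS --safe #-}
module Submission where

-- Write m = n ∸ d.  List the cells of T letter by letter, inside a letter from left to right: this is the word
-- inv (std (rowWord T)), its letters being the cells of the shape of T numbered in reading order.  Replacing cells by
-- their rows and reversing gives the row word of ι T; replacing cells by m + 1 - column gives a word D T.  Dual Knuth
-- equivalence of T and Te is Knuth equivalence of the two words of cells.  All words met on the way are standard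
-- fillings of the common skew shape, and by convexity of the shape each Knuth move remains a Knuth move after either
-- replacement.  So rowWord (ι T) ~ rowWord (ιop m Te), and D T ~ D Te.
--
-- The prefix inequalities defining lattice words are invariant under Knuth moves, hence the rotation of Te is again a
-- Littlewood-Richardson tableau.  For such a tableau U with orthogonal transpose V, the companion ι V is the straight
-- tableau whose a-th column lists m + 1 - column over the letters a of U.  Reading it by columns gives D U, so
-- rowWord (ι V) ~ D U; rotating, D T ~ D Te becomes the statement that ι V is the evacuation of ι W.

open import Defs
open import Data.Nat
open import Data.Nat.Properties
open import Data.Bool using (true; false)
open import Data.List using (List; []; _∷_; _++_; _∷ʳ_; [_]; length; map; concat; concatMap; reverse; filter; take; zipWith; upTo; applyUpTo; applyDownFrom; downFrom; replicate)
open import Data.List.Properties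
open import Data.List.Relation.Unary.All as All using (All; []; _∷_)
import Data.List.Relation.Unary.All.Properties as AllP
open import Data.List.Relation.Unary.Any using (here; there)
open import Data.List.Relation.Unary.AllPairs using (AllPairs; []; _∷_)
import Data.List.Relation.Unary.AllPairs.Properties as APP
open import Data.List.Membership.Propositional using (_∈_)
open import Data.List.Membership.Propositional.Properties using (∈-filter⁺; ∈-filter⁻; ∈-map⁺; ∈-map⁻; ∈-++⁺ˡ; ∈-++⁺ʳ; ∈-++⁻; ∈-upTo⁻)
open import Data.List.Relation.Binary.Permutation.Propositional as Perm using (_↭_; ↭-refl; ↭-trans; ↭-sym; ↭-reflexive; prep; swap)
import Data.List.Relation.Binary.Permutation.Propositional.Properties as PermP
open import Data.Maybe as Maybe using (Maybe; just; nothing)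
open import Data.Maybe.Properties using (just-injective)
open import Data.Product using (_×_; _,_; proj₁; proj₂; ∃)
open import Data.Sum using (_⊎_; inj₁; inj₂)
open import Data.Empty using (⊥; ⊥-elim)
open import Function using (_∘_; id; flip)
open import Relation.Nullary using (¬_; yes; no; does)
open import Relation.Binary.Definitions using (tri<; tri≈; tri>)
open import Relation.Binary.PropositionalEquality hiding ([_])
open import Relation.Binary.Construct.Closure.Symmetric using (SymClosure; fwd; bwd)
open import Relation.Binary.Construct.Closure.ReflexiveTransitive using (ε; _◅_; _◅◅_)
import Relation.Binary.Construct.Closure.Equivalence as Eq
open import Data.List.Membership.Propositional.Properties.WithK using (unique∧set⇒bag)
open import Data.List.Relation.Binary.BagAndSetEquality using (∼bag⇒↭)
open import Function.Bundles using (mk⇔)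

-- Both parts of the theorem come from one chain of Knuth moves. The numbering of cells depends only
-- on the shape, so the chain that `DualKnuthEq` provides between `T` and `Te` can be projected in
-- two ways: on rows it speaks of `ι T` and `ιop m Te`; on columns it speaks of `ι W` and `ι V`,
-- because transposition turns columns into the row indices that a companion records. The obstacle
-- is that a Knuth move compares cell numbers, whereas a projection compares rows or columns, which
-- may tie or come in the wrong order. Ties are absorbed by the weak inequality of the move. Reading
-- order and incomparability settle all comparisons but one; a wrong order there would put two of
-- the three cells at opposite corners of a rectangle, and the third cell would have to be both of
-- the other corners. A second obstacle is `IsOtComp`, which ranges over every tableau with the
-- given shape and companion; it is met by the injectivity of `ι`.

private variable
  A B : Set

-- Lists: selection by a label, counting, sorted lists, numbering of entries

toList : Maybe A → List A
toList (just x) = x ∷ []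
toList nothing  = []

sel : (A → ℕ) → ℕ → List A → List A
sel f a = filter (λ x → f x ≟ a)

sel-accept : (f : A → ℕ) {a : ℕ} {x : A} (xs : List A) → f x ≡ a → sel f a (x ∷ xs) ≡ x ∷ sel f a xs
sel-accept f xs p = filter-accept (λ x → f x ≟ _) p

sel-reject : (f : A → ℕ) {a : ℕ} {x : A} (xs : List A) → f x ≢ a → sel f a (x ∷ xs) ≡ sel f a xs
sel-reject f xs p = filter-reject (λ x → f x ≟ _) p

sel-++ : (f : A → ℕ) (a : ℕ) (xs ys : List A) → sel f a (xs ++ ys) ≡ sel f a xs ++ sel f a ys
sel-++ f a = filter-++ (λ x → f x ≟ a)

sel-map : (f : B → ℕ) (g : A → B) (a : ℕ) (xs : List A) → sel f a (map g xs) ≡ map g (sel (f ∘ g) a xs)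
sel-map f g a [] = refl
sel-map f g a (x ∷ xs) with does (f (g x) ≟ a)
... | true  = cong (g x ∷_) (sel-map f g a xs)
... | false = sel-map f g a xs

sel-reverse : (f : A → ℕ) (a : ℕ) (xs : List A) → sel f a (reverse xs) ≡ reverse (sel f a xs)
sel-reverse f a [] = refl
sel-reverse f a (x ∷ xs) with f x ≟ a
... | yes p = begin
  sel f a (reverse (x ∷ xs))         ≡⟨ cong (sel f a) (unfold-reverse x xs) ⟩
  sel f a (reverse xs ∷ʳ x)          ≡⟨ sel-++ f a (reverse xs) [ x ] ⟩
  sel f a (reverse xs) ++ sel f a [ x ] ≡⟨ cong₂ _++_ (sel-reverse f a xs) (sel-accept f [] p) ⟩
  reverse (sel f a xs) ∷ʳ x          ≡⟨ unfold-reverse x (sel f a xs) ⟨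
  reverse (x ∷ sel f a xs)           ≡⟨ cong reverse (sel-accept f xs p) ⟨
  reverse (sel f a (x ∷ xs))         ∎
  where open ≡-Reasoning
... | no ¬p = begin
  sel f a (reverse (x ∷ xs))         ≡⟨ cong (sel f a) (unfold-reverse x xs) ⟩
  sel f a (reverse xs ∷ʳ x)          ≡⟨ sel-++ f a (reverse xs) [ x ] ⟩
  sel f a (reverse xs) ++ sel f a [ x ] ≡⟨ cong₂ _++_ (sel-reverse f a xs) (sel-reject f [] ¬p) ⟩
  reverse (sel f a xs) ++ []         ≡⟨ ++-identityʳ _ ⟩
  reverse (sel f a xs)               ≡⟨ cong reverse (sel-reject f xs ¬p) ⟨
  reverse (sel f a (x ∷ xs))         ∎
  where open ≡-Reasoning

sel-cong : {f g : A → ℕ} {a b : ℕ} {xs : List A} →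
  All (λ x → (f x ≡ a → g x ≡ b) × (g x ≡ b → f x ≡ a)) xs → sel f a xs ≡ sel g b xs
sel-cong [] = refl
sel-cong {f = f} {g} {a} {b} {x ∷ xs} ((to , from) ∷ ps) with f x ≟ a
... | yes p = trans (sel-accept f xs p) (trans (cong (x ∷_) (sel-cong ps)) (sym (sel-accept g xs (to p))))
... | no ¬p = trans (sel-reject f xs ¬p) (trans (sel-cong ps) (sym (sel-reject g xs (¬p ∘ from))))

sel-comm : (f g : A → ℕ) (a b : ℕ) (xs : List A) → sel f a (sel g b xs) ≡ sel g b (sel f a xs)
sel-comm f g a b [] = refl
sel-comm f g a b (x ∷ xs) with f x ≟ a | g x ≟ b
... | yes p | yes q rewrite sel-accept f xs p | sel-accept g xs q
                          | sel-accept f (sel g b xs) p | sel-accept g (sel f a xs) q = cong (x ∷_) (sel-comm f g a b xs)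
... | yes p | no ¬q rewrite sel-accept f xs p | sel-reject g xs ¬q
                          | sel-reject g (sel f a xs) ¬q = sel-comm f g a b xs
... | no ¬p | yes q rewrite sel-reject f xs ¬p | sel-accept g xs q
                          | sel-reject f (sel g b xs) ¬p = sel-comm f g a b xs
... | no ¬p | no ¬q rewrite sel-reject f xs ¬p | sel-reject g xs ¬q = sel-comm f g a b xs

∈-sel⁺ : (f : A → ℕ) {x : A} {xs : List A} → x ∈ xs → x ∈ sel f (f x) xs
∈-sel⁺ f x∈ = ∈-filter⁺ (λ y → f y ≟ _) x∈ refl

∈-sel⁻ : (f : A → ℕ) (a : ℕ) {x : A} (xs : List A) → x ∈ sel f a xs → x ∈ xs × f x ≡ a
∈-sel⁻ f a xs = ∈-filter⁻ (λ y → f y ≟ a) {xs = xs}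

count-map : (f : A → ℕ) (a : ℕ) (xs : List A) → count a (map f xs) ≡ length (sel f a xs)
count-map f a xs = trans (cong length (sel-map id f a xs)) (length-map f (sel f a xs))

count-++ : ∀ a xs ys → count a (xs ++ ys) ≡ count a xs + count a ys
count-++ a xs ys = trans (cong length (sel-++ id a xs ys)) (length-++ (sel id a xs))

count-∷-≡ : ∀ {a x} xs → x ≡ a → count a (x ∷ xs) ≡ suc (count a xs)
count-∷-≡ xs p = cong length (sel-accept id xs p)

count-self : ∀ x xs → count x (x ∷ xs) ≡ suc (count x xs)
count-self x xs = count-∷-≡ {x} {x} xs refl

count-∷-≢ : ∀ {a x} xs → x ≢ a → count a (x ∷ xs) ≡ count a xs
count-∷-≢ xs p = cong length (sel-reject id xs p)

count-↭ : ∀ a {xs ys} → xs ↭ ys → count a xs ≡ count a ys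
count-↭ a p = PermP.↭-length (PermP.filter-↭ (_≟ a) p)

count-none : ∀ {a xs} → All (λ x → x ≢ a) xs → count a xs ≡ 0
count-none ps = cong length (filter-none (_≟ _) ps)

nth-∈ : (xs : List A) {k : ℕ} {x : A} → nth xs k ≡ just x → x ∈ xs
nth-∈ (x ∷ xs) {zero}  refl = here refl
nth-∈ (x ∷ xs) {suc k} p    = there (nth-∈ xs p)

∈-nth : {x : A} {xs : List A} → x ∈ xs → ∃ λ k → nth xs k ≡ just x
∈-nth (here refl) = 0 , refl
∈-nth (there x∈) with k , p ← ∈-nth x∈ = suc k , p

nth-++ˡ : (xs : List A) {ys : List A} {k : ℕ} {x : A} → nth xs k ≡ just x → nth (xs ++ ys) k ≡ just x
nth-++ˡ (x ∷ xs) {k = zero}  p = p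
nth-++ˡ (x ∷ xs) {k = suc k} p = nth-++ˡ xs p

nth-map : (f : A → B) (xs : List A) (k : ℕ) → nth (map f xs) k ≡ Maybe.map f (nth xs k)
nth-map f []       k       = refl
nth-map f (x ∷ xs) zero    = refl
nth-map f (x ∷ xs) (suc k) = nth-map f xs k

nth-map⁺ : (f : A → B) (xs : List A) {k : ℕ} {x : A} → nth xs k ≡ just x → nth (map f xs) k ≡ just (f x)
nth-map⁺ f xs {k} p = trans (nth-map f xs k) (cong (Maybe.map f) p)

nth-map⁻ : (f : A → B) (xs : List A) {k : ℕ} {y : B} → nth (map f xs) k ≡ just y →
  ∃ λ x → nth xs k ≡ just x × y ≡ f x
nth-map⁻ f (x ∷ xs) {zero}  refl = x , refl , refl
nth-map⁻ f (x ∷ xs) {suc k} p    = nth-map⁻ f xs p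

nth-< : (xs : List A) {k : ℕ} → k < length xs → ∃ λ x → nth xs k ≡ just x
nth-< (x ∷ xs) {zero}  _       = x , refl
nth-< (x ∷ xs) {suc k} (s≤s p) = nth-< xs p

nth-just-< : (xs : List A) {k : ℕ} {x : A} → nth xs k ≡ just x → k < length xs
nth-just-< (x ∷ xs) {zero}  _ = s≤s z≤n
nth-just-< (x ∷ xs) {suc k} p = s≤s (nth-just-< xs p)

nth-applyUpTo : (f : ℕ → A) {n k : ℕ} → k < n → nth (applyUpTo f n) k ≡ just (f k)
nth-applyUpTo f {suc n} {zero}  _       = refl
nth-applyUpTo f {suc n} {suc k} (s≤s p) = nth-applyUpTo (f ∘ suc) p

AllPairs-++⁻ : {R : A → A → Set} (xs : List A) {ys : List A} → AllPairs R (xs ++ ys) →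
  AllPairs R xs × AllPairs R ys × All (λ x → All (R x) ys) xs
AllPairs-++⁻ []       ps       = [] , ps , []
AllPairs-++⁻ (x ∷ xs) (p ∷ ps) with r , s , t ← AllPairs-++⁻ xs ps =
  AllP.++⁻ˡ xs p ∷ r , s , AllP.++⁻ʳ xs p ∷ t

AllPairs-reverse : {R : A → A → Set} {xs : List A} → AllPairs R xs → AllPairs (flip R) (reverse xs)
AllPairs-reverse [] = []
AllPairs-reverse {R = R} {xs = x ∷ xs} (p ∷ ps) rewrite unfold-reverse x xs =
  APP.++⁺ (AllPairs-reverse ps) ([] ∷ []) (PermP.All-resp-↭ (↭-sym (PermP.↭-reverse xs)) (All.map (_∷ []) p))

AllPairs-nth : {R : A → A → Set} (xs : List A) {i j : ℕ} {a b : A} → AllPairs R xs →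
  nth xs i ≡ just a → nth xs j ≡ just b → i < j → R a b
AllPairs-nth (x ∷ xs) {zero}  {suc j} (p ∷ ps) refl q _       = All.lookup p (nth-∈ xs q)
AllPairs-nth (x ∷ xs) {suc i} {suc j} (p ∷ ps) r    q (s≤s l) = AllPairs-nth xs ps r q l

module _ (R : A → A → Set) (asym : ∀ {x y} → R x y → R y x → ⊥) where

  -- If the heads differed, each would occur in the tail of the other list and so come after the
  -- other head, against asymmetry. This later identifies two readings of one set of cells from
  -- membership alone.
  sorted-ext : {xs ys : List A} → AllPairs R xs → AllPairs R ys →
    (∀ {z} → z ∈ xs → z ∈ ys) → (∀ {z} → z ∈ ys → z ∈ xs) → xs ≡ ys
  sorted-ext {[]}     {[]}     _ _ _ _ = refl
  sorted-ext {[]}     {y ∷ ys} _ _ _ g with () ← g (here refl)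
  sorted-ext {x ∷ xs} {[]}     _ _ f _ with () ← f (here refl)
  sorted-ext {x ∷ xs} {y ∷ ys} (p ∷ ps) (q ∷ qs) f g =
    cong₂ _∷_ x≡y (sorted-ext ps qs (λ z∈ → strip (sym x≡y) (All.lookup p z∈) (f (there z∈)))
                                    (λ z∈ → strip x≡y (All.lookup q z∈) (g (there z∈))))
    where
    x≡y : x ≡ y
    x≡y with f (here refl) | g (here refl)
    ... | here e   | _        = e
    ... | there _  | here e   = sym e
    ... | there x∈ | there y∈ = ⊥-elim (asym (All.lookup q x∈) (All.lookup p y∈))

    strip : ∀ {u v z zs} → u ≡ v → R v z → z ∈ u ∷ zs → z ∈ zs
    strip refl r (here refl) = ⊥-elim (asym r r)
    strip _    r (there z∈)  = z∈

sorted-count : {xs ys : List ℕ} → AllPairs _≤_ xs → AllPairs _≤_ ys →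
  (∀ a → count a xs ≡ count a ys) → xs ≡ ys
sorted-count {[]} {[]} _ _ _ = refl
sorted-count {[]} {y ∷ ys} _ _ h with () ← trans (h y) (count-self y ys)
sorted-count {x ∷ xs} {[]} _ _ h with () ← trans (sym (h x)) (count-self x xs)
sorted-count {x ∷ xs} {y ∷ ys} (p ∷ ps) (q ∷ qs) h with <-cmp x y
... | tri< x<y _ _ with () ← trans (sym (count-self x xs)) (trans (h x) (count-none {x} {y ∷ ys} (<⇒≢ x<y ∘ sym ∷ All.map (λ y≤z e → <⇒≱ x<y (≤-trans y≤z (≤-reflexive e))) q)))
... | tri> _ _ y<x with () ← trans (sym (count-self y ys)) (trans (sym (h y)) (count-none {y} {x ∷ xs} (<⇒≢ y<x ∘ sym ∷ All.map (λ x≤z e → <⇒≱ y<x (≤-trans x≤z (≤-reflexive e))) p)))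
... | tri≈ _ refl _ = cong (x ∷_) (sorted-count ps qs h′)
  where
  h′ : ∀ a → count a xs ≡ count a ys
  h′ a with x ≟ a
  ... | yes e = suc-injective (trans (sym (count-∷-≡ xs e)) (trans (h a) (count-∷-≡ ys e)))
  ... | no ¬e = trans (sym (count-∷-≢ xs ¬e)) (trans (h a) (count-∷-≢ ys ¬e))

sorted-↭ : {xs ys : List ℕ} → AllPairs _≤_ xs → AllPairs _≤_ ys → xs ↭ ys → xs ≡ ys
sorted-↭ p q r = sorted-count p q (λ a → count-↭ a r)

-- Pigeonhole; the lower bound `b` moves up with each entry so that the induction can run on `m`.
-- Applied to the columns met by one letter, it bounds the row lengths of a companion.
ascending-length : {m : ℕ} (b : ℕ) {xs : List ℕ} → AllPairs _<_ xs → All (λ x → b < x × x ≤ b + m) xs → length xs ≤ m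
ascending-length b [] [] = z≤n
ascending-length {zero} b (p ∷ ps) ((l , u) ∷ qs) = ⊥-elim (<⇒≱ l (≤-trans u (≤-reflexive (+-identityʳ b))))
ascending-length {suc m} b {x ∷ xs} (p ∷ ps) ((l , u) ∷ qs) =
  s≤s (ascending-length {m} (suc b) ps (All.zipWith (λ { (x<y , (_ , y≤)) → ≤-<-trans l x<y , ≤-trans y≤ (≤-reflexive (+-suc b m)) }) (p , qs)))

reverse-concatMap : (f : A → List B) (xs : List A) → reverse (concatMap f xs) ≡ concatMap (reverse ∘ f) (reverse xs)
reverse-concatMap f []       = refl
reverse-concatMap f (x ∷ xs) = begin
  reverse (f x ++ concatMap f xs) ≡⟨ reverse-++ (f x) (concatMap f xs) ⟩
  reverse (concatMap f xs) ++ reverse (f x) ≡⟨ cong₂ _++_ (reverse-concatMap f xs) (sym (++-identityʳ _)) ⟩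
  concatMap (reverse ∘ f) (reverse xs) ++ concatMap (reverse ∘ f) [ x ] ≡⟨ concatMap-++ (reverse ∘ f) (reverse xs) [ x ] ⟨
  concatMap (reverse ∘ f) (reverse xs ∷ʳ x) ≡⟨ cong (concatMap (reverse ∘ f)) (unfold-reverse x xs) ⟨
  concatMap (reverse ∘ f) (reverse (x ∷ xs)) ∎
  where open ≡-Reasoning

concatMap-cong-∈ : {f g : A → List B} (xs : List A) → (∀ {x} → x ∈ xs → f x ≡ g x) → concatMap f xs ≡ concatMap g xs
concatMap-cong-∈ []       h = refl
concatMap-cong-∈ (x ∷ xs) h = cong₂ _++_ (h (here refl)) (concatMap-cong-∈ xs (h ∘ there))

map-cong-∈ : {f g : A → B} (xs : List A) → (∀ {x} → x ∈ xs → f x ≡ g x) → map f xs ≡ map g xs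
map-cong-∈ []       h = refl
map-cong-∈ (x ∷ xs) h = cong₂ _∷_ (h (here refl)) (map-cong-∈ xs (h ∘ there))

upTo-suc : ∀ n → upTo (suc n) ≡ upTo n ++ [ n ]
upTo-suc n = sym (upTo-∷ʳ n)

concatMap-upTo-suc : (f : ℕ → List A) (n : ℕ) → concatMap f (upTo (suc n)) ≡ concatMap f (upTo n) ++ f n
concatMap-upTo-suc f n = trans (cong (concatMap f) (upTo-suc n))
  (trans (concatMap-++ f (upTo n) [ n ]) (cong (concatMap f (upTo n) ++_) (++-identityʳ (f n))))

map-upTo-reverse : (f : ℕ → A) (n : ℕ) → reverse (map f (upTo n)) ≡ map (λ k → f (n ∸ suc k)) (upTo n)
map-upTo-reverse f n = trans (cong reverse (map-upTo f n)) (trans (reverse-applyUpTo f n) (trans (down f n) (sym (map-upTo _ n))))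
  where
  down : (f : ℕ → _) (n : ℕ) → applyDownFrom f n ≡ applyUpTo (λ k → f (n ∸ suc k)) n
  down f zero    = refl
  down f (suc n) = cong (f n ∷_) (down f n)

applyUpTo-+ : (f : ℕ → A) (m n : ℕ) → applyUpTo f (m + n) ≡ applyUpTo f m ++ applyUpTo (λ k → f (m + k)) n
applyUpTo-+ f zero    n = refl
applyUpTo-+ f (suc m) n = cong (f 0 ∷_) (applyUpTo-+ (f ∘ suc) m n)

module _ (f : A → ℕ) where

  countLe : ℕ → List A → List A
  countLe n = filter (λ x → f x ≤? n)

  countLe-suc : ∀ n xs → countLe n xs ++ sel f (suc n) xs ↭ countLe (suc n) xs
  countLe-suc n [] = ↭-refl
  countLe-suc n (x ∷ xs) with <-cmp (f x) (suc n)
  ... | tri< (s≤s l) ne _ rewrite filter-accept (λ x → f x ≤? n) {xs = xs} l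
                              | sel-reject f xs ne
                              | filter-accept (λ x → f x ≤? suc n) {xs = xs} (m≤n⇒m≤1+n l) = prep x (countLe-suc n xs)
  ... | tri≈ _ e _ rewrite filter-reject (λ x → f x ≤? n) {xs = xs} (λ l → <-irrefl e (s≤s l))
                         | sel-accept f xs e
                         | filter-accept (λ x → f x ≤? suc n) {xs = xs} (≤-reflexive e) =
      ↭-trans (PermP.shift x (countLe n xs) _) (prep x (countLe-suc n xs))
  ... | tri> _ ne g rewrite filter-reject (λ x → f x ≤? n) {xs = xs} (λ l → <⇒≱ g (m≤n⇒m≤1+n l))
                              | sel-reject f xs ne
                              | filter-reject (λ x → f x ≤? suc n) {xs = xs} (<⇒≱ g) = countLe-suc n xs

  concat-sel-↭′ : ∀ n {xs} → All (λ x → 1 ≤ f x) xs → concatMap (λ k → sel f (suc k) xs) (upTo n) ↭ countLe n xs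
  concat-sel-↭′ zero ps = ↭-reflexive (sym (filter-none (λ x → f x ≤? 0) (All.map <⇒≱ ps)))
  concat-sel-↭′ (suc n) {xs} ps = ↭-trans (↭-reflexive (concatMap-upTo-suc _ n))
    (↭-trans (PermP.++⁺ʳ _ (concat-sel-↭′ n ps)) (countLe-suc n xs))

  -- The partial concatenations over the labels up to `n` are permutations of `countLe n`; starting
  -- with label 1 loses nothing because all labels are positive.
  concat-sel-↭ : ∀ n {xs} → All (λ x → 1 ≤ f x × f x ≤ n) xs → concatMap (λ k → sel f (suc k) xs) (upTo n) ↭ xs
  concat-sel-↭ n ps = ↭-trans (concat-sel-↭′ n (All.map proj₁ ps))
    (↭-reflexive (filter-all (λ x → f x ≤? n) (All.map proj₂ ps)))

enum : ℕ → List A → List (ℕ × A)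
enum i []       = []
enum i (x ∷ xs) = (i , x) ∷ enum (suc i) xs

enum-proj₂ : (i : ℕ) (xs : List A) → map proj₂ (enum i xs) ≡ xs
enum-proj₂ i []       = refl
enum-proj₂ i (x ∷ xs) = cong (x ∷_) (enum-proj₂ (suc i) xs)

All-enum : {P : A → Set} (i : ℕ) {xs : List A} → All P xs → All (P ∘ proj₂) (enum i xs)
All-enum i []       = []
All-enum i (p ∷ ps) = p ∷ All-enum (suc i) ps

enum-nth : (i : ℕ) {xs : List A} {e : ℕ × A} → e ∈ enum i xs → ∃ λ k → proj₁ e ≡ i + k × nth xs k ≡ just (proj₂ e)
enum-nth i {x ∷ xs} (here refl) = 0 , sym (+-identityʳ i) , refl
enum-nth i {x ∷ xs} (there e∈) with k , p , q ← enum-nth (suc i) e∈ = suc k , trans p (sym (+-suc i k)) , q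

nth-enum : ∀ i (xs : List A) {k x} → nth xs k ≡ just x → nth (enum i xs) k ≡ just (i + k , x)
nth-enum i (y ∷ xs) {zero}      refl = cong (λ j → just (j , y)) (sym (+-identityʳ i))
nth-enum i (y ∷ xs) {suc k} {x} p    = trans (nth-enum (suc i) xs p) (cong (λ j → just (j , x)) (sym (+-suc i k)))

zipWith-enum : (h : ℕ → ℕ → B) (f : A → ℕ) (xs : List A) →
  zipWith h (upTo (length (map f xs))) (map f xs) ≡ map (λ e → h (proj₁ e) (f (proj₂ e))) (enum 0 xs)
zipWith-enum h f xs = go id 0 (λ t → refl) xs
  where
  go : (g : ℕ → ℕ) (i : ℕ) → (∀ t → g t ≡ i + t) → ∀ xs →
    zipWith h (applyUpTo g (length (map f xs))) (map f xs) ≡ map (λ e → h (proj₁ e) (f (proj₂ e))) (enum i xs)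
  go g i eq []       = refl
  go g i eq (x ∷ xs) = cong₂ _∷_ (cong (λ z → h z (f x)) (trans (eq 0) (+-identityʳ i)))
    (go (g ∘ suc) (suc i) (λ t → trans (eq (suc t)) (+-suc i t)) xs)

-- The t-th occurrence of `a`, counted from 0, has exactly t occurrences before it. This one fact
-- governs both the labels of `std` and the entries that `relabel` gives to the orthogonal
-- transpose.
enum-count : (f : A → ℕ) (a : ℕ) (xs : List A) →
  map (λ e → count (f (proj₂ e)) (take (proj₁ e) (map f xs))) (sel (f ∘ proj₂) a (enum 0 xs)) ≡ upTo (length (sel f a xs))
enum-count f a xs = go [] xs 0 refl refl
  where
  w = map f xs
  h = λ e → count (f (proj₂ e)) (take (proj₁ e) w)
  take-prefix : ∀ (ys : List ℕ) zs → take (length ys) (ys ++ zs) ≡ ys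
  take-prefix []       zs = refl
  take-prefix (y ∷ ys) zs = cong (y ∷_) (take-prefix ys zs)
  go : ∀ ys zs c → w ≡ ys ++ map f zs → c ≡ count a ys →
    map h (sel (f ∘ proj₂) a (enum (length ys) zs)) ≡ applyUpTo (c +_) (length (sel f a zs))
  go ys []       c e e′ = refl
  go ys (z ∷ zs) c e e′ with f z ≟ a
  ... | yes p = begin
      map h (sel (f ∘ proj₂) a (enum (length ys) (z ∷ zs)))
        ≡⟨ cong (map h) (sel-accept (f ∘ proj₂) (enum (suc (length ys)) zs) p) ⟩
      h (length ys , z) ∷ map h (sel (f ∘ proj₂) a (enum (suc (length ys)) zs))
        ≡⟨ cong₂ _∷_ hd tl ⟩
      (c + 0) ∷ applyUpTo (suc c +_) (length (sel f a zs))
        ≡⟨ cong ((c + 0) ∷_) (trans (sym (map-upTo (suc c +_) (length (sel f a zs)))) (trans (map-cong (λ k → sym (+-suc c k)) (upTo (length (sel f a zs)))) (map-upTo _ (length (sel f a zs))))) ⟩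
      applyUpTo (c +_) (suc (length (sel f a zs)))
        ≡⟨ cong (applyUpTo (c +_) ∘ length) (sel-accept f zs p) ⟨
      applyUpTo (c +_) (length (sel f a (z ∷ zs))) ∎
    where
    open ≡-Reasoning
    hd : h (length ys , z) ≡ c + 0
    hd = trans (cong₂ count p (trans (cong (take (length ys)) e) (take-prefix ys _))) (trans (sym e′) (sym (+-identityʳ c)))
    tl : map h (sel (f ∘ proj₂) a (enum (suc (length ys)) zs)) ≡ applyUpTo (suc c +_) (length (sel f a zs))
    tl = trans (cong (λ i → map h (sel (f ∘ proj₂) a (enum i zs))) (trans (+-comm 1 (length ys)) (sym (length-++ ys {[ f z ]}))))
      (go (ys ++ [ f z ]) zs (suc c) (trans e (sym (++-assoc ys [ f z ] (map f zs))))
        (trans (cong suc e′) (sym (trans (count-++ a ys [ f z ]) (trans (cong (count a ys +_) (count-∷-≡ [] p)) (+-comm (count a ys) 1))))))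
  ... | no ¬p = begin
      map h (sel (f ∘ proj₂) a (enum (length ys) (z ∷ zs)))
        ≡⟨ cong (map h) (sel-reject (f ∘ proj₂) (enum (suc (length ys)) zs) ¬p) ⟩
      map h (sel (f ∘ proj₂) a (enum (suc (length ys)) zs))
        ≡⟨ cong (λ i → map h (sel (f ∘ proj₂) a (enum i zs))) (trans (+-comm 1 (length ys)) (sym (length-++ ys {[ f z ]}))) ⟩
      map h (sel (f ∘ proj₂) a (enum (length (ys ++ [ f z ])) zs))
        ≡⟨ go (ys ++ [ f z ]) zs c (trans e (sym (++-assoc ys [ f z ] (map f zs))))
        (trans e′ (sym (trans (count-++ a ys [ f z ]) (trans (cong (count a ys +_) (count-∷-≢ [] ¬p)) (+-identityʳ (count a ys)))))) ⟩
      applyUpTo (c +_) (length (sel f a zs))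
        ≡⟨ cong (applyUpTo (c +_) ∘ length) (sel-reject f zs ¬p) ⟨
      applyUpTo (c +_) (length (sel f a (z ∷ zs))) ∎
    where open ≡-Reasoning

-- Labels that run 0, 1, 2, ... single out at most one entry. Together with `enum-count` this turns
-- a selection by the number of previous occurrences into an index.
sel-nth : (h : A → ℕ) (k : ℕ) (xs : List A) {n : ℕ} → map h xs ≡ upTo n → sel h k xs ≡ toList (nth xs k)
sel-nth h k xs {n} e = go 0 k xs n e
  where
  go : ∀ c k xs n → map h xs ≡ applyUpTo (c +_) n → sel h (c + k) xs ≡ toList (nth xs k)
  go c k [] n e = refl
  go c zero (x ∷ xs) (suc n) e = trans (sel-accept h xs (∷-injectiveˡ e)) (cong (x ∷_) (filter-none _ above))
    where
    above : All (λ y → h y ≢ c + 0) xs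
    above = AllP.map⁻ (subst (All (_≢ c + 0)) (sym (∷-injectiveʳ e))
      (AllP.applyUpTo⁺₂ _ n (λ i q → <-irrefl (sym q) (+-monoʳ-< c (s≤s z≤n)))))
  go c (suc k) (x ∷ xs) (suc n) e = trans (sel-reject h xs (λ q → <-irrefl (trans (sym (∷-injectiveˡ e)) q) (+-monoʳ-< c (s≤s z≤n))))
    (trans (cong (λ i → sel h i xs) (+-suc c k)) (go (suc c) k xs n
      (trans (∷-injectiveʳ e) (trans (sym (map-upTo _ n)) (trans (map-cong (λ i → +-suc c i) (upTo n)) (map-upTo _ n))))))

import Relation.Binary.Construct.Closure.Equivalence as Eq

-- Knuth equivalence

SymStep : List ℕ → List ℕ → Set
SymStep = SymClosure KnuthStep

~-sym : ∀ {w w′} → KnuthEq w w′ → KnuthEq w′ w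
~-sym = Eq.symmetric KnuthStep

~-reflexive : ∀ {w w′} → w ≡ w′ → KnuthEq w w′
~-reflexive refl = ε

step-++ : ∀ p s {w w′} → KnuthStep w w′ → KnuthStep (p ++ w ++ s) (p ++ w′ ++ s)
step-++ p s (k1 u v {x} {y} {z} l m) = subst₂ KnuthStep (shuffle y z x) (shuffle y x z) (k1 (p ++ u) (v ++ s) l m)
  where
  shuffle : ∀ a b c → (p ++ u) ++ a ∷ b ∷ c ∷ v ++ s ≡ p ++ (u ++ a ∷ b ∷ c ∷ v) ++ s
  shuffle a b c = trans (++-assoc p u _) (cong (p ++_) (sym (++-assoc u (a ∷ b ∷ c ∷ v) s)))
step-++ p s (k2 u v {x} {y} {z} l m) = subst₂ KnuthStep (shuffle x z y) (shuffle z x y) (k2 (p ++ u) (v ++ s) l m)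
  where
  shuffle : ∀ a b c → (p ++ u) ++ a ∷ b ∷ c ∷ v ++ s ≡ p ++ (u ++ a ∷ b ∷ c ∷ v) ++ s
  shuffle a b c = trans (++-assoc p u _) (cong (p ++_) (sym (++-assoc u (a ∷ b ∷ c ∷ v) s)))

~-++ : ∀ p s {w w′} → KnuthEq w w′ → KnuthEq (p ++ w ++ s) (p ++ w′ ++ s)
~-++ p s = Eq.gmap (λ w → p ++ w ++ s) (step-++ p s)

~-++ˡ : ∀ p {w w′} → KnuthEq w w′ → KnuthEq (p ++ w) (p ++ w′)
~-++ˡ p {w} {w′} e = subst₂ (λ a b → KnuthEq (p ++ a) (p ++ b)) (++-identityʳ w) (++-identityʳ w′) (~-++ p [] e)

step-↭ : ∀ {w w′} → KnuthStep w w′ → w ↭ w′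
step-↭ (k1 u v {x} {y} {z} _ _) = PermP.++⁺ˡ u (prep y (swap z x ↭-refl))
step-↭ (k2 u v {x} {y} {z} _ _) = PermP.++⁺ˡ u (swap x z ↭-refl)

symStep-↭ : ∀ {w w′} → SymStep w w′ → w ↭ w′
symStep-↭ (fwd s) = step-↭ s
symStep-↭ (bwd s) = ↭-sym (step-↭ s)

~⇒↭ : ∀ {w w′} → KnuthEq w w′ → w ↭ w′
~⇒↭ ε        = ↭-refl
~⇒↭ (s ◅ ss) = ↭-trans (symStep-↭ s) (~⇒↭ ss)

reverse-triple : (f : ℕ → ℕ) (u v : List ℕ) (a b c : ℕ) →
  map f (reverse (u ++ a ∷ b ∷ c ∷ v)) ≡ map f (reverse v) ++ f c ∷ f b ∷ f a ∷ map f (reverse u)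
reverse-triple f u v a b c = begin
  map f (reverse (u ++ a ∷ b ∷ c ∷ v))   ≡⟨ cong (map f) (reverse-++ u (a ∷ b ∷ c ∷ v)) ⟩
  map f (reverse (a ∷ b ∷ c ∷ v) ++ reverse u) ≡⟨ cong (λ l → map f (l ++ reverse u)) (reverse-++ (a ∷ b ∷ c ∷ []) v) ⟩
  map f ((reverse v ++ c ∷ b ∷ a ∷ []) ++ reverse u) ≡⟨ cong (map f) (++-assoc (reverse v) (c ∷ b ∷ a ∷ []) (reverse u)) ⟩
  map f (reverse v ++ c ∷ b ∷ a ∷ reverse u) ≡⟨ map-++ f (reverse v) _ ⟩
  map f (reverse v) ++ f c ∷ f b ∷ f a ∷ map f (reverse u) ∎
  where open ≡-Reasoning

-- Reversing a word and reversing the order of its letters (both at once) exchanges the two kinds of Knuth moves.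
module _ (f : ℕ → ℕ) where

  reverse-k1 : ∀ u v {x y z} → f z ≤ f y → f y < f x →
    SymStep (map f (reverse (u ++ y ∷ z ∷ x ∷ v))) (map f (reverse (u ++ y ∷ x ∷ z ∷ v)))
  reverse-k1 u v {x} {y} {z} l m = subst₂ SymStep (sym (reverse-triple f u v y z x)) (sym (reverse-triple f u v y x z))
    (bwd (k2 (map f (reverse v)) (map f (reverse u)) l m))

  reverse-k2 : ∀ u v {x y z} → f z < f y → f y ≤ f x →
    SymStep (map f (reverse (u ++ x ∷ z ∷ y ∷ v))) (map f (reverse (u ++ z ∷ x ∷ y ∷ v)))
  reverse-k2 u v {x} {y} {z} l m = subst₂ SymStep (sym (reverse-triple f u v x z y)) (sym (reverse-triple f u v z x y))
    (bwd (k1 (map f (reverse v)) (map f (reverse u)) l m))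

  map-k1 : ∀ u v {x y z} → f z < f y → f y ≤ f x →
    SymStep (map f (u ++ y ∷ z ∷ x ∷ v)) (map f (u ++ y ∷ x ∷ z ∷ v))
  map-k1 u v l m = subst₂ SymStep (sym (map-++ f u _)) (sym (map-++ f u _)) (bwd (k1 (map f u) (map f v) l m))

  map-k2 : ∀ u v {x y z} → f z ≤ f y → f y < f x →
    SymStep (map f (u ++ x ∷ z ∷ y ∷ v)) (map f (u ++ z ∷ x ∷ y ∷ v))
  map-k2 u v l m = subst₂ SymStep (sym (map-++ f u _)) (sym (map-++ f u _)) (bwd (k2 (map f u) (map f v) l m))

SymStep-sym : ∀ {w w′} → SymStep w w′ → SymStep w′ w
SymStep-sym (fwd s) = bwd s
SymStep-sym (bwd s) = fwd s

complement : ℕ → List ℕ → List ℕ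
complement a w = map (λ x → suc a ∸ x) (reverse w)

-- The bound by `a` keeps the truncated subtraction strictly decreasing on the letters of the move;
-- letters from `suc a` on would all be sent to 0.
complement-step : ∀ a {w w′} → All (_≤ a) w → KnuthStep w w′ → SymStep (complement a w) (complement a w′)
complement-step a ps (k1 u v {x} {y} {z} l m) with py ∷ _ ← AllP.++⁻ʳ u ps =
  reverse-k1 (λ x → suc a ∸ x) u v (∸-monoʳ-≤ (suc a) m) (∸-monoʳ-< l (m≤n⇒m≤1+n py))
complement-step a ps (k2 u v {x} {y} {z} l m) with _ ∷ pz ∷ _ ← AllP.++⁻ʳ u ps =
  reverse-k2 (λ x → suc a ∸ x) u v (∸-monoʳ-< m (m≤n⇒m≤1+n pz)) (∸-monoʳ-≤ (suc a) l)

complement-~ : ∀ a {w w′} → All (_≤ a) w → KnuthEq w w′ → KnuthEq (complement a w) (complement a w′)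
complement-~ a ps ε = ε
complement-~ a ps (fwd s ◅ ss) = complement-step a ps s ◅ complement-~ a (PermP.All-resp-↭ (step-↭ s) ps) ss
complement-~ a ps (bwd s ◅ ss) = SymStep-sym (complement-step a ps′ s) ◅ complement-~ a ps′ ss
  where ps′ = PermP.All-resp-↭ (↭-sym (step-↭ s)) ps

-- Prefix dominance of consecutive letters under Knuth moves

module Dominance (k : ℕ) where

  δ δ⁺ : ℕ → ℕ
  δ  x = count k [ x ]
  δ⁺ x = count (suc k) [ x ]

  -- The counters `i` and `j` for the letters `k` and `suc k` read so far are carried along, so that
  -- a move deep inside a word changes just one of the listed inequalities, the one between the two
  -- exchanged letters. The larger letter is the dominant one because the lattice condition arrives
  -- here in complemented form.
  Dom : ℕ → ℕ → List ℕ → Set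
  Dom i j []      = i ≤ j
  Dom i j (x ∷ w) = i ≤ j × Dom (i + δ x) (j + δ⁺ x) w

  δ-no : ∀ {x} → x ≢ k → δ x ≡ 0
  δ-no = count-∷-≢ []

  δ-yes : ∀ {x} → x ≡ k → δ x ≡ 1
  δ-yes = count-∷-≡ []

  δ⁺-no : ∀ {x} → x ≢ suc k → δ⁺ x ≡ 0
  δ⁺-no = count-∷-≢ []

  δ⁺-yes : ∀ {x} → x ≡ suc k → δ⁺ x ≡ 1
  δ⁺-yes = count-∷-≡ []

  head-≤ : ∀ {i j} w → Dom i j w → i ≤ j
  head-≤ []      p = p
  head-≤ (x ∷ w) p = proj₁ p

  other : ∀ {x i j} → x ≢ k → i ≤ j → i + δ x ≤ j + δ⁺ x
  other {x} {i} {j} n p rewrite δ-no n | +-identityʳ i = ≤-trans p (m≤m+n j _)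

  shift-right : ∀ i a b → (i + a) + b ≡ (i + b) + a
  shift-right i a b = trans (+-assoc i a b) (trans (cong (i +_) (+-comm a b)) (sym (+-assoc i b a)))

  Dom-swap : ∀ i j a b w → Dom ((i + δ a) + δ b) ((j + δ⁺ a) + δ⁺ b) w → Dom ((i + δ b) + δ a) ((j + δ⁺ b) + δ⁺ a) w
  Dom-swap i j a b w = subst₂ (λ m n → Dom m n w) (shift-right i (δ a) (δ b)) (shift-right j (δ⁺ a) (δ⁺ b))

  skip : ∀ {x i j} → x ≢ k → x ≢ suc k → i + δ x ≤ j + δ⁺ x → i ≤ j
  skip {x} {i} {j} n n⁺ p rewrite δ-no n | δ⁺-no n⁺ | +-identityʳ i | +-identityʳ j = p

  -- The only new prefix ends in `y x`, and only `x = k` can spoil it. If `y = suc k`, that letter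
  -- pays for `x`; otherwise `z` exceeds `suc k`, and the prefix has the same balance as the old one
  -- ending in `y z x`.
  k1-fwd : ∀ {i j x y z} v → x < y → y ≤ z → Dom i j (y ∷ z ∷ x ∷ v) → Dom i j (y ∷ x ∷ z ∷ v)
  k1-fwd {i} {j} {x} {y} {z} v l m (p , q , r , s) = p , q , mid , Dom-swap (i + δ y) (j + δ⁺ y) z x v s
    where
    mid : i + δ y + δ x ≤ j + δ⁺ y + δ⁺ x
    mid with x ≟ k | y ≟ suc k
    ... | no n     | _     = other n q
    ... | yes refl | yes e rewrite δ-no {y} (λ f → 1+n≢n (trans (sym e) f)) | δ-yes {k} refl | δ⁺-yes e | +-identityʳ i
        = ≤-trans (+-monoˡ-≤ 1 p) (m≤m+n (j + 1) _)
    ... | yes refl | no n  = skip {z} (λ f → <⇒≢ (<-≤-trans l m) (sym f)) (λ f → <⇒≢ (<-≤-trans (≤∧≢⇒< l (n ∘ sym)) m) (sym f))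
        (subst₂ _≤_ (shift-right (i + δ y) (δ z) (δ x)) (shift-right (j + δ⁺ y) (δ⁺ z) (δ⁺ x)) (head-≤ v s))

  k1-bwd : ∀ {i j x y z} v → x < y → y ≤ z → Dom i j (y ∷ x ∷ z ∷ v) → Dom i j (y ∷ z ∷ x ∷ v)
  k1-bwd {i} {j} {x} {y} {z} v l m (p , q , r , s) = p , q , mid , Dom-swap (i + δ y) (j + δ⁺ y) x z v s
    where
    mid : i + δ y + δ z ≤ j + δ⁺ y + δ⁺ z
    mid with z ≟ k
    ... | no n     = other n q
    ... | yes refl = skip {x} (<⇒≢ (<-≤-trans l m)) (<⇒≢ (<-≤-trans l (m≤n⇒m≤1+n m)))
        (subst₂ _≤_ (shift-right (i + δ y) (δ x) (δ z)) (shift-right (j + δ⁺ y) (δ⁺ x) (δ⁺ z)) (head-≤ v s))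

  k2-fwd : ∀ {i j x y z} v → x ≤ y → y < z → Dom i j (x ∷ z ∷ y ∷ v) → Dom i j (z ∷ x ∷ y ∷ v)
  k2-fwd {i} {j} {x} {y} {z} v l m (p , q , r , s) = p , mid , Dom-swap i j x z (y ∷ v) (r , s)
    where
    mid : i + δ z ≤ j + δ⁺ z
    mid with z ≟ k
    ... | no n     = other n p
    ... | yes refl = skip {x} (<⇒≢ (≤-<-trans l m)) (<⇒≢ (≤-<-trans l (m≤n⇒m≤1+n m)))
        (subst₂ _≤_ (shift-right i (δ x) (δ z)) (shift-right j (δ⁺ x) (δ⁺ z)) r)

  k2-bwd : ∀ {i j x y z} v → x ≤ y → y < z → Dom i j (z ∷ x ∷ y ∷ v) → Dom i j (x ∷ z ∷ y ∷ v)
  k2-bwd {i} {j} {x} {y} {z} v l m (p , q , r , s) = p , mid , Dom-swap i j z x (y ∷ v) (r , s)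
    where
    mid : i + δ x ≤ j + δ⁺ x
    mid with x ≟ k | z ≟ suc k
    ... | no n     | _     = other n p
    ... | yes refl | no n  = skip {z} (λ f → <⇒≢ (≤-<-trans l m) (sym f)) n
        (subst₂ _≤_ (shift-right i (δ z) (δ x)) (shift-right j (δ⁺ z) (δ⁺ x)) r)
    -- Here `x ≤ y < z = suc k` forces `y = k`. The old prefix ending in `z x y` holds two letters
    -- `k` against one `suc k`, and this surplus yields the inequality after `x` alone.
    ... | yes refl | yes e with refl ← ≤-antisym l (s≤s⁻¹ (≤-trans m (≤-reflexive e))) | h ← head-≤ v s
        rewrite δ-no {z} (λ f → 1+n≢n (trans (sym e) f)) | δ-yes {k} refl | δ⁺-no {k} (1+n≢n ∘ sym) | δ⁺-yes e
              | +-identityʳ i | +-identityʳ (j + 1) | +-identityʳ (j + 1) | +-comm (i + 1) 1 | +-comm j 1 | +-identityʳ j = s≤s⁻¹ h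

  Dom-++ : ∀ {v v′} → (∀ {i j} → Dom i j v → Dom i j v′) → ∀ u {i j} → Dom i j (u ++ v) → Dom i j (u ++ v′)
  Dom-++ f []      p       = f p
  Dom-++ f (x ∷ u) (p , q) = p , Dom-++ f u q

  Dom-~ : ∀ {i j w w′} → KnuthEq w w′ → Dom i j w → Dom i j w′
  Dom-~ ε                       p = p
  Dom-~ (fwd (k1 u v l m) ◅ ss) p = Dom-~ ss (Dom-++ (k1-fwd v l m) u p)
  Dom-~ (bwd (k1 u v l m) ◅ ss) p = Dom-~ ss (Dom-++ (k1-bwd v l m) u p)
  Dom-~ (fwd (k2 u v l m) ◅ ss) p = Dom-~ ss (Dom-++ (k2-fwd v l m) u p)
  Dom-~ (bwd (k2 u v l m) ◅ ss) p = Dom-~ ss (Dom-++ (k2-bwd v l m) u p)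

  Dom⇒prefix : ∀ {i j} w → Dom i j w → ∀ n → i + count k (take n w) ≤ j + count (suc k) (take n w)
  Dom⇒prefix w       p       zero    = subst₂ _≤_ (sym (+-identityʳ _)) (sym (+-identityʳ _)) (head-≤ w p)
  Dom⇒prefix []      p       (suc n) = subst₂ _≤_ (sym (+-identityʳ _)) (sym (+-identityʳ _)) p
  Dom⇒prefix {i} {j} (x ∷ w) (p , q) (suc n) = subst₂ _≤_
    (trans (+-assoc i (δ x) _) (cong (i +_) (sym (count-++ k [ x ] (take n w)))))
    (trans (+-assoc j (δ⁺ x) _) (cong (j +_) (sym (count-++ (suc k) [ x ] (take n w)))))
    (Dom⇒prefix w q n)

  prefix⇒Dom : ∀ {i j} w → (∀ n → i + count k (take n w) ≤ j + count (suc k) (take n w)) → Dom i j w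
  prefix⇒Dom []      h = subst₂ _≤_ (+-identityʳ _) (+-identityʳ _) (h 0)
  prefix⇒Dom {i} {j} (x ∷ w) h = subst₂ _≤_ (+-identityʳ _) (+-identityʳ _) (h 0) , prefix⇒Dom w (λ n → subst₂ _≤_
    (sym (trans (+-assoc i (δ x) _) (cong (i +_) (sym (count-++ k [ x ] (take n w))))))
    (sym (trans (+-assoc j (δ⁺ x) _) (cong (j +_) (sym (count-++ (suc k) [ x ] (take n w))))))
    (h (suc n)))

prefix-dominance-~ : ∀ k {w w′} → KnuthEq w w′ → (∀ n → count k (take n w) ≤ count (suc k) (take n w)) →
  ∀ n → count k (take n w′) ≤ count (suc k) (take n w′)
prefix-dominance-~ k {w} {w′} e h = Dom⇒prefix w′ (Dom-~ e (prefix⇒Dom {0} {0} w h))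
  where open Dominance k

-- Dual equivalence

AllPairs-swap : {R : A → A → Set} (u : List A) {v : List A} {a b : A} →
  AllPairs R (u ++ a ∷ b ∷ v) → R b a → AllPairs R (u ++ b ∷ a ∷ v)
AllPairs-swap []      ((_ ∷ pa) ∷ pb ∷ ps) r = (r ∷ pb) ∷ pa ∷ ps
AllPairs-swap (x ∷ u) (p ∷ ps)             r =
  PermP.All-resp-↭ (PermP.++⁺ˡ u (swap _ _ ↭-refl)) p ∷ AllPairs-swap u ps r

-- The letters p of the words are the cells of a skew shape, in the order in which its rows are read from bottom to
-- top; conv is the convexity of the shape.  A word listing the cells so that every cell comes after the cells weakly
-- north-west of it is a standard filling of the shape.
module DualEquivalence (P : ℕ → Set) (row col : ℕ → ℕ)
  (ord  : ∀ {p q} → P p → P q → p < q → row q < row p ⊎ (row p ≡ row q × col p < col q))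
  (conv : ∀ {p q} → P p → P q → row p < row q → col p < col q →
          (∃ λ s → P s × row s ≡ row p × col s ≡ col q) × (∃ λ s → P s × row s ≡ row q × col s ≡ col p))
  (g : ℕ → ℕ) (g-antitone : ∀ {p q} → col p ≤ col q → g q ≤ g p)
  (g-strict : ∀ {p q} → P p → P q → col p < col q → g q < g p)
  where

  infix 4 _⊑_ _⋢_
  _⊑_ _⋢_ : ℕ → ℕ → Set
  p ⊑ q = row p ≤ row q × col p ≤ col q
  p ⋢ q = ¬ (p ⊑ q)

  record Standard (w : List ℕ) : Set where
    field
      valid    : All P w
      complete : ∀ {p} → P p → p ∈ w
      linear   : AllPairs (λ p q → q ⋢ p) w
  open Standard

  -- On the three cells of a move, both `g` and the row index run against the cell numbers. The
  -- column image keeps the word, and a move becomes the inverse of a move of the same kind; the row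
  -- image also reverses the word, which exchanges the two kinds.
  Images : List ℕ → List ℕ → Set
  Images w w′ = KnuthEq (map g w) (map g w′) × KnuthEq (map (suc ∘ row) (reverse w)) (map (suc ∘ row) (reverse w′))

  -- No two opposite corners of a rectangle can be separated by at most one other cell.
  corners : ∀ {u v a b c p q o} → Standard (u ++ a ∷ b ∷ c ∷ v) → P p → P q →
    All (p ⋢_) u → All (_⋢ q) v → (∀ {s} → s ∈ a ∷ b ∷ c ∷ [] → s ≡ p ⊎ s ≡ q ⊎ s ≡ o) →
    row p < row q → col p < col q → ⊥
  corners {u} {v} {a} {b} {c} {p} {q} {o} S Pp Pq before after three rp cp with conv Pp Pq rp cp
  ... | (s , Ps , rs , cs) , (t , Pt , rt , ct) = <-irrefl (trans (sym rs) (trans (cong row (trans s≡o (sym t≡o))) rt)) rp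
    where
    locate : ∀ {r} → P r → p ⊑ r → r ⊑ q → r ≡ p ⊎ r ≡ q ⊎ r ≡ o
    locate Pr p⊑r r⊑q with ∈-++⁻ u (complete S Pr)
    ... | inj₁ r∈u                          = ⊥-elim (All.lookup before r∈u p⊑r)
    ... | inj₂ (here e)                     = three (here e)
    ... | inj₂ (there (here e))             = three (there (here e))
    ... | inj₂ (there (there (here e)))     = three (there (there (here e)))
    ... | inj₂ (there (there (there r∈v)))  = ⊥-elim (All.lookup after r∈v r⊑q)
    s≡o : s ≡ o
    s≡o with locate Ps (≤-reflexive (sym rs) , ≤-trans (<⇒≤ cp) (≤-reflexive (sym cs))) (≤-trans (≤-reflexive rs) (<⇒≤ rp) , ≤-reflexive cs)
    ... | inj₁ refl        = ⊥-elim (<-irrefl cs cp)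
    ... | inj₂ (inj₁ refl) = ⊥-elim (<-irrefl (sym rs) rp)
    ... | inj₂ (inj₂ e)    = e
    t≡o : t ≡ o
    t≡o with locate Pt (≤-trans (<⇒≤ rp) (≤-reflexive (sym rt)) , ≤-reflexive (sym ct)) (≤-reflexive rt , ≤-trans (≤-reflexive ct) (<⇒≤ cp))
    ... | inj₁ refl        = ⊥-elim (<-irrefl rt rp)
    ... | inj₂ (inj₁ refl) = ⊥-elim (<-irrefl (sym ct) cp)
    ... | inj₂ (inj₂ e)    = e

  pairs : ∀ u {a b c v} → AllPairs (λ p q → q ⋢ p) (u ++ a ∷ b ∷ c ∷ v) →
    (b ⋢ a × c ⋢ a × c ⋢ b) × All (λ s → a ⋢ s × b ⋢ s × c ⋢ s) u × All (λ s → s ⋢ a × s ⋢ b × s ⋢ c) v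
  pairs u ps with _ , ((ba ∷ ca ∷ va) ∷ (cb ∷ vb) ∷ vc ∷ _) , cross ← AllPairs-++⁻ u ps =
    (ba , ca , cb) , All.map (λ { (p ∷ q ∷ r ∷ _) → p , q , r }) cross , All.zip (va , All.zip (vb , vc))

  lower : ∀ {p q} → P p → P q → p < q → p ⋢ q → row q < row p
  lower Pp Pq l n with ord Pp Pq l
  ... | inj₁ r       = r
  ... | inj₂ (e , c) = ⊥-elim (n (≤-reflexive e , <⇒≤ c))

  weakly-above : ∀ {p q} → P p → P q → p < q → row q ≤ row p
  weakly-above Pp Pq l with ord Pp Pq l
  ... | inj₁ r       = <⇒≤ r
  ... | inj₂ (e , c) = ≤-reflexive (sym e)

  ⋢⇒≢ : ∀ {p q} → p ⋢ q → p ≢ q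
  ⋢⇒≢ n refl = n (≤-refl , ≤-refl)

  -- Three comparisons are read off: `x < y` with `x` not north-west of `y` puts `y` strictly
  -- higher; `z` comes later in reading order, hence weakly higher than `y`; not being north-west of
  -- `y`, it then lies strictly to the right. Only `col x ≤ col y` calls for `corners`, with `y` and
  -- `x` as the corners and `z` as the remaining cell.
  k1-position : ∀ {u v a b c x y z} → Standard (u ++ a ∷ b ∷ c ∷ v) → P x → P y → P z → x < y → y ≤ z →
    x ⋢ y → z ⋢ y → All (y ⋢_) u → All (_⋢ x) v → (∀ {s} → s ∈ a ∷ b ∷ c ∷ [] → s ≡ y ⊎ s ≡ x ⊎ s ≡ z) →
    (row y < row x × row z ≤ row y) × (col y < col z × col x ≤ col y)
  k1-position S Px Py Pz l m x⋢y z⋢y before after three =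
    (ryx , rzy) , ≰⇒> (λ c → z⋢y (rzy , c)) , ≮⇒≥ (corners S Py Px before after three ryx)
    where
    ryx = lower Px Py l x⋢y
    rzy = weakly-above Py Pz (≤∧≢⇒< m (⋢⇒≢ z⋢y ∘ sym))

  k2-position : ∀ {u v a b c x y z} → Standard (u ++ a ∷ b ∷ c ∷ v) → P x → P y → P z → x ≤ y → y < z →
    y ⋢ x → y ⋢ z → All (z ⋢_) u → All (_⋢ y) v → (∀ {s} → s ∈ a ∷ b ∷ c ∷ [] → s ≡ z ⊎ s ≡ y ⊎ s ≡ x) →
    (row z < row y × row y ≤ row x) × (col x < col y × col y ≤ col z)
  k2-position S Px Py Pz l m y⋢x y⋢z before after three =
    (rzy , ryx) , ≰⇒> (λ c → y⋢x (ryx , c)) , ≮⇒≥ (corners S Pz Py before after three rzy)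
    where
    rzy = lower Py Pz m y⋢z
    ryx = weakly-above Px Py (≤∧≢⇒< l (⋢⇒≢ y⋢x ∘ sym))

  Standard-swap : ∀ {w w′} → w ↭ w′ → AllPairs (λ p q → q ⋢ p) w′ → Standard w → Standard w′
  Standard-swap e lin S = record
    { valid    = PermP.All-resp-↭ e (valid S)
    ; complete = λ Pp → PermP.∈-resp-↭ e (complete S Pp)
    ; linear   = lin }

  swap₂₃ : ∀ u {v a b c} → AllPairs (λ p q → q ⋢ p) (u ++ a ∷ b ∷ c ∷ v) → b ⋢ c →
    AllPairs (λ p q → q ⋢ p) (u ++ a ∷ c ∷ b ∷ v)
  swap₂₃ u {v} {a} {b} {c} lin n = subst (AllPairs _) (++-assoc u [ a ] (c ∷ b ∷ v))
    (AllPairs-swap (u ++ [ a ]) (subst (AllPairs _) (sym (++-assoc u [ a ] (b ∷ c ∷ v))) lin) n)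

  image : ∀ {w w′} → SymStep (map g w) (map g w′) → SymStep (map (suc ∘ row) (reverse w)) (map (suc ∘ row) (reverse w′)) → Images w w′
  image s t = (s ◅ ε) , (t ◅ ε)

  -- By the positions just found the exchanged cells may stand in either order, so the new word is
  -- again a standard filling and the induction along the chain can go on. A move and its inverse
  -- meet the same configuration, only with the three cells listed differently.
  step : ∀ {w w′} → SymStep w w′ → Standard w → Standard w′ × Images w w′
  step (fwd (k1 u v {x} {y} {z} l m)) S with Py ∷ Pz ∷ Px ∷ _ ← AllP.++⁻ʳ u (valid S)
    | (z⋢y , x⋢y , _) , us , vs ← pairs u (linear S)
    with (r₁ , r₂) , (c₁ , c₂) ← k1-position S Px Py Pz l m x⋢y z⋢y (All.map proj₁ us) (All.map (proj₂ ∘ proj₂) vs)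
           (λ { (here e) → inj₁ e ; (there (here e)) → inj₂ (inj₂ e) ; (there (there (here e))) → inj₂ (inj₁ e) }) =
    Standard-swap (step-↭ (k1 u v l m)) (swap₂₃ u (linear S) (λ (_ , c) → <⇒≱ (≤-<-trans c₂ c₁) c)) S ,
    image (map-k1 g u v (g-strict Py Pz c₁) (g-antitone c₂)) (reverse-k1 (suc ∘ row) u v (s≤s r₂) (s≤s r₁))
  step (bwd (k1 u v {x} {y} {z} l m)) S with Py ∷ Px ∷ Pz ∷ _ ← AllP.++⁻ʳ u (valid S)
    | (x⋢y , z⋢y , _) , us , vs ← pairs u (linear S)
    with (r₁ , r₂) , (c₁ , c₂) ← k1-position S Px Py Pz l m x⋢y z⋢y (All.map proj₁ us) (All.map (proj₁ ∘ proj₂) vs)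
           (λ { (here e) → inj₁ e ; (there (here e)) → inj₂ (inj₁ e) ; (there (there (here e))) → inj₂ (inj₂ e) }) =
    Standard-swap (↭-sym (step-↭ (k1 u v l m))) (swap₂₃ u (linear S) (λ (r , _) → <⇒≱ (≤-<-trans r₂ r₁) r)) S ,
    image (SymStep-sym (map-k1 g u v (g-strict Py Pz c₁) (g-antitone c₂))) (SymStep-sym (reverse-k1 (suc ∘ row) u v (s≤s r₂) (s≤s r₁)))
  step (fwd (k2 u v {x} {y} {z} l m)) S with Px ∷ Pz ∷ Py ∷ _ ← AllP.++⁻ʳ u (valid S)
    | (_ , y⋢x , y⋢z) , us , vs ← pairs u (linear S)
    with (r₁ , r₂) , (c₁ , c₂) ← k2-position S Px Py Pz l m y⋢x y⋢z (All.map (proj₁ ∘ proj₂) us) (All.map (proj₂ ∘ proj₂) vs)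
           (λ { (here e) → inj₂ (inj₂ e) ; (there (here e)) → inj₁ e ; (there (there (here e))) → inj₂ (inj₁ e) }) =
    Standard-swap (step-↭ (k2 u v l m)) (AllPairs-swap u (linear S) (λ (r , _) → <⇒≱ (<-≤-trans r₁ r₂) r)) S ,
    image (map-k2 g u v (g-antitone c₂) (g-strict Px Py c₁)) (reverse-k2 (suc ∘ row) u v (s≤s r₁) (s≤s r₂))
  step (bwd (k2 u v {x} {y} {z} l m)) S with Pz ∷ Px ∷ Py ∷ _ ← AllP.++⁻ʳ u (valid S)
    | (_ , y⋢z , y⋢x) , us , vs ← pairs u (linear S)
    with (r₁ , r₂) , (c₁ , c₂) ← k2-position S Px Py Pz l m y⋢x y⋢z (All.map proj₁ us) (All.map (proj₂ ∘ proj₂) vs)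
           (λ { (here e) → inj₁ e ; (there (here e)) → inj₂ (inj₂ e) ; (there (there (here e))) → inj₂ (inj₁ e) }) =
    Standard-swap (↭-sym (step-↭ (k2 u v l m))) (AllPairs-swap u (linear S) (λ (_ , c) → <⇒≱ (<-≤-trans c₁ c₂) c)) S ,
    image (SymStep-sym (map-k2 g u v (g-antitone c₂) (g-strict Px Py c₁))) (SymStep-sym (reverse-k2 (suc ∘ row) u v (s≤s r₁) (s≤s r₂)))

  images : ∀ {w w′} → Standard w → KnuthEq w w′ → Images w w′
  images S ε = ε , ε
  images S (s ◅ ss) with S′ , i , j ← step s S with i′ , j′ ← images S′ ss = i ◅◅ i′ , j ◅◅ j′

-- Row reading and column reading of a straight tableau

rowOf : List (List ℕ) → ℕ → List ℕ
rowOf Cs k = concatMap (λ c → toList (nth c k)) Cs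

infix 4 _≼_
-- The relation between columns of a straight semistandard tableau. The existence of the left entry
-- also says that column lengths do not grow, so the gaps skipped by `rowOf` lie at the end of each
-- row.
record _≼_ (c c′ : List ℕ) : Set where
  constructor mk≼
  field row-≤ : ∀ k {y} → nth c′ k ≡ just y → ∃ λ x → nth c k ≡ just x × x ≤ y
open _≼_ public

-- While `h` moves left, each entry that it passes has its left neighbour in the row as witness of
-- the move: larger than `h` and at most the entry passed.
insert-entry : ∀ {h y} t → AllPairs _≤_ (y ∷ t) → h < y → KnuthEq (y ∷ t ++ [ h ]) (y ∷ h ∷ t)
insert-entry []      _                    _   = ε
insert-entry (z ∷ t) ((y≤z ∷ _) ∷ sorted) h<y =
  ~-++ˡ [ _ ] (insert-entry t sorted (<-≤-trans h<y y≤z)) ◅◅ (fwd (k1 [] t h<y y≤z) ◅ ε)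

-- Think of `y ∷ hs` as a column read upwards and of `y ∷ t` as the row of its lowest entry. The
-- entry moved last becomes the new head of the row and is the witness for the next, smaller one.
insert-column : ∀ {y} t hs → AllPairs _≤_ (y ∷ t) → AllPairs _>_ (y ∷ hs) → KnuthEq (y ∷ t ++ hs) (y ∷ hs ++ t)
insert-column t []       _            _                     = ~-reflexive (cong (_ ∷_) (++-identityʳ t))
insert-column {y} t (h ∷ hs) (py ∷ sorted) ((h<y ∷ _) ∷ desc) =
  ~-reflexive (cong (y ∷_) (sym (++-assoc t [ h ] hs)))
  ◅◅ ~-++ [] hs (insert-entry t (py ∷ sorted) h<y)
  ◅◅ ~-++ˡ [ y ] (insert-column t hs (All.map (≤-trans (<⇒≤ h<y)) py ∷ sorted) desc)

All-rowOf : ∀ {c Cs k y} → All (c ≼_) Cs → nth c k ≡ just y → All (y ≤_) (rowOf Cs k)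
All-rowOf [] p = []
All-rowOf {c} {c′ ∷ Cs} {k} (q ∷ qs) p with nth c′ k in eq
... | nothing = All-rowOf qs p
... | just z with x , p′ , x≤z ← row-≤ q k eq = ≤-trans (≤-reflexive (just-injective (trans (sym p) p′))) x≤z ∷ All-rowOf qs p

rowOf-empty : ∀ {c Cs k} → All (c ≼_) Cs → nth c k ≡ nothing → rowOf Cs k ≡ []
rowOf-empty [] p = refl
rowOf-empty {c} {c′ ∷ Cs} {k} (q ∷ qs) p with nth c′ k in eq
... | nothing = rowOf-empty qs p
... | just z with x , p′ , _ ← row-≤ q k eq with () ← trans (sym p) p′

rowOf-sorted : ∀ {Cs} k → AllPairs _≼_ Cs → AllPairs _≤_ (rowOf Cs k)
rowOf-sorted k [] = []
rowOf-sorted {c ∷ Cs} k (p ∷ ps) with nth c k in eq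
... | nothing = rowOf-sorted k ps
... | just y  = All-rowOf p eq ∷ rowOf-sorted k ps

rowOf-strict : ∀ {Cs k} → AllPairs _≼_ Cs → All (AllPairs _<_) Cs →
  ∀ j {y} → nth (rowOf Cs (suc k)) j ≡ just y → ∃ λ x → nth (rowOf Cs k) j ≡ just x × x < y
rowOf-strict {c ∷ Cs} {k} (p ∷ ps) (q ∷ qs) j e with nth c (suc k) in eq
... | nothing rewrite rowOf-empty {k = suc k} p eq with () ← e
... | just z with nth-< c (<-trans (n<1+n k) (nth-just-< c eq))
...   | x , eq′ rewrite eq′ with j | e
...     | zero  | refl = x , refl , AllPairs-nth c q eq′ eq (n<1+n k)
...     | suc j | e′   = rowOf-strict ps qs j e′

rowOf-length : ∀ Cs k → length (rowOf Cs k) ≤ length Cs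
rowOf-length []       k = z≤n
rowOf-length (c ∷ Cs) k with nth c k
... | nothing = m≤n⇒m≤1+n (rowOf-length Cs k)
... | just _  = s≤s (rowOf-length Cs k)

All-rowOf⁺ : ∀ {P : ℕ → Set} {Cs} k → All (All P) Cs → All P (rowOf Cs k)
All-rowOf⁺ k [] = []
All-rowOf⁺ {Cs = c ∷ Cs} k (p ∷ ps) with nth c k in eq
... | nothing = All-rowOf⁺ k ps
... | just x  = All.lookup p (nth-∈ c eq) ∷ All-rowOf⁺ k ps

take-suc-nth : ∀ (xs : List ℕ) k → take (suc k) xs ≡ take k xs ++ toList (nth xs k)
take-suc-nth []       zero    = refl
take-suc-nth []       (suc k) = refl
take-suc-nth (x ∷ xs) zero    = refl
take-suc-nth (x ∷ xs) (suc k) = cong (x ∷_) (take-suc-nth xs k)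

-- Induction on the number of rows: the part of the first column above row `K` already stands in
-- front of the rows above, and `insert-column` carries it past the rest of row `K`, behind the
-- first entry of that row.
column-first : ∀ {c Cs} → All (c ≼_) Cs → AllPairs _≼_ Cs → AllPairs _<_ c → ∀ K →
  KnuthEq (concatMap (rowOf (c ∷ Cs)) (downFrom K)) (reverse (take K c) ++ concatMap (rowOf Cs) (downFrom K))
column-first p ps q zero = ε
column-first {c} {Cs} p ps q (suc K) with nth c K in eq | take-suc-nth c K
... | nothing | e rewrite rowOf-empty {k = K} p eq | e | ++-identityʳ (take K c) = column-first p ps q K
... | just y  | e rewrite e | reverse-++ (take K c) [ y ] =
  ~-++ˡ (y ∷ rowOf Cs K) (column-first p ps q K)
  ◅◅ ~-reflexive (cong (y ∷_) (sym (++-assoc (rowOf Cs K) (reverse (take K c)) _)))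
  ◅◅ ~-++ [] _ (insert-column (rowOf Cs K) (reverse (take K c)) (All-rowOf p eq ∷ rowOf-sorted K ps) desc)
  ◅◅ ~-reflexive (cong (y ∷_) (++-assoc (reverse (take K c)) (rowOf Cs K) _))
  where
  desc : AllPairs _>_ (y ∷ reverse (take K c))
  desc = subst (AllPairs _>_) (trans (cong reverse e) (reverse-++ (take K c) [ y ])) (AllPairs-reverse (APP.take⁺ (suc K) q))

row~column : ∀ {Cs} K → AllPairs _≼_ Cs → All (AllPairs _<_) Cs → All (λ c → length c ≤ K) Cs →
  KnuthEq (concatMap (rowOf Cs) (downFrom K)) (concatMap reverse Cs)
row~column {[]} K _ _ _ = ~-reflexive (empty (downFrom K))
  where
  empty : ∀ (ks : List ℕ) → concatMap (rowOf []) ks ≡ []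
  empty []       = refl
  empty (k ∷ ks) = empty ks
row~column {c ∷ Cs} K (p ∷ ps) (q ∷ qs) (l ∷ ls) =
  column-first p ps q K
  ◅◅ ~-reflexive (cong (λ d → reverse d ++ concatMap (rowOf Cs) (downFrom K)) (take-all K c l))
  ◅◅ ~-++ˡ (reverse c) (row~column K ps qs ls)

-- Cells of a tableau in reading order, and convexity of skew shapes

record Cell : Set where
  constructor ⟨_,_,_⟩
  field
    row col val : ℕ
open Cell public

place : Cell → ℕ × ℕ
place e = row e , col e

rowCells : ℕ → ℕ → List ℕ → List Cell
rowCells r c []       = []
rowCells r c (x ∷ xs) = ⟨ r , suc c , x ⟩ ∷ rowCells r (suc c) xs

-- Listed from the bottom row up, so that the values spell `rowWord`. As in `entry`, `row` counts
-- from 0 and `col` from 1.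
cellsFrom : ℕ → Tab → List Cell
cellsFrom i []               = []
cellsFrom i ((off , es) ∷ T) = cellsFrom (suc i) T ++ rowCells i off es

cells : Tab → List Cell
cells = cellsFrom 0

rowCells-val : ∀ r c es → map val (rowCells r c es) ≡ es
rowCells-val r c []       = refl
rowCells-val r c (x ∷ es) = cong (x ∷_) (rowCells-val r (suc c) es)

rowWord-∷ : ∀ row T → rowWord (row ∷ T) ≡ rowWord T ++ proj₂ row
rowWord-∷ row T = begin
  concat (reverse (proj₂ row ∷ map proj₂ T)) ≡⟨ cong concat (unfold-reverse (proj₂ row) (map proj₂ T)) ⟩
  concat (reverse (map proj₂ T) ∷ʳ proj₂ row) ≡⟨ concat-++ (reverse (map proj₂ T)) [ proj₂ row ] ⟨
  rowWord T ++ (proj₂ row ++ []) ≡⟨ cong (rowWord T ++_) (++-identityʳ _) ⟩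
  rowWord T ++ proj₂ row ∎
  where open ≡-Reasoning

cellsFrom-val : ∀ i T → map val (cellsFrom i T) ≡ rowWord T
cellsFrom-val i [] = refl
cellsFrom-val i ((off , es) ∷ T) = trans (map-++ val (cellsFrom (suc i) T) (rowCells i off es))
  (trans (cong₂ _++_ (cellsFrom-val (suc i) T) (rowCells-val i off es)) (sym (rowWord-∷ (off , es) T)))

cells-val : ∀ T → map val (cells T) ≡ rowWord T
cells-val = cellsFrom-val 0

yam-reverse : ∀ T → yam T ≡ reverse (rowWord T)
yam-reverse []        = refl
yam-reverse (row ∷ T) = trans (cong (reverse (proj₂ row) ++_) (yam-reverse T))
  (trans (sym (reverse-++ (rowWord T) (proj₂ row))) (cong reverse (sym (rowWord-∷ row T))))

yam-cells : ∀ T → yam T ≡ map val (reverse (cells T))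
yam-cells T = trans (yam-reverse T) (trans (cong reverse (sym (cells-val T))) (sym (reverse-map val (cells T))))

rowCells-All : ∀ r c es → All (λ e → row e ≡ r × c < col e) (rowCells r c es)
rowCells-All r c []       = []
rowCells-All r c (x ∷ es) = (refl , ≤-refl) ∷ All.map (λ (p , q) → p , <⇒≤ q) (rowCells-All r (suc c) es)

replicate-sel : ∀ k r es → replicate (count k es) (suc r) ≡ map (suc ∘ row) (reverse (sel val k (rowCells r 0 es)))
replicate-sel k r es = trans (cong (λ n → replicate n (suc r)) len) (sym (constant (reverse xs) (PermP.All-resp-↭ (↭-sym (PermP.↭-reverse xs)) (AllP.filter⁺ (λ e → val e ≟ k) (All.map proj₁ (rowCells-All r 0 es))))))
  where
  xs = sel val k (rowCells r 0 es)
  len : count k es ≡ length (reverse xs)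
  len = trans (cong (count k) (sym (rowCells-val r 0 es))) (trans (count-map val k (rowCells r 0 es)) (sym (length-reverse xs)))
  constant : ∀ ys → All (λ e → row e ≡ r) ys → map (suc ∘ row) ys ≡ replicate (length ys) (suc r)
  constant []       []       = refl
  constant (y ∷ ys) (p ∷ ps) = cong₂ _∷_ (cong suc p) (constant ys ps)

rowCells-sel-row : ∀ k r c c′ es → map row (reverse (sel val k (rowCells r c es))) ≡ map row (reverse (sel val k (rowCells r c′ es)))
rowCells-sel-row k r c c′ es = trans (reverse-map row (sel val k (rowCells r c es)))
  (trans (cong reverse (go c c′ es)) (sym (reverse-map row (sel val k (rowCells r c′ es)))))
  where
  go : ∀ c c′ es → map row (sel val k (rowCells r c es)) ≡ map row (sel val k (rowCells r c′ es))
  go c c′ [] = refl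
  go c c′ (x ∷ es) with does (x ≟ k)
  ... | true  = cong (r ∷_) (go (suc c) (suc c′) es)
  ... | false = go (suc c) (suc c′) es

-- The selection runs through the reversed reading order, so the rows come out weakly increasing as
-- in a row of the companion. Later work on companions starts from this form.
compRow-cells : ∀ T k → compRow T k ≡ map (suc ∘ row) (sel val k (reverse (cells T)))
compRow-cells T k = go id 0 (λ t → refl) T
  where
  go : (g : ℕ → ℕ) (i : ℕ) → (∀ t → g t ≡ i + t) → ∀ T →
    concat (zipWith (λ i row → replicate (count k (proj₂ row)) (suc i)) (applyUpTo g (length T)) T)
      ≡ map (suc ∘ row) (sel val k (reverse (cellsFrom i T)))
  go g i eq [] = refl
  go g i eq ((off , es) ∷ T) = begin
    replicate (count k es) (suc (g 0)) ++ _ ≡⟨ cong₂ _++_ first (go (g ∘ suc) (suc i) (λ t → trans (eq (suc t)) (+-suc i t)) T) ⟩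
    map (suc ∘ row) (sel val k (reverse (rowCells i off es))) ++ map (suc ∘ row) (sel val k (reverse (cellsFrom (suc i) T)))
      ≡⟨ map-++ (suc ∘ row) (sel val k (reverse (rowCells i off es))) _ ⟨
    map (suc ∘ row) (sel val k (reverse (rowCells i off es)) ++ sel val k (reverse (cellsFrom (suc i) T)))
      ≡⟨ cong (map (suc ∘ row)) (sel-++ val k (reverse (rowCells i off es)) _) ⟨
    map (suc ∘ row) (sel val k (reverse (rowCells i off es) ++ reverse (cellsFrom (suc i) T)))
      ≡⟨ cong (map (suc ∘ row) ∘ sel val k) (reverse-++ (cellsFrom (suc i) T) (rowCells i off es)) ⟨
    map (suc ∘ row) (sel val k (reverse (cellsFrom i ((off , es) ∷ T)))) ∎
    where
    open ≡-Reasoning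
    first : replicate (count k es) (suc (g 0)) ≡ map (suc ∘ row) (sel val k (reverse (rowCells i off es)))
    first = begin
      replicate (count k es) (suc (g 0)) ≡⟨ cong (replicate (count k es) ∘ suc) (trans (eq 0) (+-identityʳ i)) ⟩
      replicate (count k es) (suc i) ≡⟨ replicate-sel k i es ⟩
      map (suc ∘ row) (reverse (sel val k (rowCells i 0 es))) ≡⟨ map-∘ {g = suc} {f = row} (reverse (sel val k (rowCells i 0 es))) ⟩
      map suc (map row (reverse (sel val k (rowCells i 0 es)))) ≡⟨ cong (map suc) (rowCells-sel-row k i 0 off es) ⟩
      map suc (map row (reverse (sel val k (rowCells i off es)))) ≡⟨ map-∘ {g = suc} {f = row} (reverse (sel val k (rowCells i off es))) ⟨
      map (suc ∘ row) (reverse (sel val k (rowCells i off es))) ≡⟨ cong (map (suc ∘ row)) (sel-reverse val k (rowCells i off es)) ⟨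
      map (suc ∘ row) (sel val k (reverse (rowCells i off es))) ∎

infix 4 _◁_
_◁_ : Cell → Cell → Set
e ◁ e′ = row e′ < row e ⊎ (row e ≡ row e′ × col e < col e′)

◁-asym : ∀ {e e′} → e ◁ e′ → e′ ◁ e → ⊥
◁-asym (inj₁ p)       (inj₁ q)       = <-asym p q
◁-asym (inj₁ p)       (inj₂ (q , _)) = <-irrefl q p
◁-asym (inj₂ (p , _)) (inj₁ q)       = <-irrefl p q
◁-asym (inj₂ (_ , p)) (inj₂ (_ , q)) = <-asym p q

rowCells-sorted : ∀ r c es → AllPairs _◁_ (rowCells r c es)
rowCells-sorted r c []       = []
rowCells-sorted r c (x ∷ es) = All.map (λ (p , q) → inj₂ (sym p , q)) (rowCells-All r (suc c) es) ∷ rowCells-sorted r (suc c) es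

cellsFrom-All : ∀ i T → All (λ e → i ≤ row e) (cellsFrom i T)
cellsFrom-All i []               = []
cellsFrom-All i ((off , es) ∷ T) = AllP.++⁺ (All.map <⇒≤ (cellsFrom-All (suc i) T)) (All.map (λ (p , _) → ≤-reflexive (sym p)) (rowCells-All i off es))

cellsFrom-sorted : ∀ i T → AllPairs _◁_ (cellsFrom i T)
cellsFrom-sorted i []               = []
cellsFrom-sorted i ((off , es) ∷ T) = APP.++⁺ (cellsFrom-sorted (suc i) T) (rowCells-sorted i off es)
  (All.map (λ p → All.map (λ (q , _) → inj₁ (≤-<-trans (≤-reflexive q) p)) (rowCells-All i off es)) (cellsFrom-All (suc i) T))

cells-sorted : ∀ T → AllPairs _◁_ (cells T)
cells-sorted = cellsFrom-sorted 0

∈-rowCells⁻ : ∀ r c es {e} → e ∈ rowCells r c es → ∃ λ k → row e ≡ r × col e ≡ suc (c + k) × nth es k ≡ just (val e)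
∈-rowCells⁻ r c (x ∷ es) (here refl) = 0 , refl , cong suc (sym (+-identityʳ c)) , refl
∈-rowCells⁻ r c (x ∷ es) (there e∈) with k , p , q , s ← ∈-rowCells⁻ r (suc c) es e∈ = suc k , p , trans q (cong suc (sym (+-suc c k))) , s

∈-rowCells⁺ : ∀ r c es {k x} → nth es k ≡ just x → ⟨ r , suc (c + k) , x ⟩ ∈ rowCells r c es
∈-rowCells⁺ r c (x ∷ es) {zero}  refl = here (cong (λ t → ⟨ r , suc t , x ⟩) (+-identityʳ c))
∈-rowCells⁺ r c (x ∷ es) {suc k} {y} p = there (subst (λ t → ⟨ r , suc t , y ⟩ ∈ rowCells r (suc c) es) (sym (+-suc c k)) (∈-rowCells⁺ r (suc c) es p))

Has : Tab → ℕ → ℕ → ℕ → Set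
Has T r c x = ∃ λ off → ∃ λ es → ∃ λ k → nth T r ≡ just (off , es) × c ≡ suc (off + k) × nth es k ≡ just x

∈-cellsFrom⁻ : ∀ i T {e} → e ∈ cellsFrom i T → ∃ λ t → row e ≡ i + t × Has T t (col e) (val e)
∈-cellsFrom⁻ i ((off , es) ∷ T) e∈ with ∈-++⁻ (cellsFrom (suc i) T) e∈
... | inj₁ q with t , p , h ← ∈-cellsFrom⁻ (suc i) T q = suc t , trans p (sym (+-suc i t)) , h
... | inj₂ q with k , p , c , n ← ∈-rowCells⁻ i off es q = 0 , trans p (sym (+-identityʳ i)) , off , es , k , refl , c , n

∈-cellsFrom⁺ : ∀ i T {t c x} → Has T t c x → ⟨ i + t , c , x ⟩ ∈ cellsFrom i T
∈-cellsFrom⁺ i ((off , es) ∷ T) {zero} {c} {x} (_ , _ , k , refl , refl , n) =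
  subst (λ r → ⟨ r , c , x ⟩ ∈ cellsFrom i ((off , es) ∷ T)) (sym (+-identityʳ i)) (∈-++⁺ʳ (cellsFrom (suc i) T) (∈-rowCells⁺ i off es n))
∈-cellsFrom⁺ i ((off , es) ∷ T) {suc t} {c} {x} (o , f , k , p , q , n) =
  subst (λ r → ⟨ r , c , x ⟩ ∈ cellsFrom i ((off , es) ∷ T)) (sym (+-suc i t)) (∈-++⁺ˡ (∈-cellsFrom⁺ (suc i) T (o , f , k , p , q , n)))

∈-cells⁻ : ∀ T {e} → e ∈ cells T → Has T (row e) (col e) (val e)
∈-cells⁻ T e∈ with t , p , h ← ∈-cellsFrom⁻ 0 T e∈ = subst (λ r → Has T r _ _) (sym p) h

∈-cells⁺ : ∀ T {r c x} → Has T r c x → ⟨ r , c , x ⟩ ∈ cells T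
∈-cells⁺ T = ∈-cellsFrom⁺ 0 T

cell⇒ : ∀ off es j {x} → cell (off , es) j ≡ just x → ∃ λ k → j ≡ suc (off + k) × nth es k ≡ just x
cell⇒ off es j e with off <? j
... | yes l = j ∸ suc off , sym (m+[n∸m]≡n l) , e

cell⇐ : ∀ off es k → cell (off , es) (suc (off + k)) ≡ nth es k
cell⇐ off es k with off <? suc (off + k)
... | yes _ = cong (nth es) (m+n∸m≡n off k)
... | no ¬l = ⊥-elim (¬l (s≤s (m≤m+n off k)))

entry⇒Has : ∀ T r c {x} → entry T r c ≡ just x → Has T r c x
entry⇒Has T r c e with nth T r
... | just (off , es) with k , p , q ← cell⇒ off es c e = off , es , k , refl , p , q

Has⇒entry : ∀ T r c {x} → Has T r c x → entry T r c ≡ just x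
Has⇒entry T r c (off , es , k , p , refl , q) with nth T r
Has⇒entry T r c (off , es , k , refl , refl , q) | just _ = trans (cell⇐ off es k) q

InShape : List (ℕ × ℕ) → ℕ → ℕ → Set
InShape S r c = ∃ λ a → ∃ λ b → nth S r ≡ just (a , b) × a < c × c ≤ b

Has⇒InShape : ∀ T {r c x} → Has T r c x → InShape (shape T) r c
Has⇒InShape T (off , es , k , p , refl , q) = off , off + length es , nth-map⁺ _ T p , s≤s (m≤m+n off k) , +-monoʳ-< off (nth-just-< es q)

InShape⇒Has : ∀ T {r c} → InShape (shape T) r c → ∃ λ x → Has T r c x
InShape⇒Has T {r} {c} (a , b , p , l , u) with nth-map⁻ _ T p
... | (off , es) , q , refl with k ← c ∸ suc off | e ← sym (m+[n∸m]≡n l) with nth-< es {k} (+-cancelˡ-< off _ _ (≤-trans (≤-reflexive (sym e)) u))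
... | x , n = x , off , es , k , q , e , n

rowCells-place : ∀ r c es fs → length es ≡ length fs → map place (rowCells r c es) ≡ map place (rowCells r c fs)
rowCells-place r c []       []       _ = refl
rowCells-place r c (x ∷ es) (y ∷ fs) p = cong ((r , suc c) ∷_) (rowCells-place r (suc c) es fs (suc-injective p))

cells-place : ∀ T U → shape T ≡ shape U → map place (cells T) ≡ map place (cells U)
cells-place = go 0
  where
  go : ∀ i T U → shape T ≡ shape U → map place (cellsFrom i T) ≡ map place (cellsFrom i U)
  go i [] [] _ = refl
  go i ((off , es) ∷ T) ((off′ , fs) ∷ U) e with refl ← cong proj₁ (∷-injectiveˡ e) =
    trans (map-++ place (cellsFrom (suc i) T) _) (trans (cong₂ _++_ (go (suc i) T U (∷-injectiveʳ e))
      (rowCells-place i off es fs (+-cancelˡ-≡ off _ _ (cong proj₂ (∷-injectiveˡ e)))))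
      (sym (map-++ place (cellsFrom (suc i) U) _)))

Decr-nth : ∀ xs → Decr xs → ∀ {i j a b} → nth xs i ≡ just a → nth xs j ≡ just b → i ≤ j → b ≤ a
Decr-nth (x ∷ xs)     p       {zero}  {zero}  refl refl _       = ≤-refl
Decr-nth (x ∷ y ∷ xs) (p , q) {zero}  {suc j} refl s    _       = ≤-trans (Decr-nth (y ∷ xs) q {0} {j} refl s z≤n) p
Decr-nth (x ∷ y ∷ xs) (p , q) {suc i} {suc j} r    s    (s≤s l) = Decr-nth (y ∷ xs) q r s l

AllL⇒All : ∀ {P : ℕ → Set} xs → AllL xs P → All P xs
AllL⇒All []       _       = []
AllL⇒All (x ∷ xs) (p , q) = p ∷ AllL⇒All xs q

All⇒AllL : ∀ {P : ℕ → Set} {xs} → All P xs → AllL xs P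
All⇒AllL []       = _
All⇒AllL (p ∷ ps) = p , All⇒AllL ps

module Skew {d m T} (box : SkewInBox d m T) where

  inner-Decr = proj₁ (proj₂ box)
  outer-Decr = proj₁ (proj₂ (proj₂ box))

  nth-inner : ∀ {r a b} → nth (shape T) r ≡ just (a , b) → nth (inner T) r ≡ just a
  nth-inner p with (_ , _) , q , refl ← nth-map⁻ _ T p = nth-map⁺ proj₁ T q

  nth-outer : ∀ {r a b} → nth (shape T) r ≡ just (a , b) → nth (outer T) r ≡ just b
  nth-outer p with (_ , _) , q , refl ← nth-map⁻ _ T p = nth-map⁺ _ T q

  row-bound : ∀ {r c} → InShape (shape T) r c → r < d
  row-bound (_ , _ , p , _) = ≤-trans (nth-just-< (shape T) p) (≤-reflexive (trans (length-map _ T) (proj₁ box)))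

  col-bound : ∀ {r c} → InShape (shape T) r c → c ≤ m
  col-bound (_ , _ , p , _ , u) = ≤-trans u (All.lookup (AllL⇒All (outer T) (proj₂ (proj₂ (proj₂ box)))) (nth-∈ (outer T) (nth-outer p)))

  -- Both borders of the shape move weakly left on the way down: the upper cell controls the left
  -- border of row `r`, the lower cell its right border.
  convex : ∀ {r r₁ r₂ c c₁ c₂} → InShape (shape T) r₁ c₁ → InShape (shape T) r₂ c₂ →
    r₁ ≤ r → r ≤ r₂ → c₁ ≤ c → c ≤ c₂ → InShape (shape T) r c
  convex (a₁ , b₁ , p₁ , l₁ , u₁) (a₂ , b₂ , p₂ , l₂ , u₂) r₁≤r r≤r₂ c₁≤c c≤c₂
    with (a , b) , p ← nth-< (shape T) (≤-<-trans r≤r₂ (nth-just-< (shape T) p₂)) =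
    a , b , p ,
    ≤-<-trans (Decr-nth (inner T) inner-Decr (nth-inner p₁) (nth-inner p) r₁≤r) (<-≤-trans l₁ c₁≤c) ,
    ≤-trans c≤c₂ (≤-trans u₂ (Decr-nth (outer T) outer-Decr (nth-outer p) (nth-outer p₂) r≤r₂))

  module SemiStandard (ss : Semistandard T) where

    row-mono : ∀ {r c x y} n → Has T r c x → Has T r (n + c) y → x ≤ y
    row-mono {r} {c} zero h h′ = ≤-reflexive (just-injective (trans (sym (Has⇒entry T r c h)) (Has⇒entry T r c h′)))
    row-mono {r} {c} (suc n) h h′ with z , k ← InShape⇒Has T (convex (Has⇒InShape T h) (Has⇒InShape T h′) ≤-refl ≤-refl (m≤n+m c n) (m≤n+m (n + c) 1)) =
      ≤-trans (row-mono n h k) (proj₁ ss r (n + c) _ _ (Has⇒entry T r _ k) (Has⇒entry T r _ h′))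

    col-mono : ∀ {r c x y} n → Has T r c x → Has T (n + r) c y → n + x ≤ y
    col-mono {r} {c} zero h h′ = ≤-reflexive (just-injective (trans (sym (Has⇒entry T r c h)) (Has⇒entry T r c h′)))
    col-mono {r} {c} (suc n) h h′ with z , k ← InShape⇒Has T (convex (Has⇒InShape T h) (Has⇒InShape T h′) (m≤n+m r n) (m≤n+m (n + r) 1) ≤-refl ≤-refl) =
      ≤-trans (s≤s (col-mono n h k)) (proj₂ ss (n + r) c _ _ (Has⇒entry T _ c k) (Has⇒entry T _ c h′))

    private
      -- Go right along the row of the first cell, then down the column of the second; the corner
      -- belongs to the shape by convexity. The descent contributes one unit per row, which yields
      -- both `mono` and `strict`.
      via : ∀ {r r′ c c′ x y} → Has T r c x → Has T r′ c′ y → r ≤ r′ → c ≤ c′ → (r′ ∸ r) + x ≤ y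
      via {r} {r′} {c} {c′} {x} {y} h h′ p q with z , k ← InShape⇒Has T (convex (Has⇒InShape T h) (Has⇒InShape T h′) ≤-refl p q ≤-refl) =
        ≤-trans (+-monoʳ-≤ (r′ ∸ r) (row-mono (c′ ∸ c) h (subst (λ t → Has T r t z) (sym (m∸n+n≡m q)) k)))
          (col-mono (r′ ∸ r) k (subst (λ t → Has T t c′ y) (sym (m∸n+n≡m p)) h′))

    mono : ∀ {e e′} → e ∈ cells T → e′ ∈ cells T → row e ≤ row e′ → col e ≤ col e′ → val e ≤ val e′
    mono {e} {e′} e∈ e′∈ p q = ≤-trans (m≤n+m (val e) (row e′ ∸ row e)) (via (∈-cells⁻ T e∈) (∈-cells⁻ T e′∈) p q)

    strict : ∀ {e e′} → e ∈ cells T → e′ ∈ cells T → row e < row e′ → col e ≤ col e′ → val e < val e′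
    strict {e} {e′} e∈ e′∈ p q = ≤-trans (+-monoˡ-≤ (val e) (m<n⇒0<n∸m p)) (via (∈-cells⁻ T e∈) (∈-cells⁻ T e′∈) (<⇒≤ p) q)

  ∈-InShape : ∀ {e} → e ∈ cells T → InShape (shape T) (row e) (col e)
  ∈-InShape e∈ = Has⇒InShape T (∈-cells⁻ T e∈)

  fill : ∀ {r c} → InShape (shape T) r c → ∃ λ x → ⟨ r , c , x ⟩ ∈ cells T
  fill i with x , h ← InShape⇒Has T i = x , ∈-cells⁺ T h

-- Standardization, its inverse, and the word of cells

AllPairs-≢-↭ : {xs ys : List A} → xs ↭ ys → AllPairs _≢_ xs → AllPairs _≢_ ys
AllPairs-≢-↭ _↭_.refl ps = ps
AllPairs-≢-↭ (prep x e) (p ∷ ps) = PermP.All-resp-↭ e p ∷ AllPairs-≢-↭ e ps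
AllPairs-≢-↭ (swap x y e) ((x≢y ∷ p) ∷ q ∷ ps) =
  ((x≢y ∘ sym) ∷ PermP.All-resp-↭ e q) ∷ PermP.All-resp-↭ e p ∷ AllPairs-≢-↭ e ps
AllPairs-≢-↭ (_↭_.trans e e′) ps = AllPairs-≢-↭ e′ (AllPairs-≢-↭ e ps)

AllPairs-map-∈ : {R S : A → A → Set} {xs : List A} → (∀ {x y} → x ∈ xs → y ∈ xs → R x y → S x y) → AllPairs R xs → AllPairs S xs
AllPairs-map-∈ h []       = []
AllPairs-map-∈ {R = R} {S} {x ∷ xs} h (p ∷ ps) = All.tabulate (λ y∈ → h (here refl) (there y∈) (All.lookup p y∈)) ∷ AllPairs-map-∈ (λ x∈ y∈ → h (there x∈) (there y∈)) ps

≡ᵇ-refl : ∀ n → (n ≡ᵇ n) ≡ true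
≡ᵇ-refl zero    = refl
≡ᵇ-refl (suc n) = ≡ᵇ-refl n

indexOf-nth : ∀ {s} → AllPairs _≢_ s → ∀ {k v} → nth s k ≡ just v → indexOf v s ≡ k
indexOf-nth {x ∷ s} _        {zero}      refl rewrite ≡ᵇ-refl x = refl
indexOf-nth {x ∷ s} (p ∷ ps) {suc k} {v} e with x ≡ᵇ v in eq
... | true  = ⊥-elim (All.lookup p (nth-∈ s e) (≡ᵇ⇒≡ x v (subst T (sym eq) _)))
  where open import Data.Bool using (T)
... | false = cong suc (indexOf-nth ps e)

sorted-blocks-≤ : (f : A → ℕ) (n : ℕ) (xs : List A) → All (λ x → f x ≤ n) (concatMap (λ k → sel f (suc k) xs) (upTo n))
sorted-blocks-≤ f zero    xs = []
sorted-blocks-≤ f (suc n) xs rewrite concatMap-upTo-suc (λ k → sel f (suc k) xs) n =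
  AllP.++⁺ (All.map m≤n⇒m≤1+n (sorted-blocks-≤ f n xs)) (All.map ≤-reflexive (AllP.all-filter (λ x → f x ≟ suc n) xs))

sorted-blocks : (f : A → ℕ) {R : A → A → Set} (n : ℕ) {xs : List A} → AllPairs R xs →
  AllPairs (λ x y → f x < f y ⊎ (f x ≡ f y × R x y)) (concatMap (λ k → sel f (suc k) xs) (upTo n))
sorted-blocks f zero    ps = []
sorted-blocks f (suc n) {xs} ps rewrite concatMap-upTo-suc (λ k → sel f (suc k) xs) n =
  APP.++⁺ (sorted-blocks f n ps)
    (AllPairs-map-∈ (λ x∈ y∈ r → inj₂ (trans (All.lookup block x∈) (sym (All.lookup block y∈)) , r)) (APP.filter⁺ (λ x → f x ≟ suc n) ps))
    (All.map (λ l → All.map (λ e → inj₁ (≤-trans (s≤s l) (≤-reflexive (sym e)))) block) (sorted-blocks-≤ f n xs))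
  where block = AllP.all-filter (λ x → f x ≟ suc n) xs

below : ℕ → List ℕ → ℕ
below a w = length (filter (_<? a) w)

below-suc : ∀ a w → below (suc a) w ≡ below a w + count a w
below-suc a [] = refl
below-suc a (x ∷ w) with <-cmp x a
... | tri< l ne _ rewrite filter-accept (_<? suc a) {xs = w} (m≤n⇒m≤1+n l) | filter-accept (_<? a) {xs = w} l | count-∷-≢ w ne = cong suc (below-suc a w)
... | tri≈ nl e _ rewrite filter-accept (_<? suc a) {xs = w} (s≤s (≤-reflexive e)) | filter-reject (_<? a) {xs = w} nl | count-∷-≡ w e
    = trans (cong suc (below-suc a w)) (sym (+-suc _ _))
... | tri> nl ne g rewrite filter-reject (_<? suc a) {xs = w} (<⇒≱ (s≤s g)) | filter-reject (_<? a) {xs = w} nl | count-∷-≢ w ne = below-suc a w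

module _ (f : A → ℕ) (d : ℕ) (xs : List A) (range : All (λ x → 1 ≤ f x × f x ≤ d) xs) where

  private
    w = map f xs
    en = enum 0 xs
    blocks = concatMap (λ k → sel (f ∘ proj₂) (suc k) en) (upTo d)
    occ : ℕ × A → ℕ
    occ e = count (f (proj₂ e)) (take (proj₁ e) w)
    F : ℕ × A → ℕ
    F e = suc (below (f (proj₂ e)) w + occ e)
    range-w : All (λ a → 1 ≤ a × a ≤ d) w
    range-w = AllP.map⁺ range

  std-enum : std w ≡ map F en
  std-enum = zipWith-enum (λ k a → suc (below a w + count a (take k w))) f xs

  blocks-↭ : blocks ↭ en
  blocks-↭ = concat-sel-↭ (f ∘ proj₂) d (All-enum 0 range)

  F-block : ∀ k → map F (sel (f ∘ proj₂) (suc k) en) ≡ applyUpTo (λ t → suc (below (suc k) w + t)) (count (suc k) w)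
  F-block k = begin
    map F es ≡⟨ map-cong-∈ es (λ {e} e∈ → cong (λ a → suc (below a w + occ e)) (proj₂ (∈-sel⁻ (f ∘ proj₂) (suc k) en e∈))) ⟩
    map ((λ t → suc (below (suc k) w + t)) ∘ occ) es ≡⟨ map-∘ es ⟩
    map (λ t → suc (below (suc k) w + t)) (map occ es) ≡⟨ cong (map _) (enum-count f (suc k) xs) ⟩
    map (λ t → suc (below (suc k) w + t)) (upTo (length (sel f (suc k) xs))) ≡⟨ map-upTo _ (length (sel f (suc k) xs)) ⟩
    applyUpTo (λ t → suc (below (suc k) w + t)) (length (sel f (suc k) xs)) ≡⟨ cong (applyUpTo _) (count-map f (suc k) xs) ⟨
    applyUpTo (λ t → suc (below (suc k) w + t)) (count (suc k) w) ∎
    where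
    open ≡-Reasoning
    es = sel (f ∘ proj₂) (suc k) en

  F-blocks : ∀ n → map F (concatMap (λ k → sel (f ∘ proj₂) (suc k) en) (upTo n)) ≡ applyUpTo suc (below (suc n) w)
  F-blocks zero = cong (applyUpTo suc) (sym (cong length (filter-none (_<? 1) (All.map (λ (l , _) → <⇒≱ (s≤s l)) range-w))))
  F-blocks (suc n) = begin
    map F (concatMap blk (upTo (suc n))) ≡⟨ cong (map F) (concatMap-upTo-suc blk n) ⟩
    map F (concatMap blk (upTo n) ++ blk n) ≡⟨ map-++ F (concatMap blk (upTo n)) (blk n) ⟩
    map F (concatMap blk (upTo n)) ++ map F (blk n) ≡⟨ cong₂ _++_ (F-blocks n) (F-block n) ⟩
    applyUpTo suc (below (suc n) w) ++ applyUpTo (λ t → suc (below (suc n) w + t)) (count (suc n) w) ≡⟨ applyUpTo-+ suc (below (suc n) w) (count (suc n) w) ⟨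
    applyUpTo suc (below (suc n) w + count (suc n) w) ≡⟨ cong (applyUpTo suc) (below-suc (suc n) w) ⟨
    applyUpTo suc (below (suc (suc n)) w) ∎
    where
    open ≡-Reasoning
    blk = λ k → sel (f ∘ proj₂) (suc k) en

  F-all : map F blocks ≡ applyUpTo suc (length w)
  F-all = trans (F-blocks d) (cong (applyUpTo suc ∘ length) (filter-all (_<? suc d) (All.map (s≤s ∘ proj₂) range-w)))

  std-distinct : AllPairs _≢_ (std w)
  std-distinct = subst (AllPairs _≢_) (sym std-enum) (AllPairs-≢-↭ (PermP.map⁺ F blocks-↭)
    (subst (AllPairs _≢_) (sym F-all) (APP.applyUpTo⁺₁ suc (length w) (λ l _ → <⇒≢ l ∘ suc-injective))))

  -- Each block of equal letters continues the numbering where the smaller letters stop. So the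
  -- positions, listed letter by letter, carry the labels 1, 2, 3, ... in this order, and since
  -- labels are distinct, `indexOf` returns exactly this list.
  inv-std : inv (std w) ≡ map (suc ∘ proj₁) blocks
  inv-std = begin
    map (λ k → suc (indexOf (suc k) (std w))) (upTo (length (std w))) ≡⟨ cong (λ n → map (λ k → suc (indexOf (suc k) (std w))) (upTo n)) len ⟩
    map (λ k → suc (indexOf (suc k) (std w))) (upTo (length w)) ≡⟨ map-∘ (upTo (length w)) ⟩
    map (λ v → suc (indexOf v (std w))) (map suc (upTo (length w))) ≡⟨ cong (map _) (trans (map-upTo suc (length w)) (sym F-all)) ⟩
    map (λ v → suc (indexOf v (std w))) (map F blocks) ≡⟨ map-∘ blocks ⟨
    map (λ e → suc (indexOf (F e) (std w))) blocks ≡⟨ map-cong-∈ blocks (λ e∈ → cong suc (index (PermP.∈-resp-↭ blocks-↭ e∈))) ⟩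
    map (suc ∘ proj₁) blocks ∎
    where
    open ≡-Reasoning
    enum-length : ∀ i (ys : List A) → length (enum i ys) ≡ length ys
    enum-length i []       = refl
    enum-length i (y ∷ ys) = cong suc (enum-length (suc i) ys)
    len : length (std w) ≡ length w
    len = trans (cong length std-enum) (trans (length-map F en) (trans (enum-length 0 xs) (sym (length-map f xs))))
    index : ∀ {e} → e ∈ en → indexOf (F e) (std w) ≡ proj₁ e
    index {e} e∈ with k , refl , q ← enum-nth 0 e∈ =
      indexOf-nth std-distinct {k} (trans (cong (λ l → nth l k) std-enum) (nth-map⁺ F en {k} (nth-enum 0 xs q)))

byLetter : ℕ → Tab → List Cell
byLetter d T = concatMap (λ k → sel val (suc k) (cells T)) (upTo d)

Letters : ℕ → Tab → Set
Letters d T = All (λ e → 1 ≤ val e × val e ≤ d) (cells T)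

rowWord-companion : ∀ T (off : ℕ → ℕ) d →
  rowWord (map (λ k → off k , compRow T (suc k)) (upTo d)) ≡ map (suc ∘ row) (reverse (byLetter d T))
rowWord-companion T off d = begin
  concat (reverse (map proj₂ (map (λ k → off k , compRow T (suc k)) (upTo d)))) ≡⟨ cong (concat ∘ reverse) (map-∘ (upTo d)) ⟨
  concat (reverse (map (λ k → compRow T (suc k)) (upTo d))) ≡⟨ cong concat (reverse-map _ (upTo d)) ⟨
  concatMap (λ k → compRow T (suc k)) (reverse (upTo d)) ≡⟨ concatMap-cong block (reverse (upTo d)) ⟩
  concatMap (map (suc ∘ row) ∘ reverse ∘ λ k → sel val (suc k) (cells T)) (reverse (upTo d)) ≡⟨ map-concatMap (suc ∘ row) (reverse ∘ λ k → sel val (suc k) (cells T)) (reverse (upTo d)) ⟨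
  map (suc ∘ row) (concatMap (reverse ∘ λ k → sel val (suc k) (cells T)) (reverse (upTo d))) ≡⟨ cong (map (suc ∘ row)) (reverse-concatMap _ (upTo d)) ⟨
  map (suc ∘ row) (reverse (byLetter d T)) ∎
  where
  open ≡-Reasoning
  block : ∀ k → compRow T (suc k) ≡ map (suc ∘ row) (reverse (sel val (suc k) (cells T)))
  block k = trans (compRow-cells T (suc k)) (cong (map (suc ∘ row)) (sel-reverse val (suc k) (cells T)))

-- The argument is a list of places rather than a tableau, so that one map decodes the words of two
-- tableaux of equal shape. The letters of `inv` start at 1, hence the shift; `(0 , 0)` is a default
-- outside the numbering.
placeAt : List (ℕ × ℕ) → ℕ → ℕ × ℕ
placeAt ps zero    = 0 , 0
placeAt ps (suc k) = Maybe.fromMaybe (0 , 0) (nth ps k)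

placeAt-cells : ∀ T {k e} → nth (cells T) k ≡ just e → placeAt (map place (cells T)) (suc k) ≡ place e
placeAt-cells T p = cong (Maybe.fromMaybe (0 , 0)) (nth-map⁺ place (cells T) p)

positions : ℕ → Tab → List ℕ
positions d T = map (suc ∘ proj₁) (concatMap (λ k → sel (val ∘ proj₂) (suc k) (enum 0 (cells T))) (upTo d))

positions-image : ∀ d T → Letters d T → (h : ℕ × ℕ → ℕ) → map (h ∘ placeAt (map place (cells T))) (positions d T) ≡ map (h ∘ place) (byLetter d T)
positions-image d T range h = begin
  map (h ∘ placeAt (map place (cells T))) (map (suc ∘ proj₁) blocks) ≡⟨ map-∘ blocks ⟨
  map (λ e → h (placeAt (map place (cells T)) (suc (proj₁ e)))) blocks ≡⟨ map-cong-∈ blocks (λ e∈ → at (PermP.∈-resp-↭ (blocks-↭ val d (cells T) range) e∈)) ⟩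
  map (h ∘ place ∘ proj₂) blocks ≡⟨ map-∘ blocks ⟩
  map (h ∘ place) (map proj₂ blocks) ≡⟨ cong (map (h ∘ place)) (map-concatMap proj₂ _ (upTo d)) ⟩
  map (h ∘ place) (concatMap (λ k → map proj₂ (sel (val ∘ proj₂) (suc k) (enum 0 (cells T)))) (upTo d)) ≡⟨ cong (map (h ∘ place)) (concatMap-cong forget (upTo d)) ⟩
  map (h ∘ place) (byLetter d T) ∎
  where
  open ≡-Reasoning
  blocks = concatMap (λ k → sel (val ∘ proj₂) (suc k) (enum 0 (cells T))) (upTo d)
  at : ∀ {e} → e ∈ enum 0 (cells T) → h (placeAt (map place (cells T)) (suc (proj₁ e))) ≡ h (place (proj₂ e))
  at e∈ with k , refl , q ← enum-nth 0 e∈ = cong h (placeAt-cells T q)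
  forget : ∀ k → map proj₂ (sel (val ∘ proj₂) (suc k) (enum 0 (cells T))) ≡ sel val (suc k) (cells T)
  forget k = trans (sym (sel-map val proj₂ (suc k) (enum 0 (cells T)))) (cong (sel val (suc k)) (enum-proj₂ 0 (cells T)))

module _ {d m T} (box : SkewInBox d m T) (ss : Semistandard T) (range : Letters d T) where
  open Skew box
  open SemiStandard ss

  private
    ps = map place (cells T)
    row′ col′ : ℕ → ℕ
    row′ = proj₁ ∘ placeAt ps
    col′ = proj₂ ∘ placeAt ps
    P : ℕ → Set
    P p = ∃ λ k → ∃ λ e → p ≡ suc k × nth (cells T) k ≡ just e

    row-at : ∀ {k e} → nth (cells T) k ≡ just e → row′ (suc k) ≡ row e
    row-at q = cong proj₁ (placeAt-cells T q)
    col-at : ∀ {k e} → nth (cells T) k ≡ just e → col′ (suc k) ≡ col e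
    col-at q = cong proj₂ (placeAt-cells T q)

    ord : ∀ {p q} → P p → P q → p < q → row′ q < row′ p ⊎ (row′ p ≡ row′ q × col′ p < col′ q)
    ord (k , e , refl , n) (k′ , e′ , refl , n′) (s≤s l) rewrite placeAt-cells T n | placeAt-cells T n′ =
      AllPairs-nth (cells T) (cells-sorted T) n n′ l

    at-place : ∀ {r c} → InShape (shape T) r c → ∃ λ s → P s × row′ s ≡ r × col′ s ≡ c
    at-place i with x , e∈ ← fill i with k , n ← ∈-nth e∈ = suc k , (k , _ , refl , n) , row-at n , col-at n

    conv : ∀ {p q} → P p → P q → row′ p < row′ q → col′ p < col′ q →
      (∃ λ s → P s × row′ s ≡ row′ p × col′ s ≡ col′ q) × (∃ λ s → P s × row′ s ≡ row′ q × col′ s ≡ col′ p)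
    conv (k , e , refl , n) (k′ , e′ , refl , n′) r c rewrite placeAt-cells T n | placeAt-cells T n′ =
      at-place (convex i i′ ≤-refl (<⇒≤ r) (<⇒≤ c) ≤-refl) , at-place (convex i i′ (<⇒≤ r) ≤-refl ≤-refl (<⇒≤ c))
      where
      i  = ∈-InShape (nth-∈ (cells T) n)
      i′ = ∈-InShape (nth-∈ (cells T) n′)

    g : ℕ → ℕ
    g p = suc m ∸ col′ p

    g-strict : ∀ {p q} → P p → P q → col′ p < col′ q → g q < g p
    g-strict _ (k′ , e′ , refl , n′) l rewrite placeAt-cells T n′ =
      ∸-monoʳ-< l (m≤n⇒m≤1+n (col-bound (∈-InShape (nth-∈ (cells T) n′))))

    module D = DualEquivalence P row′ col′ ord conv g (∸-monoʳ-≤ (suc m)) g-strict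

    blocks = concatMap (λ k → sel (val ∘ proj₂) (suc k) (enum 0 (cells T))) (upTo d)

    member : ∀ {e} → e ∈ blocks → nth (cells T) (proj₁ e) ≡ just (proj₂ e)
    member e∈ with k , refl , n ← enum-nth 0 (PermP.∈-resp-↭ (blocks-↭ val d (cells T) range) e∈) = n

    -- Semistandardness enters here. With a larger letter, `mono` keeps the later cell from the
    -- north-west of the earlier one; with the same letter in a higher row, `strict` does; in the
    -- same row the later cell lies further right.
    separated : ∀ {e e′ : ℕ × Cell} → e ∈ blocks → e′ ∈ blocks →
      val (proj₂ e) < val (proj₂ e′) ⊎ (val (proj₂ e) ≡ val (proj₂ e′) × proj₂ e ◁ proj₂ e′) → suc (proj₁ e′) D.⋢ suc (proj₁ e)
    separated e∈ e′∈ h rewrite placeAt-cells T (member e∈) | placeAt-cells T (member e′∈) with nth-∈ (cells T) (member e∈) | nth-∈ (cells T) (member e′∈) | h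
    ... | p | p′ | inj₁ l               = λ (r , c) → <⇒≱ l (mono p′ p r c)
    ... | p | p′ | inj₂ (v , inj₁ l)       = λ (r , c) → <-irrefl (sym v) (strict p′ p l c)
    ... | p | p′ | inj₂ (v , inj₂ (_ , l)) = λ (r , c) → <⇒≱ l c

  positions-Standard : D.Standard (positions d T)
  positions-Standard = record
    { valid    = AllP.map⁺ (All.tabulate (λ e∈ → _ , _ , refl , member e∈))
    ; complete = λ { (k , e , refl , n) → ∈-map⁺ (suc ∘ proj₁) (PermP.∈-resp-↭ (↭-sym (blocks-↭ val d (cells T) range)) (nth-∈ (enum 0 (cells T)) (nth-enum 0 (cells T) n))) }
    ; linear   = APP.map⁺ (AllPairs-map-∈ separated (sorted-blocks (val ∘ proj₂) d
        (APP.map⁻ (subst (AllPairs _◁_) (sym (enum-proj₂ 0 (cells T))) (cells-sorted T)))))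
    }

  -- The chain starts at the standard filling given by `T`, and `step` carries that property along
  -- it; equality of shapes lets the places of `T` decode the word of `U`.
  dual-equivalent-words : ∀ {U} → Letters d U → DualKnuthEq T U →
    KnuthEq (map (λ e → suc m ∸ col e) (byLetter d T)) (map (λ e → suc m ∸ col e) (byLetter d U)) ×
    KnuthEq (map (suc ∘ row) (reverse (byLetter d T))) (map (suc ∘ row) (reverse (byLetter d U)))
  dual-equivalent-words {U} rangeU (sh , eq) with i , j ← D.images positions-Standard
      (subst₂ KnuthEq (trans (cong (inv ∘ std) (sym (cells-val T))) (inv-std val d (cells T) range))
                      (trans (cong (inv ∘ std) (sym (cells-val U))) (inv-std val d (cells U) rangeU)) eq) =
    subst₂ KnuthEq (positions-image d T range (λ p → suc m ∸ proj₂ p)) (colsU (λ p → suc m ∸ proj₂ p)) i ,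
    subst₂ KnuthEq (flipped (positions-image d T range (suc ∘ proj₁))) (flipped (colsU (suc ∘ proj₁))) j
    where
    colsU : ∀ h → map (h ∘ placeAt ps) (positions d U) ≡ map (h ∘ place) (byLetter d U)
    colsU h = trans (cong (λ qs → map (h ∘ placeAt qs) (positions d U)) (cells-place T U sh)) (positions-image d U rangeU h)
    flipped : ∀ {A B : Set} {f : A → ℕ} {g : B → ℕ} {xs ys} → map f xs ≡ map g ys → map f (reverse xs) ≡ map g (reverse ys)
    flipped {f = f} {g} {xs} {ys} e = trans (reverse-map f xs) (trans (cong reverse e) (sym (reverse-map g ys)))

-- Littlewood-Richardson tableaux

entries-↭ : ∀ T → entries T ↭ rowWord T
entries-↭ []        = ↭-refl
entries-↭ (row ∷ T) = ↭-trans (PermP.++-comm (proj₂ row) (entries T))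
  (↭-trans (PermP.++⁺ʳ (proj₂ row) (entries-↭ T)) (↭-reflexive (sym (rowWord-∷ row T))))

cells-All : ∀ {P : ℕ → Set} T → All P (rowWord T) → All (P ∘ val) (cells T)
cells-All {P} T ps = AllP.map⁻ (subst (All P) (sym (cells-val T)) ps)

sel-split : (f : A → ℕ) (b : ℕ) (xs : List A) {k : ℕ} {e : A} → nth (sel f b xs) k ≡ just e →
  ∃ λ us → ∃ λ vs → xs ≡ us ++ e ∷ vs × length (sel f b us) ≡ k × f e ≡ b
sel-split f b (x ∷ xs) {k} p with f x ≟ b
... | no ¬q with us , vs , refl , l , q′ ← sel-split f b xs (trans (cong (λ l → nth l k) (sym (sel-reject f xs ¬q))) p) =
  x ∷ us , vs , refl , trans (cong length (sel-reject f us ¬q)) l , q′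
... | yes q with k | trans (cong (λ l → nth l k) (sym (sel-accept f xs q))) p
...   | zero  | refl = [] , xs , refl , refl , q
...   | suc k | p′ with us , vs , refl , l , q′ ← sel-split f b xs p′ =
  x ∷ us , vs , refl , trans (cong length (sel-accept f us q)) (cong suc l) , q′

-- Cut the word just after the k-th letter `suc a`, counted from 0: the prefix holds `k + 1` of
-- them, hence at least `k + 1` letters `a`, so the k-th `a` has been read before.
lattice-nth : (f : A → ℕ) {R : A → A → Set} (a : ℕ) {xs : List A} → AllPairs R xs →
  (∀ n → count (suc a) (take n (map f xs)) ≤ count a (take n (map f xs))) →
  ∀ {k e} → nth (sel f (suc a) xs) k ≡ just e → ∃ λ e′ → nth (sel f a xs) k ≡ just e′ × R e′ e
lattice-nth f {R} a {xs} ps lattice {k} {e} p with sel-split f (suc a) xs p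
... | us , vs , refl , l , q = e′ , found , R-e
  where
  prefix : take (length us + 1) (map f (us ++ e ∷ vs)) ≡ map f us ++ [ suc a ]
  prefix = trans (take-map (length us + 1) (us ++ e ∷ vs)) (trans (cong (map f) (go us)) (trans (map-++ f us [ e ]) (cong (λ b → map f us ++ [ b ]) q)))
    where
    go : ∀ us → take (length us + 1) (us ++ e ∷ vs) ≡ us ++ [ e ]
    go []       = refl
    go (u ∷ us) = cong (u ∷_) (go us)
  k< : k < length (sel f a us)
  k< = begin
    suc k ≡⟨ cong suc (trans (sym l) (sym (count-map f (suc a) us))) ⟩
    suc (count (suc a) (map f us)) ≡⟨ +-comm 1 _ ⟩
    count (suc a) (map f us) + 1 ≡⟨ cong (count (suc a) (map f us) +_) (count-self (suc a) []) ⟨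
    count (suc a) (map f us) + count (suc a) [ suc a ] ≡⟨ count-++ (suc a) (map f us) [ suc a ] ⟨
    count (suc a) (map f us ++ [ suc a ]) ≡⟨ cong (count (suc a)) prefix ⟨
    count (suc a) (take (length us + 1) (map f (us ++ e ∷ vs))) ≤⟨ lattice (length us + 1) ⟩
    count a (take (length us + 1) (map f (us ++ e ∷ vs))) ≡⟨ cong (count a) prefix ⟩
    count a (map f us ++ [ suc a ]) ≡⟨ count-++ a (map f us) [ suc a ] ⟩
    count a (map f us) + count a [ suc a ] ≡⟨ cong (count a (map f us) +_) (count-∷-≢ {a} {suc a} [] 1+n≢n) ⟩
    count a (map f us) + 0 ≡⟨ +-identityʳ _ ⟩
    count a (map f us) ≡⟨ count-map f a us ⟩
    length (sel f a us) ∎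
    where open ≤-Reasoning
  e′ = proj₁ (nth-< (sel f a us) k<)
  at = proj₂ (nth-< (sel f a us) k<)
  found : nth (sel f a (us ++ e ∷ vs)) k ≡ just e′
  found = trans (cong (λ l → nth l k) (sel-++ f a us (e ∷ vs))) (nth-++ˡ (sel f a us) at)
  R-e : R e′ e
  R-e = All.head (All.lookup (proj₂ (proj₂ (AllPairs-++⁻ us ps))) (proj₁ (∈-sel⁻ f a us (nth-∈ (sel f a us) at))))

yamCells : Tab → List Cell
yamCells T = reverse (cells T)

yamCells-sorted : ∀ T → AllPairs (flip _◁_) (yamCells T)
yamCells-sorted T = AllPairs-reverse (cells-sorted T)

∈-yamCells⁻ : ∀ T {e} → e ∈ yamCells T → e ∈ cells T
∈-yamCells⁻ T = PermP.∈-resp-↭ (PermP.↭-reverse (cells T))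

∈-yamCells⁺ : ∀ T {e} → e ∈ cells T → e ∈ yamCells T
∈-yamCells⁺ T = PermP.∈-resp-↭ (↭-sym (PermP.↭-reverse (cells T)))

letter : ℕ → Tab → List Cell
letter a T = sel val a (yamCells T)

columns : ℕ → ℕ → Tab → List (List ℕ)
columns d m T = map (λ k → map (λ e → suc m ∸ col e) (letter (suc k) T)) (upTo d)

module LR {d m T} (lr : IsLRTab d m T) where

  box = proj₁ lr
  ss  = proj₁ (proj₂ lr)
  open Skew box public
  open SemiStandard ss public

  letter-∈ : ∀ a {e} → e ∈ letter a T → e ∈ cells T × val e ≡ a
  letter-∈ a e∈ with p , q ← ∈-sel⁻ val a (yamCells T) e∈ = ∈-yamCells⁻ T p , q

  letter-sorted : ∀ a → AllPairs (flip _◁_) (letter a T)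
  letter-sorted a = APP.filter⁺ (λ e → val e ≟ a) (yamCells-sorted T)

  lattice : ∀ a n → count (suc (suc a)) (take n (map val (yamCells T))) ≤ count (suc a) (take n (map val (yamCells T)))
  lattice a n = subst (λ w → count (suc (suc a)) (take n w) ≤ count (suc a) (take n w)) (yam-cells T) (proj₂ (proj₂ (proj₂ lr)) n a)

  -- `lattice-nth` makes the smaller letter come first in the Yamanouchi reading; within one row,
  -- coming first means lying further right, where a smaller letter is impossible.
  above : ∀ a {k e} → nth (letter (suc (suc a)) T) k ≡ just e → ∃ λ e′ → nth (letter (suc a) T) k ≡ just e′ × row e′ < row e
  above a {k} {e} p with lattice-nth val (suc a) (yamCells-sorted T) (lattice a) p
  ... | e′ , q , inj₁ r = e′ , q , r
  ... | e′ , q , inj₂ (r , c) = ⊥-elim (1+n≰n (subst₂ _≤_ v v′ (mono e∈ e′∈ (≤-reflexive r) (<⇒≤ c))))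
    where
    e∈  = proj₁ (letter-∈ (suc (suc a)) (nth-∈ (letter (suc (suc a)) T) p))
    v   = proj₂ (letter-∈ (suc (suc a)) (nth-∈ (letter (suc (suc a)) T) p))
    e′∈ = proj₁ (letter-∈ (suc a) (nth-∈ (letter (suc a) T) q))
    v′  = proj₂ (letter-∈ (suc a) (nth-∈ (letter (suc a) T) q))

  letters≥1 : All (λ e → 1 ≤ val e) (cells T)
  letters≥1 = cells-All T (PermP.All-resp-↭ (entries-↭ T) (AllL⇒All (entries T) (proj₁ (proj₂ (proj₂ lr)))))

  -- Each use of `above` climbs at least one row. Hence the letters are at most `d`, a bound that
  -- `IsLRTab` does not state and that standardization and rotation rely on.
  letter-row : ∀ a {e} → e ∈ cells T → val e ≡ suc a → a ≤ row e
  letter-row zero    _  _ = z≤n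
  letter-row (suc a) {e} e∈ v with ∈-nth (subst (λ b → e ∈ sel val b (yamCells T)) v (∈-sel⁺ val (∈-yamCells⁺ T e∈)))
  ... | k , p with e′ , q , r ← above a p =
    ≤-<-trans (letter-row a (proj₁ (letter-∈ (suc a) (nth-∈ (letter (suc a) T) q))) (proj₂ (letter-∈ (suc a) (nth-∈ (letter (suc a) T) q)))) r

  letters : Letters d T
  letters = All.tabulate (λ {e} e∈ → All.lookup letters≥1 e∈ , bound e∈ (All.lookup letters≥1 e∈))
    where
    bound : ∀ {e} → e ∈ cells T → 1 ≤ val e → val e ≤ d
    bound {e} e∈ l with val e in eq
    ... | suc a = ≤-<-trans (letter-row a e∈ eq) (row-bound (∈-InShape e∈))

  col≥1 : ∀ {e} → e ∈ cells T → 1 ≤ col e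
  col≥1 e∈ with _ , _ , _ , l , _ ← ∈-InShape e∈ = ≤-trans (s≤s z≤n) l

  col≤ : ∀ {e} → e ∈ cells T → col e ≤ m
  col≤ e∈ = col-bound (∈-InShape e∈)

  row< : ∀ {e} → e ∈ cells T → row e < d
  row< e∈ = row-bound (∈-InShape e∈)

  -- If the k-th letter suc a were strictly right of the k-th letter a, the cell to its left would be a letter suc a
  -- as well, and the same would happen again for the index of that cell.
  weakly-left : ∀ a fuel {k e e′} → length (letter (suc (suc a)) T) ≤ fuel + k →
    nth (letter (suc (suc a)) T) k ≡ just e → nth (letter (suc a) T) k ≡ just e′ → col e ≤ col e′
  weakly-left a zero l p q = ⊥-elim (<⇒≱ (nth-just-< (letter (suc (suc a)) T) p) l)
  weakly-left a (suc fuel) {k} {⟨ r′ , zero , _ ⟩} l p q = z≤n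
  weakly-left a (suc fuel) {k} {e@(⟨ r′ , suc c , y ⟩)} {e′} l p q = ≮⇒≥ absurd
    where
    As = letter (suc a) T
    Bs = letter (suc (suc a)) T
    e∈  = proj₁ (letter-∈ (suc (suc a)) (nth-∈ Bs p))
    v   = proj₂ (letter-∈ (suc (suc a)) (nth-∈ Bs p))
    e′∈ = proj₁ (letter-∈ (suc a) (nth-∈ As q))
    v′  = proj₂ (letter-∈ (suc a) (nth-∈ As q))
    r<r′ : row e′ < r′
    r<r′ with e″ , q′ , r ← above a p with refl ← just-injective (trans (sym q) q′) = r
    absurd : col e′ < suc c → ⊥
    absurd (s≤s c′≤c) with fill (convex (∈-InShape e′∈) (∈-InShape e∈) (<⇒≤ r<r′) ≤-refl c′≤c (n≤1+n c))
    ... | x , f∈ with x≡ ← ≤-antisym (≤-trans (mono f∈ e∈ ≤-refl (n≤1+n c)) (≤-reflexive v)) (≤-trans (s≤s (≤-reflexive (sym v′))) (strict e′∈ f∈ r<r′ c′≤c))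
      with ∈-nth (subst (λ b → ⟨ r′ , c , x ⟩ ∈ sel val b (yamCells T)) x≡ (∈-sel⁺ val (∈-yamCells⁺ T f∈)))
    ... | k₂ , p₂ with above a p₂
    ...   | e₂ , q₂ , r₂ with <-cmp k k₂
    ...     | tri> _ _ k₂<k with AllPairs-nth Bs (letter-sorted (suc (suc a))) p₂ p k₂<k
    ...       | inj₁ bad       = <-irrefl refl bad
    ...       | inj₂ (_ , bad) = <⇒≱ bad (n≤1+n c)
    absurd (s≤s c′≤c) | x , f∈ | k₂ , p₂ | e₂ , q₂ , r₂ | tri≈ _ refl _ = 1+n≢n (cong col (just-injective (trans (sym p) p₂)))
    absurd (s≤s c′≤c) | x , f∈ | k₂ , p₂ | e₂ , q₂ , r₂ | tri< k<k₂ _ _ =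
      <⇒≱ (<-≤-trans left c′≤c) (weakly-left a fuel (≤-trans l (≤-trans (≤-reflexive (sym (+-suc fuel k))) (+-monoʳ-≤ fuel k<k₂))) p₂ q₂)
      where
      e₂∈ = proj₁ (letter-∈ (suc a) (nth-∈ As q₂))
      v₂  = proj₂ (letter-∈ (suc a) (nth-∈ As q₂))
      left : col e₂ < col e′
      left with AllPairs-nth As (letter-sorted (suc a)) q q₂ k<k₂
      ... | inj₂ (_ , c₂) = c₂
      ... | inj₁ lower    = ≰⇒> (λ c → <-irrefl (trans v′ (sym v₂)) (strict e′∈ e₂∈ lower c))

  -- `above` provides the entry at the same height of the left column, and `weakly-left` the
  -- inequality, reversed by passing to `suc m ∸ col`. The number of larger letters is enough fuel
  -- because every recursive call raises the index.
  columns-step : ∀ a → map (λ e → suc m ∸ col e) (letter (suc a) T) ≼ map (λ e → suc m ∸ col e) (letter (suc (suc a)) T)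
  columns-step a .row-≤ k p with nth-map⁻ _ (letter (suc (suc a)) T) p
  ... | e , q , refl with above a q
  ...   | e′ , q′ , _ = _ , nth-map⁺ _ (letter (suc a) T) q′ , ∸-monoʳ-≤ (suc m) (weakly-left a (length (letter (suc (suc a)) T)) (m≤m+n _ k) q q′)

  ≼-refl : ∀ c → c ≼ c
  ≼-refl c .row-≤ k p = _ , p , ≤-refl

  ≼-trans : ∀ {b c e} → b ≼ c → c ≼ e → b ≼ e
  ≼-trans p q .row-≤ k n with y , n′ , l ← row-≤ q k n with x , n″ , l′ ← row-≤ p k n′ = x , n″ , ≤-trans l′ l

  columns-≼ : AllPairs _≼_ (columns d m T)
  columns-≼ = subst (AllPairs _≼_) (sym (map-upTo _ d)) (APP.applyUpTo⁺₁ _ d (λ i<j _ → chain _ (<⇒≤ i<j)))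
    where
    chain : ∀ {i} j → i ≤ j → map (λ e → suc m ∸ col e) (letter (suc i) T) ≼ map (λ e → suc m ∸ col e) (letter (suc j) T)
    chain {i} j l with m≤n⇒m<n∨m≡n l
    ... | inj₂ refl = ≼-refl _
    chain {i} (suc j) l | inj₁ (s≤s l′) = ≼-trans (chain j l′) (columns-step j)

  -- Equal letters form a horizontal strip: read from the top right to the bottom left, they move to
  -- a new column each time.
  letter-ascending : ∀ a → AllPairs _<_ (map (λ e → suc m ∸ col e) (letter a T))
  letter-ascending a = APP.map⁺ (AllPairs-map-∈ (λ e∈ e′∈ o → ascend (letter-∈ a e∈) (letter-∈ a e′∈) o) (letter-sorted a))
    where
    ascend : ∀ {e e′} → e ∈ cells T × val e ≡ a → e′ ∈ cells T × val e′ ≡ a → e′ ◁ e → suc m ∸ col e < suc m ∸ col e′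
    ascend (p , v) (p′ , v′) (inj₁ r)       = ∸-monoʳ-< (≰⇒> (λ c → <-irrefl (trans v (sym v′)) (strict p p′ r c))) (m≤n⇒m≤1+n (col≤ p))
    ascend (p , v) (p′ , v′) (inj₂ (_ , c)) = ∸-monoʳ-< c (m≤n⇒m≤1+n (col≤ p))

  columns-ascending : All (AllPairs _<_) (columns d m T)
  columns-ascending = AllP.map⁺ (All.universal (λ k → letter-ascending (suc k)) (upTo d))

  column-range : ∀ a → All (λ x → 0 < x × x ≤ m) (map (λ e → suc m ∸ col e) (letter a T))
  column-range a = AllP.map⁺ (All.tabulate (λ e∈ → let p = proj₁ (letter-∈ a e∈) in
    m<n⇒0<n∸m (s≤s (col≤ p)) , ≤-trans (∸-monoʳ-≤ (suc m) (col≥1 p)) ≤-refl))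

  columns-range : All (All (λ x → 0 < x × x ≤ m)) (columns d m T)
  columns-range = AllP.map⁺ (All.universal (λ k → column-range (suc k)) (upTo d))

  letter-length : ∀ a → length (letter a T) ≤ m
  letter-length a = ≤-trans (≤-reflexive (sym (length-map _ (letter a T)))) (ascending-length 0 (letter-ascending a) (column-range a))

  columns-length : All (λ c → length c ≤ m) (columns d m T)
  columns-length = AllP.map⁺ (All.universal (λ k → ≤-trans (≤-reflexive (length-map _ (letter (suc k) T))) (letter-length (suc k))) (upTo d))

  columns-word : concatMap reverse (columns d m T) ≡ map (λ e → suc m ∸ col e) (byLetter d T)
  columns-word = begin
    concatMap reverse (columns d m T) ≡⟨ concatMap-map reverse _ (upTo d) ⟩
    concatMap (λ k → reverse (map f (letter (suc k) T))) (upTo d) ≡⟨ concatMap-cong block (upTo d) ⟩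
    concatMap (λ k → map f (sel val (suc k) (cells T))) (upTo d) ≡⟨ map-concatMap f _ (upTo d) ⟨
    map f (byLetter d T) ∎
    where
    open ≡-Reasoning
    f : Cell → ℕ
    f e = suc m ∸ col e
    block : ∀ k → reverse (map f (letter (suc k) T)) ≡ map f (sel val (suc k) (cells T))
    block k = trans (sym (reverse-map f (letter (suc k) T))) (cong (map f)
      (trans (cong reverse (sel-reverse val (suc k) (cells T))) (reverse-involutive _)))

-- The orthogonal transpose

mutual
  -- colWord applies a function local to its definition to the result of cell; the metavariable is solved by that function.
  columnEntry : ℕ → Tab → Row → ℕ → List ℕ
  columnEntry = _

  colWord-unfold : ∀ c V → colWord c V ≡ concatMap (λ j → concatMap (λ row → columnEntry c V row j) V) (applyDownFrom suc c)
  colWord-unfold c V = refl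

columnEntry-cell : ∀ c V row j → columnEntry c V row j ≡ toList (cell row j)
columnEntry-cell c V row j with cell row j
... | just x  = refl
... | nothing = refl

columnFrom : ℕ → ℕ → Tab → List Cell
columnFrom j i []        = []
columnFrom j i (row ∷ V) = map (λ x → ⟨ i , j , x ⟩) (toList (cell row j)) ++ columnFrom j (suc i) V

colCells : ℕ → Tab → List Cell
colCells c V = concatMap (λ j → columnFrom j 0 V) (applyDownFrom suc c)

columnFrom-val : ∀ j i V → map val (columnFrom j i V) ≡ concatMap (λ row → toList (cell row j)) V
columnFrom-val j i []        = refl
columnFrom-val j i (row ∷ V) = trans (map-++ val (map (λ x → ⟨ i , j , x ⟩) (toList (cell row j))) _)
  (cong₂ _++_ (trans (sym (map-∘ (toList (cell row j)))) (map-id (toList (cell row j)))) (columnFrom-val j (suc i) V))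

colCells-val : ∀ c V → map val (colCells c V) ≡ colWord c V
colCells-val c V = begin
  map val (colCells c V) ≡⟨ map-concatMap val _ (applyDownFrom suc c) ⟩
  concatMap (λ j → map val (columnFrom j 0 V)) (applyDownFrom suc c) ≡⟨ concatMap-cong (λ j → columnFrom-val j 0 V) (applyDownFrom suc c) ⟩
  concatMap (λ j → concatMap (λ row → toList (cell row j)) V) (applyDownFrom suc c)
    ≡⟨ concatMap-cong (λ j → concatMap-cong (λ row → sym (columnEntry-cell c V row j)) V) (applyDownFrom suc c) ⟩
  concatMap (λ j → concatMap (λ row → columnEntry c V row j) V) (applyDownFrom suc c) ≡⟨ colWord-unfold c V ⟨
  colWord c V ∎
  where open ≡-Reasoning

toList-∈ : {mx : Maybe A} {x : A} → x ∈ toList mx → mx ≡ just x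
toList-∈ {mx = just x} (here refl) = refl

columnFrom-All : ∀ j i V → All (λ e → col e ≡ j × i ≤ row e) (columnFrom j i V)
columnFrom-All j i []        = []
columnFrom-All j i (row ∷ V) = AllP.++⁺ (AllP.map⁺ (All.universal (λ _ → refl , ≤-refl) (toList (cell row j))))
  (All.map (λ (p , q) → p , <⇒≤ q) (columnFrom-All j (suc i) V))

∈-columnFrom⁻ : ∀ j i V {e} → e ∈ columnFrom j i V → ∃ λ t → row e ≡ i + t × Has V t j (val e)
∈-columnFrom⁻ j i ((off , es) ∷ V) e∈ with ∈-++⁻ (map (λ x → ⟨ i , j , x ⟩) (toList (cell (off , es) j))) e∈
... | inj₂ q with t , p , h ← ∈-columnFrom⁻ j (suc i) V q = suc t , trans p (sym (+-suc i t)) , h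
... | inj₁ q with x , x∈ , refl ← ∈-map⁻ (λ x → ⟨ i , j , x ⟩) q with k , p , n ← cell⇒ off es j (toList-∈ x∈) =
  0 , sym (+-identityʳ i) , off , es , k , refl , p , n

∈-columnFrom⁺ : ∀ j i V {t x} → Has V t j x → ⟨ i + t , j , x ⟩ ∈ columnFrom j i V
∈-columnFrom⁺ j i ((off , es) ∷ V) {zero} {x} (_ , _ , k , refl , refl , n) rewrite cell⇐ off es k | n | +-identityʳ i = here refl
∈-columnFrom⁺ j i ((off , es) ∷ V) {suc t} {x} (o , f , k , p , q , n) rewrite +-suc i t =
  ∈-++⁺ʳ (map (λ x → ⟨ i , j , x ⟩) (toList (cell (off , es) j))) (∈-columnFrom⁺ j (suc i) V (o , f , k , p , q , n))

infix 4 _◂_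
_◂_ : ℕ × ℕ → ℕ × ℕ → Set
p ◂ q = proj₂ q < proj₂ p ⊎ (proj₂ p ≡ proj₂ q × proj₁ p < proj₁ q)

◂-asym : ∀ {p q} → p ◂ q → q ◂ p → ⊥
◂-asym (inj₁ p)       (inj₁ q)       = <-asym p q
◂-asym (inj₁ p)       (inj₂ (q , _)) = <-irrefl q p
◂-asym (inj₂ (p , _)) (inj₁ q)       = <-irrefl p q
◂-asym (inj₂ (_ , p)) (inj₂ (_ , q)) = <-asym p q

columnFrom-sorted : ∀ j i V → AllPairs (λ e e′ → place e ◂ place e′) (columnFrom j i V)
columnFrom-sorted j i []        = []
columnFrom-sorted j i (row ∷ V) with cell row j
... | nothing = columnFrom-sorted j (suc i) V
... | just x  = All.map (λ (p , q) → inj₂ (sym p , q)) (columnFrom-All j (suc i) V) ∷ columnFrom-sorted j (suc i) V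

colCells-All : ∀ c V → All (λ e → col e ≤ c) (colCells c V)
colCells-All zero    V = []
colCells-All (suc c) V = AllP.++⁺ (All.map (≤-reflexive ∘ proj₁) (columnFrom-All (suc c) 0 V)) (All.map m≤n⇒m≤1+n (colCells-All c V))

colCells-sorted : ∀ c V → AllPairs (λ e e′ → place e ◂ place e′) (colCells c V)
colCells-sorted zero    V = []
colCells-sorted (suc c) V = APP.++⁺ (columnFrom-sorted (suc c) 0 V) (colCells-sorted c V)
  (All.map (λ (p , _) → All.map (λ q → inj₁ (≤-trans (s≤s q) (≤-reflexive (sym p)))) (colCells-All c V)) (columnFrom-All (suc c) 0 V))

∈-colCells⁻ : ∀ c V {e} → e ∈ colCells c V → Has V (row e) (col e) (val e)
∈-colCells⁻ (suc c) V e∈ with ∈-++⁻ (columnFrom (suc c) 0 V) e∈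
... | inj₂ q = ∈-colCells⁻ c V q
... | inj₁ q with t , refl , h ← ∈-columnFrom⁻ (suc c) 0 V q with refl , _ ← All.lookup (columnFrom-All (suc c) 0 V) q = h

∈-colCells⁺ : ∀ c V {r j x} → 1 ≤ j → j ≤ c → Has V r j x → ⟨ r , j , x ⟩ ∈ colCells c V
∈-colCells⁺ zero    V l u h = ⊥-elim (<⇒≱ l u)
∈-colCells⁺ (suc c) V {r} {j} l u h with m≤n⇒m<n∨m≡n u
... | inj₁ (s≤s u′) = ∈-++⁺ʳ (columnFrom (suc c) 0 V) (∈-colCells⁺ c V l u′ h)
... | inj₂ refl     = ∈-++⁺ˡ (∈-columnFrom⁺ (suc c) 0 V h)

module _ c V (bounded : ∀ {r j} → InShape (shape V) r j → j ≤ c) where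

  colCells-↭ : colCells c V ↭ cells V
  colCells-↭ = ∼bag⇒↭ (unique∧set⇒bag
    (AllPairs-map-∈ (λ { _ _ r refl → ◂-asym r r }) (colCells-sorted c V))
    (AllPairs-map-∈ (λ { {x} _ _ r refl → ◁-asym {x} {x} r r }) (cells-sorted V))
    (mk⇔ (λ e∈ → ∈-cells⁺ V (∈-colCells⁻ c V e∈))
         (λ e∈ → inside (∈-cells⁻ V e∈))))
    where
    positive : ∀ {r j} → InShape (shape V) r j → 1 ≤ j
    positive (_ , _ , _ , l , _) = ≤-trans (s≤s z≤n) l
    inside : ∀ {r j x} → Has V r j x → ⟨ r , j , x ⟩ ∈ colCells c V
    inside h = ∈-colCells⁺ c V (positive (Has⇒InShape V h)) (bounded (Has⇒InShape V h)) h

nth-applyDownFrom : (f : ℕ → A) {n k : ℕ} → k < n → nth (applyDownFrom f n) k ≡ just (f (n ∸ suc k))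
nth-applyDownFrom f {suc n} {zero}  _       = refl
nth-applyDownFrom f {suc n} {suc k} (s≤s l) = nth-applyDownFrom f l

countGe≤length : ∀ c xs → countGe c xs ≤ length xs
countGe≤length c xs = length-filter (c ≤?_) xs

Decr-head : ∀ x xs → Decr (x ∷ xs) → All (_≤ x) xs
Decr-head x []       _       = []
Decr-head x (y ∷ xs) (p , q) = p ∷ All.map (λ l → ≤-trans l p) (Decr-head y xs q)

Decr-tail : ∀ x xs → Decr (x ∷ xs) → Decr xs
Decr-tail x []       _       = _
Decr-tail x (y ∷ xs) (_ , q) = q

-- For a decreasing list `countGe` gives the conjugate partition. Together with `countGe⁻` this
-- trades conditions on the rows of `U` for conditions on the rows of `V`.
countGe⁺ : ∀ {c} xs → Decr xs → ∀ {r a} → nth xs r ≡ just a → c ≤ a → r < countGe c xs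
countGe⁺ {c} (x ∷ xs) D {zero}  refl l rewrite filter-accept (c ≤?_) {xs = xs} l = s≤s z≤n
countGe⁺ {c} (x ∷ xs) D {suc r} p    l rewrite filter-accept (c ≤?_) {xs = xs} (≤-trans l (All.lookup (Decr-head x xs D) (nth-∈ xs p))) =
  s≤s (countGe⁺ xs (Decr-tail x xs D) p l)

countGe⁻ : ∀ {c} xs → Decr xs → ∀ {r a} → nth xs r ≡ just a → r < countGe c xs → c ≤ a
countGe⁻ {c} (x ∷ xs) D {r} p l with c ≤? x
... | no c≰x with () ← subst (r <_) (cong length (filter-none (c ≤?_) {xs = x ∷ xs} (c≰x ∷ All.map (λ y≤x c≤y → c≰x (≤-trans c≤y y≤x)) (Decr-head x xs D)))) l
countGe⁻ {c} (x ∷ xs) D {zero}  refl l | yes c≤x = c≤x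
countGe⁻ {c} (x ∷ xs) D {suc r} p    l | yes c≤x = countGe⁻ xs (Decr-tail x xs D) p
  (s≤s⁻¹ (subst (suc r <_) (cong length (filter-accept (c ≤?_) {xs = xs} c≤x)) l))

compRow-sorted : ∀ T k → AllPairs _≤_ (compRow T k)
compRow-sorted T k = subst (AllPairs _≤_) (sym (compRow-cells T k))
  (APP.map⁺ (AllPairs-map-∈ (λ { _ _ (inj₁ r) → s≤s (<⇒≤ r) ; _ _ (inj₂ (r , _)) → s≤s (≤-reflexive (sym r)) })
    (APP.filter⁺ (λ e → val e ≟ k) (yamCells-sorted T))))

cells-ext : (xs ys : List Cell) → map place xs ≡ map place ys → map val xs ≡ map val ys → xs ≡ ys
cells-ext []       []       _ _ = refl
cells-ext (x ∷ xs) (y ∷ ys) p q with refl ← ∷-injectiveˡ p | refl ← ∷-injectiveˡ q = cong (_ ∷_) (cells-ext xs ys (∷-injectiveʳ p) (∷-injectiveʳ q))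

rowWord-rows : ∀ (f : ℕ → List ℕ) n → rowWord (map (λ k → 0 , f k) (upTo n)) ≡ concatMap f (downFrom n)
rowWord-rows f n = begin
  concat (reverse (map proj₂ (map (λ k → 0 , f k) (upTo n)))) ≡⟨ cong (concat ∘ reverse) (map-∘ (upTo n)) ⟨
  concat (reverse (map f (upTo n))) ≡⟨ cong concat (reverse-map f (upTo n)) ⟨
  concatMap f (reverse (upTo n)) ≡⟨ cong (concatMap f) (reverse-upTo n) ⟩
  concatMap f (downFrom n) ∎
  where open ≡-Reasoning

module Transpose {d m U V} (lr : IsLRTab d m U) (ot : IsOt d m U V) where
  open LR lr

  V-shape : shape V ≡ otShape d m U
  V-shape = proj₁ ot

  V-length : length V ≡ m
  V-length = trans (sym (length-map _ V)) (trans (cong length V-shape) (length-applyDownFrom _ m))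

  outer-length : length (outer U) ≡ d
  outer-length = trans (length-map _ U) (proj₁ box)

  inner-length : length (inner U) ≡ d
  inner-length = trans (length-map _ U) (proj₁ box)

  cO cI : ℕ → ℕ
  cO c = countGe c (outer U)
  cI c = countGe c (inner U)

  cO≤d : ∀ c → cO c ≤ d
  cO≤d c = ≤-trans (countGe≤length c (outer U)) (≤-reflexive outer-length)

  cI≤d : ∀ c → cI c ≤ d
  cI≤d c = ≤-trans (countGe≤length c (inner U)) (≤-reflexive inner-length)

  -- Transposition followed by rotation. Since rows count from 0 and columns from 1, the two shifts
  -- cancel; `suc m ∸ col` in `columns` is the same row of `V` counted from 1.
  φ : Cell → ℕ × ℕ
  φ e = m ∸ col e , d ∸ row e

  V⇒U : ∀ {i j} → InShape (shape V) i j → j ≤ d × ∃ λ e → e ∈ cells U × φ e ≡ (i , j)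
  V⇒U {i} {j} (a , b , p , l , u) = j≤d , e , e∈ , cong₂ _,_ (trans (cong (m ∸_) col-e) (m∸[m∸n]≡n (<⇒≤ i<m))) (m∸[m∸n]≡n j≤d)
    where
    p′ : nth (otShape d m U) i ≡ just (a , b)
    p′ = subst (λ S → nth S i ≡ just (a , b)) V-shape p
    i<m : i < m
    i<m = subst (i <_) (length-applyDownFrom _ m) (nth-just-< (otShape d m U) p′)
    c r : ℕ
    c = suc (m ∸ suc i)
    r = d ∸ j
    col-e : c ≡ m ∸ i
    col-e = sym (+-∸-assoc 1 i<m)
    ab : (a , b) ≡ (d ∸ cO c , d ∸ cI c)
    ab = sym (just-injective (trans (sym (nth-applyDownFrom _ i<m)) p′))
    l′ : d ∸ cO c < j
    l′ = subst (_< j) (cong proj₁ ab) l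
    u′ : j ≤ d ∸ cI c
    u′ = subst (j ≤_) (cong proj₂ ab) u
    j≤d : j ≤ d
    j≤d = ≤-trans u′ (m∸n≤m d (cI c))
    r<d : r < d
    r<d = ∸-monoʳ-< {d} {j} {0} (≤-trans (s≤s z≤n) l′) j≤d
    swap-∸ : ∀ {x y} → x ≤ d → y ≤ d ∸ x → x ≤ d ∸ y
    swap-∸ {x} {y} x≤d q = m+n≤o⇒m≤o∸n x (≤-trans (≤-reflexive (+-comm x y)) (m≤o∸n⇒m+n≤o y x≤d q))
    r<cO : r < cO c
    r<cO = ≰⇒> (λ q → <⇒≱ l′ (swap-∸ j≤d q))
    cI≤r : cI c ≤ r
    cI≤r = swap-∸ (cI≤d c) u′
    U-shape : InShape (shape U) r c
    U-shape with (a′ , b′) , q ← nth-< (shape U) (≤-trans r<d (≤-reflexive (sym (trans (length-map _ U) (proj₁ box))))) =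
      a′ , b′ , q , ≰⇒> (λ c≤a → <⇒≱ (countGe⁺ (inner U) inner-Decr (nth-inner q) c≤a) cI≤r) , countGe⁻ (outer U) outer-Decr (nth-outer q) r<cO
    e = ⟨ r , c , proj₁ (fill U-shape) ⟩
    e∈ = proj₂ (fill U-shape)

  U⇒V : ∀ {e} → e ∈ cells U → InShape (shape V) (m ∸ col e) (d ∸ row e)
  U⇒V {⟨ r , zero , _ ⟩} e∈ = ⊥-elim (<⇒≱ (col≥1 e∈) z≤n)
  U⇒V {⟨ r , suc c , _ ⟩} e∈ with ∈-InShape e∈
  ... | a , b , p , l , u = subst (λ S → InShape S (m ∸ suc c) (d ∸ r)) (sym V-shape)
    (d ∸ cO (suc c) , d ∸ cI (suc c) ,
     trans (nth-applyDownFrom _ {m} {m ∸ suc c} (∸-monoʳ-< {m} {suc c} {0} (s≤s z≤n) c<m)) (cong (λ k → just (d ∸ cO (suc k) , d ∸ cI (suc k))) index) ,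
     ∸-monoʳ-< (countGe⁺ (outer U) outer-Decr (nth-outer p) u) (cO≤d (suc c)) ,
     ∸-monoʳ-≤ d (≮⇒≥ (λ r<cI → <⇒≱ l (countGe⁻ (inner U) inner-Decr (nth-inner p) r<cI))))
    where
    c<m : c < m
    c<m = col≤ e∈
    index : m ∸ suc (m ∸ suc c) ≡ c
    index = trans (cong (m ∸_) (sym (+-∸-assoc 1 c<m))) (m∸[m∸n]≡n (<⇒≤ c<m))

  place-order : AllPairs (λ e e′ → φ e ◂ φ e′) (yamCells U)
  place-order = AllPairs-map-∈ (λ e∈ e′∈ → reversed (∈-yamCells⁻ U e∈) (∈-yamCells⁻ U e′∈)) (yamCells-sorted U)
    where
    reversed : ∀ {e e′} → e ∈ cells U → e′ ∈ cells U → e′ ◁ e → φ e ◂ φ e′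
    reversed p p′ (inj₁ r)       = inj₁ (∸-monoʳ-< r (<⇒≤ (row< p′)))
    reversed p p′ (inj₂ (r , c)) = inj₂ (cong (d ∸_) (sym r) , ∸-monoʳ-< c (col≤ p))

  -- `φ` carries the Yamanouchi reading of `U`, rows from the top and each from the right, to the
  -- column reading of `V`, columns from the right and each from the top. Both lists are therefore
  -- sorted for `_◂_`, and the shapes give the same members.
  places : map place (colCells d V) ≡ map φ (yamCells U)
  places = sorted-ext _◂_ ◂-asym (APP.map⁺ (colCells-sorted d V)) (APP.map⁺ place-order) to from
    where
    to : ∀ {z} → z ∈ map place (colCells d V) → z ∈ map φ (yamCells U)
    to z∈ with e , e∈ , refl ← ∈-map⁻ place z∈ with _ , e′ , e′∈ , eq ← V⇒U (Has⇒InShape V (∈-colCells⁻ d V e∈)) =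
      subst (_∈ map φ (yamCells U)) eq (∈-map⁺ φ (∈-yamCells⁺ U e′∈))
    from : ∀ {z} → z ∈ map φ (yamCells U) → z ∈ map place (colCells d V)
    from z∈ with e , e∈ , refl ← ∈-map⁻ φ z∈ with i ← U⇒V (∈-yamCells⁻ U e∈) with x , h ← InShape⇒Has V i =
      ∈-map⁺ place (∈-colCells⁺ d V (m<n⇒0<n∸m (row< (∈-yamCells⁻ U e∈))) (m∸n≤m d (row e)) h)

  en : List (ℕ × Cell)
  en = enum 0 (yamCells U)

  occ : ℕ × Cell → ℕ
  occ e = count (val (proj₂ e)) (take (proj₁ e) (map val (yamCells U)))

  ζ : ℕ × Cell → Cell
  ζ e = ⟨ m ∸ col (proj₂ e) , d ∸ row (proj₂ e) , suc (occ e) ⟩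

  colCells-ζ : colCells d V ≡ map ζ en
  colCells-ζ = cells-ext _ _
    (trans places (trans (cong (map φ) (sym (enum-proj₂ 0 (yamCells U)))) (trans (sym (map-∘ en)) (map-∘ en))))
    (begin
      map val (colCells d V) ≡⟨ colCells-val d V ⟩
      colWord d V ≡⟨ proj₂ ot ⟩
      relabel (yam U) ≡⟨ cong relabel (yam-cells U) ⟩
      relabel (map val (yamCells U)) ≡⟨ zipWith-enum (λ k a → suc (count a (take k (map val (yamCells U))))) val (yamCells U) ⟩
      map (suc ∘ occ) en ≡⟨ map-∘ en ⟩
      map val (map ζ en) ∎)
    where open ≡-Reasoning

  Cs : List (List ℕ)
  Cs = columns d m U

  f : Cell → ℕ
  f e = suc m ∸ col e

  -- The entry `suc k` of `V` sits at the images of those cells of `U` whose letter has occurred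
  -- exactly `k` times before: one cell for each letter with more than `k` occurrences, and its row
  -- in `V` is entry `k` of the column of that letter. The two sides list these rows in different
  -- orders, whence a permutation, which `compRow-rowOf` turns into an equality by sortedness.
  compRow-↭ : ∀ k → compRow V (suc k) ↭ rowOf Cs k
  compRow-↭ k = begin
    compRow V (suc k) ≡⟨ compRow-cells V (suc k) ⟩
    map (suc ∘ row) (sel val (suc k) (reverse (cells V)))
      ↭⟨ PermP.map⁺ (suc ∘ row) (PermP.filter-↭ (λ e → val e ≟ suc k) (↭-trans (PermP.↭-reverse (cells V)) (↭-sym (colCells-↭ d V (λ i → proj₁ (V⇒U i)))))) ⟩
    map (suc ∘ row) (sel val (suc k) (colCells d V)) ≡⟨ cong (map (suc ∘ row) ∘ sel val (suc k)) colCells-ζ ⟩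
    map (suc ∘ row) (sel val (suc k) (map ζ en)) ≡⟨ cong (map (suc ∘ row)) (sel-map val ζ (suc k) en) ⟩
    map (suc ∘ row) (map ζ (sel (suc ∘ occ) (suc k) en)) ≡⟨ map-∘ (sel (suc ∘ occ) (suc k) en) ⟨
    map (λ e → suc (m ∸ col (proj₂ e))) (sel (suc ∘ occ) (suc k) en)
      ≡⟨ map-cong-∈ (sel (suc ∘ occ) (suc k) en) (λ e∈ → sym (+-∸-assoc 1 (en-col (proj₁ (∈-sel⁻ (suc ∘ occ) (suc k) en e∈))))) ⟩
    map (f ∘ proj₂) (sel (suc ∘ occ) (suc k) en) ≡⟨ cong (map (f ∘ proj₂)) (sel-cong (All.universal (λ _ → suc-injective , cong suc) en)) ⟩
    map (f ∘ proj₂) (sel occ k en)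
      ↭⟨ PermP.map⁺ (f ∘ proj₂) (concat-sel-↭ (val ∘ proj₂) d {sel occ k en} (AllP.filter⁺ (λ e → occ e ≟ k) (All-enum 0 (PermP.All-resp-↭ (↭-sym (PermP.↭-reverse (cells U))) letters)))) ⟨
    map (f ∘ proj₂) (concatMap (λ a → sel (val ∘ proj₂) (suc a) (sel occ k en)) (upTo d)) ≡⟨ map-concatMap (f ∘ proj₂) _ (upTo d) ⟩
    concatMap (λ a → map (f ∘ proj₂) (sel (val ∘ proj₂) (suc a) (sel occ k en))) (upTo d) ≡⟨ concatMap-cong pick (upTo d) ⟩
    concatMap (λ a → toList (nth (map f (letter (suc a) U)) k)) (upTo d) ≡⟨ concatMap-map (λ c → toList (nth c k)) (λ a → map f (letter (suc a) U)) (upTo d) ⟨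
    rowOf Cs k ∎
    where
    open Perm.PermutationReasoning
    en-col : ∀ {e} → e ∈ en → col (proj₂ e) ≤ m
    en-col e∈ with _ , _ , n ← enum-nth 0 e∈ = col≤ (∈-yamCells⁻ U (nth-∈ (yamCells U) n))
    toList-map : ∀ {A B : Set} (g : A → B) mx → map g (toList mx) ≡ toList (Maybe.map g mx)
    toList-map g (just x) = refl
    toList-map g nothing  = refl
    pick : ∀ a → map (f ∘ proj₂) (sel (val ∘ proj₂) (suc a) (sel occ k en)) ≡ toList (nth (map f (letter (suc a) U)) k)
    pick a = trans (cong (map (f ∘ proj₂)) (trans (sel-comm (val ∘ proj₂) occ (suc a) k en)
        (sel-nth occ k (sel (val ∘ proj₂) (suc a) en) (enum-count val (suc a) (yamCells U)))))
      (trans (toList-map (f ∘ proj₂) (nth (sel (val ∘ proj₂) (suc a) en) k)) (cong toList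
        (trans (sym (nth-map (f ∘ proj₂) (sel (val ∘ proj₂) (suc a) en) k))
          (cong (λ l → nth l k) (trans (map-∘ (sel (val ∘ proj₂) (suc a) en)) (cong (map f)
            (trans (sym (sel-map val proj₂ (suc a) en)) (cong (sel val (suc a)) (enum-proj₂ 0 (yamCells U))))))))))

  compRow-rowOf : ∀ k → compRow V (suc k) ≡ rowOf Cs k
  compRow-rowOf k = sorted-↭ (compRow-sorted V (suc k)) (rowOf-sorted k columns-≼) (compRow-↭ k)

  companion : ι V ≡ map (λ k → 0 , rowOf Cs k) (upTo m)
  companion = trans (map-cong (λ k → cong (0 ,_) (compRow-rowOf k)) (upTo (length V))) (cong (λ n → map (λ k → 0 , rowOf Cs k) (upTo n)) V-length)

  companion-word : KnuthEq (rowWord (ι V)) (map (λ e → suc m ∸ col e) (byLetter d U))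
  companion-word = ~-reflexive (trans (cong rowWord companion) (rowWord-rows (rowOf Cs) m))
    ◅◅ row~column m columns-≼ columns-ascending columns-length
    ◅◅ ~-reflexive columns-word

-- Rotation

length-reverse-map : (f : A → B) (xs : List A) → length (reverse (map f xs)) ≡ length xs
length-reverse-map f xs = trans (length-reverse (map f xs)) (length-map f xs)

rotRow : ℕ → ℕ → Row → Row
rotRow c a row = c ∸ (proj₁ row + length (proj₂ row)) , reverse (map (λ x → suc a ∸ x) (proj₂ row))

bullet-rotRow : ∀ c a X → bullet c a X ≡ reverse (map (rotRow c a) X)
bullet-rotRow c a X = cong reverse (map-cong (λ _ → refl) X)

Within : ℕ → Tab → Set
Within c X = All (λ row → proj₁ row + length (proj₂ row) ≤ c) X

SkewInBox⇒Within : ∀ {d m T} → SkewInBox d m T → Within m T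
SkewInBox⇒Within {T = T} box = AllP.map⁻ (AllL⇒All (outer T) (proj₂ (proj₂ (proj₂ box))))

-- Rows count from 0, columns and letters from 1: hence `r ∸ suc (row e)` beside `suc c ∸ col e`.
rotCell : ℕ → ℕ → ℕ → Cell → Cell
rotCell r c a e = ⟨ r ∸ suc (row e) , suc c ∸ col e , suc a ∸ val e ⟩

cellsFrom-++ : ∀ i X Y → cellsFrom i (X ++ Y) ≡ cellsFrom (i + length X) Y ++ cellsFrom i X
cellsFrom-++ i []              Y = trans (cong (λ j → cellsFrom j Y) (sym (+-identityʳ i))) (sym (++-identityʳ _))
cellsFrom-++ i ((off , es) ∷ X) Y = trans (cong (_++ rowCells i off es) (trans (cellsFrom-++ (suc i) X Y)
  (cong (λ j → cellsFrom j Y ++ cellsFrom (suc i) X) (sym (+-suc i (length X)))))) (++-assoc (cellsFrom (i + suc (length X)) Y) (cellsFrom (suc i) X) (rowCells i off es))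

rowCells-++ : ∀ r c es fs → rowCells r c (es ++ fs) ≡ rowCells r c es ++ rowCells r (c + length es) fs
rowCells-++ r c []       fs = cong (λ j → rowCells r j fs) (sym (+-identityʳ c))
rowCells-++ r c (x ∷ es) fs = cong (⟨ r , suc c , x ⟩ ∷_) (trans (rowCells-++ r (suc c) es fs)
  (cong (λ j → rowCells r (suc c) es ++ rowCells r j fs) (sym (+-suc c (length es)))))

rowCells-rot : ∀ R c a i r off es → R ∸ suc i ≡ r → off + length es ≤ c →
  rowCells r (c ∸ (off + length es)) (reverse (map (λ x → suc a ∸ x) es)) ≡ reverse (map (rotCell R c a) (rowCells i off es))
rowCells-rot R c a i r off []       p l = refl
rowCells-rot R c a i r off (x ∷ es) p l = begin
  rowCells r c′ (reverse (map comp (x ∷ es))) ≡⟨ cong (rowCells r c′) (unfold-reverse (comp x) (map comp es)) ⟩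
  rowCells r c′ (reverse (map comp es) ++ [ comp x ]) ≡⟨ rowCells-++ r c′ (reverse (map comp es)) [ comp x ] ⟩
  rowCells r c′ (reverse (map comp es)) ++ [ ⟨ r , suc (c′ + length (reverse (map comp es))) , comp x ⟩ ]
    ≡⟨ cong₂ (λ xs j → xs ++ [ ⟨ r , j , comp x ⟩ ])
         (trans (cong (λ j → rowCells r (c ∸ j) (reverse (map comp es))) (+-suc off (length es)))
                (rowCells-rot R c a i r (suc off) es p (≤-trans (≤-reflexive (sym (+-suc off (length es)))) l)))
         last-col ⟩
  reverse (map rot (rowCells i (suc off) es)) ++ [ ⟨ r , suc c ∸ suc off , comp x ⟩ ]
    ≡⟨ cong (λ k → reverse (map rot (rowCells i (suc off) es)) ++ [ ⟨ k , suc c ∸ suc off , comp x ⟩ ]) p ⟨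
  reverse (map rot (rowCells i (suc off) es)) ++ [ rot ⟨ i , suc off , x ⟩ ] ≡⟨ unfold-reverse (rot ⟨ i , suc off , x ⟩) (map rot (rowCells i (suc off) es)) ⟨
  reverse (map rot (rowCells i off (x ∷ es))) ∎
  where
  open ≡-Reasoning
  comp = λ y → suc a ∸ y
  rot  = rotCell R c a
  c′   = c ∸ (off + suc (length es))
  last-col : suc (c′ + length (reverse (map comp es))) ≡ c ∸ off
  last-col = begin
    suc (c′ + length (reverse (map comp es))) ≡⟨ cong (λ n → suc (c′ + n)) (trans (length-reverse (map comp es)) (length-map comp es)) ⟩
    suc (c′ + length es) ≡⟨ +-suc c′ (length es) ⟨
    c′ + suc (length es) ≡⟨ cong (_+ suc (length es)) (∸-+-assoc c off (suc (length es))) ⟨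
    c ∸ off ∸ suc (length es) + suc (length es) ≡⟨ m∸n+n≡m (m+n≤o⇒m≤o∸n (suc (length es)) (≤-trans (≤-reflexive (+-comm (suc (length es)) off)) l)) ⟩
    c ∸ off ∎

-- Rotation reverses the reading order. `Within` prevents the subtraction that gives the new offsets
-- from being cut off at 0.
bullet-cells : ∀ c a X → Within c X → cells (bullet c a X) ≡ reverse (map (rotCell (length X) c a) (cells X))
bullet-cells c a X ls = trans (cong cells (bullet-rotRow c a X)) (go 0 X refl ls)
  where
  R = length X
  rot = rotCell R c a
  go : ∀ i Y → i + length Y ≡ R → Within c Y → cells (reverse (map (rotRow c a) Y)) ≡ reverse (map rot (cellsFrom i Y))
  go i [] _ _ = refl
  go i ((off , es) ∷ Y) p (l ∷ ls) = begin
    cells (reverse (map (rotRow c a) ((off , es) ∷ Y))) ≡⟨ cong cells (unfold-reverse (rotRow c a (off , es)) (map (rotRow c a) Y)) ⟩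
    cells (rotY ++ [ rotRow c a (off , es) ]) ≡⟨ cellsFrom-++ 0 rotY [ rotRow c a (off , es) ] ⟩
    rowCells (length rotY) (c ∸ (off + length es)) (reverse (map (λ x → suc a ∸ x) es)) ++ cells rotY
      ≡⟨ cong₂ _++_ (rowCells-rot R c a i (length rotY) off es len l) (go (suc i) Y (trans (sym (+-suc i (length Y))) p) ls) ⟩
    reverse (map rot (rowCells i off es)) ++ reverse (map rot (cellsFrom (suc i) Y)) ≡⟨ reverse-++ (map rot (cellsFrom (suc i) Y)) (map rot (rowCells i off es)) ⟨
    reverse (map rot (cellsFrom (suc i) Y) ++ map rot (rowCells i off es)) ≡⟨ cong reverse (map-++ rot (cellsFrom (suc i) Y) (rowCells i off es)) ⟨
    reverse (map rot (cellsFrom i ((off , es) ∷ Y))) ∎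
    where
    open ≡-Reasoning
    rotY = reverse (map (rotRow c a) Y)
    len : R ∸ suc i ≡ length rotY
    len = begin
      R ∸ suc i ≡⟨ cong (_∸ suc i) (trans (sym p) (+-suc i (length Y))) ⟩
      suc i + length Y ∸ suc i ≡⟨ m+n∸m≡n (suc i) (length Y) ⟩
      length Y ≡⟨ length-reverse-map (rotRow c a) Y ⟨
      length rotY ∎

bullet-length : ∀ c a X → length (bullet c a X) ≡ length X
bullet-length c a X = trans (cong length (bullet-rotRow c a X)) (length-reverse-map (rotRow c a) X)

bullet-rowWord : ∀ c a X → Within c X → rowWord (bullet c a X) ≡ complement a (rowWord X)
bullet-rowWord c a X ls = begin
  rowWord (bullet c a X) ≡⟨ cells-val (bullet c a X) ⟨
  map val (cells (bullet c a X)) ≡⟨ cong (map val) (bullet-cells c a X ls) ⟩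
  map val (reverse (map (rotCell (length X) c a) (cells X))) ≡⟨ reverse-map val (map (rotCell (length X) c a) (cells X)) ⟩
  reverse (map val (map (rotCell (length X) c a) (cells X))) ≡⟨ cong reverse (trans (sym (map-∘ (cells X))) (map-∘ (cells X))) ⟩
  reverse (map (λ x → suc a ∸ x) (map val (cells X))) ≡⟨ cong (reverse ∘ map (λ x → suc a ∸ x)) (cells-val X) ⟩
  reverse (map (λ x → suc a ∸ x) (rowWord X)) ≡⟨ reverse-map (λ x → suc a ∸ x) (rowWord X) ⟨
  complement a (rowWord X) ∎
  where open ≡-Reasoning

complement-involutive : ∀ a {w} → All (_≤ suc a) w → reverse (map (λ x → suc a ∸ x) (reverse (map (λ x → suc a ∸ x) w))) ≡ w
complement-involutive a {w} ps = begin
  reverse (map comp (reverse (map comp w))) ≡⟨ cong reverse (reverse-map comp (map comp w)) ⟩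
  reverse (reverse (map comp (map comp w))) ≡⟨ reverse-involutive _ ⟩
  map comp (map comp w) ≡⟨ map-∘ w ⟨
  map (comp ∘ comp) w ≡⟨ map-cong-∈ w (λ x∈ → m∸[m∸n]≡n (All.lookup ps x∈)) ⟩
  map id w ≡⟨ map-id w ⟩
  w ∎
  where
  open ≡-Reasoning
  comp = λ x → suc a ∸ x

bullet-involutive : ∀ c a {X} → Within c X → All (λ row → All (_≤ a) (proj₂ row)) X → bullet c a (bullet c a X) ≡ X
bullet-involutive c a {X} ls ps = begin
  bullet c a (bullet c a X) ≡⟨ trans (cong (bullet c a) (bullet-rotRow c a X)) (bullet-rotRow c a (reverse (map rot X))) ⟩
  reverse (map rot (reverse (map rot X))) ≡⟨ cong reverse (reverse-map rot (map rot X)) ⟩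
  reverse (reverse (map rot (map rot X))) ≡⟨ reverse-involutive _ ⟩
  map rot (map rot X) ≡⟨ map-∘ X ⟨
  map (rot ∘ rot) X ≡⟨ map-cong-∈ X (λ x∈ → rot-rot (All.lookup ls x∈) (All.lookup ps x∈)) ⟩
  map id X ≡⟨ map-id X ⟩
  X ∎
  where
  open ≡-Reasoning
  rot = rotRow c a
  rot-rot : ∀ {x} → proj₁ x + length (proj₂ x) ≤ c → All (_≤ a) (proj₂ x) → rot (rot x) ≡ x
  rot-rot {off , es} l p = cong₂ _,_ offset (complement-involutive a (All.map m≤n⇒m≤1+n p))
    where
    offset : c ∸ (c ∸ (off + length es) + length (reverse (map (λ x → suc a ∸ x) es))) ≡ off
    offset = begin
      c ∸ (c ∸ (off + length es) + length (reverse (map (λ x → suc a ∸ x) es))) ≡⟨ cong (λ n → c ∸ (c ∸ (off + length es) + n)) (length-reverse-map (λ x → suc a ∸ x) es) ⟩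
      c ∸ (c ∸ (off + length es) + length es) ≡⟨ cong (λ n → c ∸ (n + length es)) (∸-+-assoc c off (length es)) ⟨
      c ∸ (c ∸ off ∸ length es + length es) ≡⟨ cong (c ∸_) (m∸n+n≡m (m+n≤o⇒m≤o∸n (length es) (≤-trans (≤-reflexive (+-comm (length es) off)) l))) ⟩
      c ∸ (c ∸ off) ≡⟨ m∸[m∸n]≡n (m+n≤o⇒m≤o off l) ⟩
      off ∎

∈-bullet⁻ : ∀ c a X → Within c X → ∀ {r j x} → Has (bullet c a X) r j x → ∃ λ e → e ∈ cells X × rotCell (length X) c a e ≡ ⟨ r , j , x ⟩
∈-bullet⁻ c a X ls h with e , e∈ , eq ← ∈-map⁻ (rotCell (length X) c a) (PermP.∈-resp-↭ (↭-trans (↭-reflexive (bullet-cells c a X ls)) (PermP.↭-reverse _)) (∈-cells⁺ (bullet c a X) h)) = e , e∈ , sym eq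

cell-bounds : ∀ c X → Within c X → ∀ {e} → e ∈ cells X → row e < length X × 1 ≤ col e × col e ≤ c
cell-bounds c X ls e∈ with off , es , k , p , q , n ← ∈-cells⁻ X e∈ =
  nth-just-< X p , ≤-trans (s≤s z≤n) (≤-reflexive (sym q)) ,
  ≤-trans (≤-reflexive q) (≤-trans (+-monoʳ-< off (nth-just-< es n)) (All.lookup ls (nth-∈ X p)))

next-∸ : ∀ {n x y} → 1 ≤ x → x ≤ n → y ≤ n → n ∸ y ≡ suc (n ∸ x) → x ≡ suc y
next-∸ {n} {suc x} {y} _ x<n y≤n e = cong suc (∸-cancelˡ-≡ (<⇒≤ x<n) y≤n (sym (trans e (sym (+-∸-assoc 1 x<n)))))

-- Rotation exchanges the order of neighbours and complementing exchanges the order of their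
-- entries. The bounds on places make the truncated subtractions injective, so that adjacency can be
-- traced back to `X`; the bound on entries keeps the columns strict.
bullet-semistandard : ∀ c a X → Within c X → All (λ e → val e ≤ a) (cells X) → Semistandard X → Semistandard (bullet c a X)
bullet-semistandard c a X ls ps (rows , cols) = rows′ , cols′
  where
  bX = bullet c a X
  entry-at : ∀ {e} → e ∈ cells X → entry X (row e) (col e) ≡ just (val e)
  entry-at e∈ = Has⇒entry X _ _ (∈-cells⁻ X e∈)
  rows′ : ∀ r j x y → entry bX r j ≡ just x → entry bX r (suc j) ≡ just y → x ≤ y
  rows′ r j x y p q with ∈-bullet⁻ c a X ls (entry⇒Has bX r j p) | ∈-bullet⁻ c a X ls (entry⇒Has bX r (suc j) q)
  ... | e , e∈ , refl | e′ , e′∈ , eq with refl ← cong val eq with r< , c> , c≤ ← cell-bounds c X ls e∈ | r′< , c′> , c′≤ ← cell-bounds c X ls e′∈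
      with same ← suc-injective (∸-cancelˡ-≡ r′< r< (cong row eq))
         | next ← next-∸ {suc c} {col e} {col e′} c> (m≤n⇒m≤1+n c≤) (m≤n⇒m≤1+n c′≤) (cong col eq) =
    ∸-monoʳ-≤ (suc a) (rows (row e) (col e′) (val e′) (val e)
      (subst (λ t → entry X t (col e′) ≡ just (val e′)) same (entry-at e′∈))
      (subst (λ t → entry X (row e) t ≡ just (val e)) next (entry-at e∈)))
  cols′ : ∀ r j x y → entry bX r j ≡ just x → entry bX (suc r) j ≡ just y → x < y
  cols′ r j x y p q with ∈-bullet⁻ c a X ls (entry⇒Has bX r j p) | ∈-bullet⁻ c a X ls (entry⇒Has bX (suc r) j q)
  ... | e , e∈ , refl | e′ , e′∈ , eq with refl ← cong val eq with r< , c> , c≤ ← cell-bounds c X ls e∈ | r′< , c′> , c′≤ ← cell-bounds c X ls e′∈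
      with same ← ∸-cancelˡ-≡ {m = suc c} (m≤n⇒m≤1+n c′≤) (m≤n⇒m≤1+n c≤) (cong col eq)
         | next ← suc-injective (next-∸ {length X} {suc (row e)} {suc (row e′)} (s≤s z≤n) r< r′< (cong row eq)) =
    ∸-monoʳ-< (cols (row e′) (col e) (val e′) (val e)
      (subst (λ t → entry X (row e′) t ≡ just (val e′)) same (entry-at e′∈))
      (subst (λ t → entry X t (col e) ≡ just (val e)) next (entry-at e∈)))
      (m≤n⇒m≤1+n (All.lookup ps e∈))

Decr⇒AllPairs : ∀ xs → Decr xs → AllPairs _≥_ xs
Decr⇒AllPairs []       _ = []
Decr⇒AllPairs (x ∷ xs) D = Decr-head x xs D ∷ Decr⇒AllPairs xs (Decr-tail x xs D)

AllPairs⇒Decr : ∀ {xs} → AllPairs _≥_ xs → Decr xs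
AllPairs⇒Decr []                          = _
AllPairs⇒Decr (_ ∷ [])                    = _
AllPairs⇒Decr ((p ∷ _) ∷ ps@(_ ∷ _))      = p , AllPairs⇒Decr ps

AllPairs⇒Incr : ∀ {xs} → AllPairs _≤_ xs → Incr xs
AllPairs⇒Incr []                          = _
AllPairs⇒Incr (_ ∷ [])                    = _
AllPairs⇒Incr ((p ∷ _) ∷ ps@(_ ∷ _))      = p , AllPairs⇒Incr ps

map-bullet : (h : Row → ℕ) (c a : ℕ) (X : Tab) → map h (bullet c a X) ≡ reverse (map (h ∘ rotRow c a) X)
map-bullet h c a X = trans (cong (map h) (bullet-rotRow c a X)) (trans (reverse-map h (map (rotRow c a) X)) (cong reverse (sym (map-∘ X))))

bullet-box : ∀ {d m X} a → SkewInBox d m X → SkewInBox d m (bullet m a X)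
bullet-box {d} {m} {X} a box@(len , iD , oD , bd) = trans (bullet-length m a X) len , inner′ , outer′ , bound
  where
  ls = SkewInBox⇒Within box
  flip-Decr : ∀ xs → Decr xs → Decr (reverse (map (m ∸_) xs))
  flip-Decr xs D = AllPairs⇒Decr (AllPairs-reverse (APP.map⁺ (AllPairs-map-∈ (λ _ _ → ∸-monoʳ-≤ m) (Decr⇒AllPairs xs D))))
  inner′ : Decr (inner (bullet m a X))
  inner′ = subst Decr (sym (trans (map-bullet proj₁ m a X) (cong reverse (map-∘ X)))) (flip-Decr (outer X) oD)
  outer-rot : ∀ x → proj₁ x + length (proj₂ x) ≤ m → proj₁ (rotRow m a x) + length (proj₂ (rotRow m a x)) ≡ m ∸ proj₁ x
  outer-rot (off , es) l = trans (cong₂ _+_ (sym (∸-+-assoc m off (length es))) (length-reverse-map (λ x → suc a ∸ x) es))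
    (m∸n+n≡m (m+n≤o⇒m≤o∸n (length es) (≤-trans (≤-reflexive (+-comm (length es) off)) l)))
  outer-≡ : outer (bullet m a X) ≡ reverse (map (m ∸_) (inner X))
  outer-≡ = trans (map-bullet _ m a X) (cong reverse (trans (map-cong-∈ X (λ {x} x∈ → outer-rot x (All.lookup ls x∈))) (map-∘ X)))
  outer′ : Decr (outer (bullet m a X))
  outer′ = subst Decr (sym outer-≡) (flip-Decr (inner X) iD)
  bound : AllL (outer (bullet m a X)) (λ x → x ≤ m)
  bound = All⇒AllL (subst (All (_≤ m)) (sym outer-≡)
    (PermP.All-resp-↭ (↭-sym (PermP.↭-reverse (map (m ∸_) (inner X)))) (AllP.map⁺ (All.universal (m∸n≤m m) (inner X)))))

-- The row bound `r` is also the bound on entries, as in `IsEvac`. Beyond the order of entries,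
-- `strict` demands that an entry have one above it, which makes the row lengths decrease. The
-- record is used for `ι Tb` in the d by m box and for `ι V` in the m by d box.
record Straight (r c : ℕ) (f : ℕ → List ℕ) : Set where
  field
    weak   : ∀ k → AllPairs _≤_ (f k)
    strict : ∀ k j {y} → nth (f (suc k)) j ≡ just y → ∃ λ x → nth (f k) j ≡ just x × x < y
    width  : ∀ k → length (f k) ≤ c
    range  : ∀ k → All (λ x → 0 < x × x ≤ r) (f k)

module _ {r c f} (S : Straight r c f) where
  open Straight S

  private
    G : Tab
    G = map (λ k → 0 , f k) (upTo r)

    within : Within c G
    within = AllP.map⁺ (All.universal width (upTo r))

    small : All (λ row → All (_≤ r) (proj₂ row)) G
    small = AllP.map⁺ (All.universal (λ k → All.map proj₂ (range k)) (upTo r))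

    nth-G : ∀ {k row} → nth G k ≡ just row → row ≡ (0 , f k)
    nth-G {k} p with k′ , q , refl ← nth-map⁻ _ (upTo r) p =
      cong (λ i → 0 , f i) (just-injective (trans (sym q) (nth-applyUpTo id (≤-trans (nth-just-< (upTo r) q) (≤-reflexive (length-upTo r))))))

    Has-G : ∀ {k j x} → Has G k j x → ∃ λ t → j ≡ suc t × nth (f k) t ≡ just x
    Has-G (_ , _ , t , p , q , n) with refl ← nth-G p = t , q , n

    semistandard : Semistandard G
    semistandard = rows , cols
      where
      rows : ∀ k j x y → entry G k j ≡ just x → entry G k (suc j) ≡ just y → x ≤ y
      rows k j x y p q with t , refl , n ← Has-G (entry⇒Has G k j p) | t′ , e′ , n′ ← Has-G (entry⇒Has G k (suc j) q)
        with refl ← suc-injective e′ = AllPairs-nth (f k) (weak k) n n′ (n<1+n t)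
      cols : ∀ k j x y → entry G k j ≡ just x → entry G (suc k) j ≡ just y → x < y
      cols k j x y p q with t , refl , n ← Has-G (entry⇒Has G k j p) | t′ , e′ , n′ ← Has-G (entry⇒Has G (suc k) j q)
        with refl ← suc-injective e′ with x′ , n″ , l ← strict k t n′ = ≤-trans (s≤s (≤-reflexive (just-injective (trans (sym n) n″)))) l

    rowWord-small : All (_≤ r) (rowWord G)
    rowWord-small = PermP.All-resp-↭ (entries-↭ G) (AllP.concat⁺ (AllP.map⁺ small))

    length-step : ∀ k → length (f (suc k)) ≤ length (f k)
    length-step k = ≮⇒≥ λ l → let y , p = nth-< (f (suc k)) l ; x , q , _ = strict k (length (f k)) p in <-irrefl refl (nth-just-< (f k) q)

    length-chain : ∀ {i} j → i ≤ j → length (f j) ≤ length (f i)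
    length-chain {i} j l with m≤n⇒m<n∨m≡n l
    ... | inj₂ refl = ≤-refl
    length-chain {i} (suc j) l | inj₁ (s≤s l′) = ≤-trans (length-step j) (length-chain j l′)

    outers : All (λ x → x ≡ c) (outer (bullet c r G))
    outers = subst (All (_≡ c)) (sym (map-bullet _ c r G)) (PermP.All-resp-↭ (↭-sym (PermP.↭-reverse _))
      (AllP.map⁺ (All.map (λ {row} → full {row}) (All.zip (AllP.map⁺ {xs = upTo r} (All.universal (λ _ → refl) (upTo r)) , within)))))
      where
      full : ∀ {row} → proj₁ row ≡ 0 × proj₁ row + length (proj₂ row) ≤ c → proj₁ (rotRow c r row) + length (proj₂ (rotRow c r row)) ≡ c
      full {_ , es} (refl , l) = trans (cong (c ∸ length es +_) (length-reverse-map (λ x → suc r ∸ x) es)) (m∸n+n≡m l)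

    lengths : Incr (map (λ row → length (proj₂ row)) (bullet c r G))
    lengths = AllPairs⇒Incr (subst (AllPairs _≤_)
      (sym (trans (map-bullet _ c r G) (cong reverse (trans (map-cong (λ row → length-reverse-map (λ x → suc r ∸ x) (proj₂ row)) G) (trans (sym (map-∘ (upTo r))) (map-upTo _ r))))))
      (AllPairs-reverse (APP.applyUpTo⁺₁ _ r (λ {i} {j} i<j _ → length-chain j (<⇒≤ i<j)))))

  -- After rotation every row ends in column `c` and the lengths grow downwards, so that only the
  -- Knuth class remains to be supplied.
  bullet-straight : ∀ X → KnuthEq (rowWord (bullet c r G)) (rowWord X) → IsAntiNormalForm r c X (bullet c r G)
  bullet-straight X e =
    trans (bullet-length c r G) (trans (length-map _ (upTo r)) (length-upTo r)) , All⇒AllL outers , lengths ,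
    bullet-semistandard c r G within (cells-All G rowWord-small) semistandard , e

  bullet-bullet-straight : bullet c r (bullet c r G) ≡ G
  bullet-bullet-straight = bullet-involutive c r within small

  bullet-straight-~ : ∀ {w} → KnuthEq (rowWord G) w → KnuthEq (rowWord (bullet c r G)) (complement r w)
  bullet-straight-~ e = ~-reflexive (bullet-rowWord c r G within) ◅◅ complement-~ r rowWord-small e

-- Reversal

count-complement : ∀ {a b d} {w} → a + b ≡ suc d → All (_≤ d) w → count a (map (λ x → suc d ∸ x) w) ≡ count b w
count-complement {a} {b} {d} {w} p ps = trans (count-map (λ x → suc d ∸ x) a w) (cong length (sel-cong {g = id} (All.map both ps)))
  where
  both : ∀ {x} → x ≤ d → (suc d ∸ x ≡ a → x ≡ b) × (x ≡ b → suc d ∸ x ≡ a)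
  both {x} l =
    (λ e → trans (sym (m∸[m∸n]≡n (m≤n⇒m≤1+n l))) (trans (cong (suc d ∸_) e) (trans (cong (_∸ a) (sym p)) (m+n∸m≡n a b)))) ,
    (λ e → trans (cong (suc d ∸_) e) (trans (cong (_∸ b) (sym p)) (m+n∸n≡m a b)))

InRange : ℕ → ℕ → Set
InRange d x = 1 ≤ x × x ≤ d

complement-range : ∀ {d} {w} → All (InRange d) w → All (InRange d) (map (λ x → suc d ∸ x) w)
complement-range {d} ps = AllP.map⁺ (All.map (λ (l , u) → m<n⇒0<n∸m (s≤s u) , ∸-monoʳ-≤ (suc d) l) ps)

module Reversal {d m T Te} (lr : IsLRTab d m T) (rev : IsReversal d m T Te) where

  module L = LR lr

  sh : shape T ≡ shape Te
  sh = proj₁ (proj₁ (proj₂ rev))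

  transport : (F : List (ℕ × ℕ) → List ℕ) (g : Tab → List ℕ) → (∀ X → g X ≡ F (shape X)) → g T ≡ g Te
  transport F g h = trans (h T) (trans (cong F sh) (sym (h Te)))

  box : SkewInBox d m Te
  box with len , iD , oD , bd ← L.box =
    trans (sym (trans (sym (length-map _ T)) (trans (cong length sh) (length-map _ Te)))) len ,
    subst Decr (transport (map proj₁) inner (λ X → map-∘ X)) iD ,
    subst Decr outer≡ oD ,
    subst (λ xs → AllL xs (_≤ m)) outer≡ bd
    where
    outer≡ : outer T ≡ outer Te
    outer≡ = transport (map proj₂) outer (λ X → map-∘ X)

  Te-length : length Te ≡ d
  Te-length = proj₁ box

  within : Within m Te
  within = SkewInBox⇒Within box

  word : KnuthEq (rowWord Te) (map (λ x → suc d ∸ x) (yam T))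
  word = proj₂ (proj₂ rev) ◅◅ ~-reflexive (trans (bullet-rowWord m d T (SkewInBox⇒Within L.box))
    (cong (map (λ x → suc d ∸ x)) (sym (yam-reverse T))))

  yam-range : All (InRange d) (yam T)
  yam-range = subst (All (InRange d)) (sym (yam-cells T)) (AllP.map⁺ (PermP.All-resp-↭ (↭-sym (PermP.↭-reverse (cells T))) L.letters))

  rowWord-range : All (InRange d) (rowWord Te)
  rowWord-range = PermP.All-resp-↭ (↭-sym (~⇒↭ word)) (complement-range yam-range)

  letters : Letters d Te
  letters = cells-All Te rowWord-range

  Tb : Tab
  Tb = bullet m d Te

  yam-Tb : yam Tb ≡ map (λ x → suc d ∸ x) (rowWord Te)
  yam-Tb = begin
    yam Tb ≡⟨ yam-reverse Tb ⟩
    reverse (rowWord Tb) ≡⟨ cong reverse (bullet-rowWord m d Te within) ⟩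
    reverse (map (λ x → suc d ∸ x) (reverse (rowWord Te))) ≡⟨ cong reverse (reverse-map _ (rowWord Te)) ⟩
    reverse (reverse (map (λ x → suc d ∸ x) (rowWord Te))) ≡⟨ reverse-involutive _ ⟩
    map (λ x → suc d ∸ x) (rowWord Te) ∎
    where open ≡-Reasoning

  count-prefix : ∀ {a b} {w} → a + b ≡ suc d → All (InRange d) w → ∀ n → count a (take n (map (λ x → suc d ∸ x) w)) ≡ count b (take n w)
  count-prefix {a} {w = w} p ps n = trans (cong (count a) (take-map n w)) (count-complement p (AllP.take⁺ n (All.map proj₂ ps)))

  -- Letters beyond `d` do not occur. For the others, complementing turns `suc (suc i)` and `suc i`
  -- into `b` and `suc b`, and the condition into prefix dominance of `suc b` over `b`, which passes
  -- along `word` from the rotation of `T` to `Te`.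
  lattice : Lattice (yam Tb)
  lattice k i rewrite yam-Tb with suc (suc i) ≤? d
  ... | no big = ≤-trans (≤-reflexive (count-none (AllP.take⁺ k (All.map (λ (_ , u) e → big (≤-trans (≤-reflexive (sym e)) u)) (complement-range rowWord-range))))) z≤n
  ... | yes l = subst₂ _≤_ (sym (count-prefix low rowWord-range k)) (sym (count-prefix high rowWord-range k))
    (prefix-dominance-~ b (~-sym word) (λ n → subst₂ _≤_ (sym (count-prefix (trans (+-comm b _) low) yam-range n)) (sym (count-prefix (trans (+-comm (suc b) _) high) yam-range n))
      (proj₂ (proj₂ (proj₂ lr)) n i)) k)
    where
    b = d ∸ suc i
    high : suc i + suc b ≡ suc d
    high = trans (+-suc (suc i) b) (cong suc (m+[n∸m]≡n (<⇒≤ l)))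
    low : suc (suc i) + b ≡ suc d
    low = cong suc (m+[n∸m]≡n (<⇒≤ l))

  rotated-LR : IsLRTab d m Tb
  rotated-LR = bullet-box d box , bullet-semistandard m d Te within (All.map proj₂ letters) (proj₁ rev) ,
    All⇒AllL (PermP.All-resp-↭ (↭-sym (entries-↭ Tb)) (subst (All (1 ≤_)) (sym (bullet-rowWord m d Te within))
      (subst (All (1 ≤_)) (sym (reverse-map _ (rowWord Te))) (PermP.All-resp-↭ (↭-sym (PermP.↭-reverse _)) (All.map proj₁ (complement-range rowWord-range)))))) ,
    lattice

  yamCells-Tb : yamCells Tb ≡ map (rotCell (length Te) m d) (cells Te)
  yamCells-Tb = trans (cong reverse (bullet-cells m d Te within)) (reverse-involutive (map (rotCell (length Te) m d) (cells Te)))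

  -- The letters `suc k` of `Tb` come from the letters `d ∸ k` of `Te`, written `suc (d ∸ suc k)` to
  -- fit the indexing of companion rows; rotation reverses their order and complements their rows.
  compRow-Tb : ∀ {k} → k < d → compRow Tb (suc k) ≡ reverse (map (λ x → suc d ∸ x) (compRow Te (suc (d ∸ suc k))))
  compRow-Tb {k} k<d = begin
    compRow Tb (suc k) ≡⟨ compRow-cells Tb (suc k) ⟩
    map (suc ∘ row) (sel val (suc k) (reverse (cells Tb))) ≡⟨ cong (map (suc ∘ row) ∘ sel val (suc k)) yamCells-Tb ⟩
    map (suc ∘ row) (sel val (suc k) (map rot (cells Te))) ≡⟨ cong (map (suc ∘ row)) (trans (sel-map val rot (suc k) (cells Te)) (cong (map rot) (sel-cong (All.map (λ {e} → same {e}) letters)))) ⟩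
    map (suc ∘ row) (map rot (sel val b (cells Te))) ≡⟨ map-∘ (sel val b (cells Te)) ⟨
    map (λ e → suc (length Te ∸ suc (row e))) (sel val b (cells Te)) ≡⟨ map-cong-∈ (sel val b (cells Te)) (λ e∈ → rows (proj₁ (∈-sel⁻ val b (cells Te) e∈))) ⟩
    map (λ e → suc d ∸ suc (row e)) (sel val b (cells Te)) ≡⟨ map-∘ (sel val b (cells Te)) ⟩
    map comp (map (suc ∘ row) (sel val b (cells Te))) ≡⟨ reverse-involutive _ ⟨
    reverse (reverse (map comp (map (suc ∘ row) (sel val b (cells Te))))) ≡⟨ cong reverse (reverse-map comp (map (suc ∘ row) (sel val b (cells Te)))) ⟨
    reverse (map comp (reverse (map (suc ∘ row) (sel val b (cells Te))))) ≡⟨ cong (reverse ∘ map comp) (reverse-map (suc ∘ row) (sel val b (cells Te))) ⟨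
    reverse (map comp (map (suc ∘ row) (reverse (sel val b (cells Te))))) ≡⟨ cong (reverse ∘ map comp ∘ map (suc ∘ row)) (sel-reverse val b (cells Te)) ⟨
    reverse (map comp (map (suc ∘ row) (sel val b (reverse (cells Te))))) ≡⟨ cong (reverse ∘ map comp) (compRow-cells Te b) ⟨
    reverse (map comp (compRow Te b)) ∎
    where
    open ≡-Reasoning
    b    = suc (d ∸ suc k)
    comp = λ x → suc d ∸ x
    rot  = rotCell (length Te) m d
    b≡ : b ≡ d ∸ k
    b≡ = sym (+-∸-assoc 1 k<d)
    same : ∀ {e} → InRange d (val e) → (suc d ∸ val e ≡ suc k → val e ≡ b) × (val e ≡ b → suc d ∸ val e ≡ suc k)
    same (_ , u) = (λ p → trans (sym (m∸[m∸n]≡n (m≤n⇒m≤1+n u))) (trans (cong (suc d ∸_) p) (sym b≡))) ,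
      (λ p → trans (cong (suc d ∸_) (trans p b≡)) (m∸[m∸n]≡n {suc d} {suc k} (m≤n⇒m≤1+n k<d)))
    rows : ∀ {e} → e ∈ cells Te → suc (length Te ∸ suc (row e)) ≡ d ∸ row e
    rows {e} e∈ = trans (sym (+-∸-assoc 1 (proj₁ (cell-bounds m Te within e∈)))) (cong (_∸ row e) Te-length)

  Tb-length : length Tb ≡ d
  Tb-length = trans (bullet-length m d Te) Te-length

  companion-Tb : ι Tb ≡ map (λ k → 0 , compRow Tb (suc k)) (upTo d)
  companion-Tb = cong (λ n → map (λ k → 0 , compRow Tb (suc k)) (upTo n)) Tb-length

  companion-op : ιop m Te ≡ map (λ k → m ∸ length (compRow Te (suc k)) , compRow Te (suc k)) (upTo d)
  companion-op = cong (λ n → map (λ k → m ∸ length (compRow Te (suc k)) , compRow Te (suc k)) (upTo n)) Te-length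

  rotate-op : ι Tb ≡ bullet m d (ιop m Te)
  rotate-op = begin
    ι Tb ≡⟨ companion-Tb ⟩
    map (λ k → 0 , compRow Tb (suc k)) (upTo d) ≡⟨ map-cong-∈ (upTo d) (λ k∈ → cong₂ _,_ (sym (m≤n⇒m∸n≡0 (offset (compRow Te _)))) (compRow-Tb (∈-upTo⁻ k∈))) ⟩
    map (λ k → rotRow m d (op (d ∸ suc k))) (upTo d) ≡⟨ map-upTo-reverse (rotRow m d ∘ op) d ⟨
    reverse (map (rotRow m d ∘ op) (upTo d)) ≡⟨ cong reverse (map-∘ (upTo d)) ⟩
    reverse (map (rotRow m d) (map op (upTo d))) ≡⟨ bullet-rotRow m d (map op (upTo d)) ⟨
    bullet m d (map op (upTo d)) ≡⟨ cong (bullet m d) companion-op ⟨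
    bullet m d (ιop m Te) ∎
    where
    open ≡-Reasoning
    op : ℕ → Row
    op k = m ∸ length (compRow Te (suc k)) , compRow Te (suc k)
    offset : ∀ (xs : List ℕ) → m ≤ m ∸ length xs + length xs
    offset xs = ≤-trans (m≤n+m∸n m (length xs)) (≤-reflexive (+-comm (length xs) _))

  rotate-straight : bullet m d (ι Tb) ≡ ιop m Te
  rotate-straight = begin
    bullet m d (ι Tb) ≡⟨ trans (cong (bullet m d) companion-Tb) (bullet-rotRow m d (map st (upTo d))) ⟩
    reverse (map (rotRow m d) (map st (upTo d))) ≡⟨ cong reverse (map-∘ (upTo d)) ⟨
    reverse (map (rotRow m d ∘ st) (upTo d)) ≡⟨ map-upTo-reverse (rotRow m d ∘ st) d ⟩
    map (λ k → rotRow m d (st (d ∸ suc k))) (upTo d) ≡⟨ map-cong-∈ (upTo d) (λ k∈ → row-≡ (∈-upTo⁻ k∈)) ⟩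
    map (λ k → m ∸ length (compRow Te (suc k)) , compRow Te (suc k)) (upTo d) ≡⟨ companion-op ⟨
    ιop m Te ∎
    where
    open ≡-Reasoning
    st : ℕ → Row
    st k = 0 , compRow Tb (suc k)
    comp-range : ∀ k → All (_≤ suc d) (compRow Te k)
    comp-range k = subst (All (_≤ suc d)) (sym (compRow-cells Te k)) (AllP.map⁺ (AllP.filter⁺ (λ e → val e ≟ k)
      (All.tabulate (λ e∈ → s≤s (<⇒≤ (≤-trans (proj₁ (cell-bounds m Te within (∈-yamCells⁻ Te e∈))) (≤-reflexive Te-length)))))))
    row-≡ : ∀ {k} → k < d → rotRow m d (st (d ∸ suc k)) ≡ (m ∸ length (compRow Te (suc k)) , compRow Te (suc k))
    row-≡ {k} k<d rewrite compRow-Tb (∸-monoʳ-< {d} {suc k} {0} (s≤s z≤n) k<d)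
                        | trans (cong (d ∸_) (sym (+-∸-assoc 1 k<d))) (m∸[m∸n]≡n (<⇒≤ k<d)) =
      cong₂ _,_ (cong (m ∸_) (length-reverse-map (λ x → suc d ∸ x) (compRow Te (suc k)))) (complement-involutive d (comp-range (suc k)))

-- Companions as straight tableaux, and recovery of a tableau from its companion

module _ {d m T} (lr : IsLRTab d m T) where
  open LR lr

  -- Strictness down the columns of `ι T` is the lattice condition in the form of `above`; the width
  -- bound holds because a letter occurs at most once in each column.
  companion-Straight : Straight d m (λ k → compRow T (suc k))
  companion-Straight = record
    { weak   = λ k → compRow-sorted T (suc k)
    ; strict = below-strict
    ; width  = λ k → subst (_≤ m) (sym (trans (cong length (compRow-cells T (suc k))) (length-map _ (letter (suc k) T)))) (letter-length (suc k))
    ; range  = λ k → subst (All _) (sym (compRow-cells T (suc k))) (AllP.map⁺ (All.tabulate (λ e∈ → s≤s z≤n , row< (proj₁ (letter-∈ (suc k) e∈)))))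
    }
    where
    below-strict : ∀ k j {y} → nth (compRow T (suc (suc k))) j ≡ just y → ∃ λ x → nth (compRow T (suc k)) j ≡ just x × x < y
    below-strict k j p with e , q , refl ← nth-map⁻ (suc ∘ row) (letter (suc (suc k)) T) (subst (λ xs → nth xs j ≡ just _) (compRow-cells T (suc (suc k))) p)
      with e′ , q′ , r ← above k q =
      suc (row e′) , subst (λ xs → nth xs j ≡ just (suc (row e′))) (sym (compRow-cells T (suc k))) (nth-map⁺ (suc ∘ row) (letter (suc k) T) q′) , s≤s r

  transpose-Straight : Straight m d (rowOf (columns d m T))
  transpose-Straight = record
    { weak   = λ k → rowOf-sorted k columns-≼
    ; strict = λ k → rowOf-strict columns-≼ columns-ascending
    ; width  = λ k → ≤-trans (rowOf-length (columns d m T) k) (≤-reflexive (trans (length-map _ (upTo d)) (length-upTo d)))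
    ; range  = λ k → All-rowOf⁺ k columns-range
    }

  row-sorted : ∀ {r off es} → nth T r ≡ just (off , es) → AllPairs _≤_ es
  row-sorted {r} {off} {es} p = subst (AllPairs _≤_) (rowCells-val r off es)
    (APP.map⁺ (AllPairs-map-∈ (λ e∈ e′∈ → weakly (inside e∈) (inside e′∈)) (AllPairs-map-∈ sameRow (rowCells-sorted r off es))))
    where
    inside : ∀ {e} → e ∈ rowCells r off es → e ∈ cells T
    inside e∈ with k , refl , refl , n ← ∈-rowCells⁻ r off es e∈ = ∈-cells⁺ T (off , es , k , p , refl , n)
    sameRow : ∀ {e e′} → e ∈ rowCells r off es → e′ ∈ rowCells r off es → e ◁ e′ → row e ≡ row e′ × col e < col e′
    sameRow e∈ e′∈ (inj₂ q) = q
    sameRow e∈ e′∈ (inj₁ l) = ⊥-elim (<-irrefl (trans (at e′∈) (sym (at e∈))) l)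
      where
      at : ∀ {e} → e ∈ rowCells r off es → row e ≡ r
      at e∈ = proj₁ (All.lookup (rowCells-All r off es) e∈)
    weakly : ∀ {e e′} → e ∈ cells T → e′ ∈ cells T → row e ≡ row e′ × col e < col e′ → val e ≤ val e′
    weakly e∈ e′∈ (r , c) = mono e∈ e′∈ (≤-reflexive r) (<⇒≤ c)

  row-range : ∀ {r off es} → nth T r ≡ just (off , es) → All (InRange d) es
  row-range {r} {off} {es} p = All.tabulate λ x∈ → let k , n = ∈-nth x∈ in All.lookup letters (∈-cells⁺ T (off , es , k , p , refl , n))

sel-row : ∀ i T {t off es} → nth T t ≡ just (off , es) → sel row (i + t) (cellsFrom i T) ≡ rowCells (i + t) off es
sel-row i ((off , es) ∷ T) {zero} refl rewrite +-identityʳ i = trans (sel-++ row i (cellsFrom (suc i) T) (rowCells i off es))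
  (cong₂ _++_ (filter-none (λ e → row e ≟ i) (All.map (λ l e → <-irrefl (sym e) l) (cellsFrom-All (suc i) T)))
              (filter-all (λ e → row e ≟ i) (All.map proj₁ (rowCells-All i off es))))
sel-row i ((off , es) ∷ T) {suc t} {off′} {es′} p rewrite +-suc i t = trans (sel-++ row (suc (i + t)) (cellsFrom (suc i) T) (rowCells i off es))
  (trans (cong₂ _++_ (sel-row (suc i) T p)
    (filter-none (λ e → row e ≟ suc (i + t)) (All.map (λ (q , _) e → <-irrefl (trans (sym q) e) (s≤s (m≤m+n i t))) (rowCells-All i off es))))
  (++-identityʳ _))

-- Both sides count the cells with letter `k` in row `r`, selecting by row and by letter in the two
-- possible orders: recording matrices of a tableau and its companion are transposes.
count-row : ∀ T {r off es} → nth T r ≡ just (off , es) → ∀ k → count k es ≡ count (suc r) (compRow T k)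
count-row T {r} {off} {es} p k = begin
  count k es ≡⟨ cong (count k) (rowCells-val r off es) ⟨
  count k (map val (rowCells r off es)) ≡⟨ count-map val k (rowCells r off es) ⟩
  length (sel val k (rowCells r off es)) ≡⟨ cong (length ∘ sel val k) (sel-row 0 T p) ⟨
  length (sel val k (sel row r (cells T))) ≡⟨ cong length (sel-comm val row k r (cells T)) ⟩
  length (sel row r (sel val k (cells T))) ≡⟨ cong length (sel-cong (All.universal (λ _ → cong suc , suc-injective) (sel val k (cells T)))) ⟩
  length (sel (suc ∘ row) (suc r) (sel val k (cells T))) ≡⟨ length-reverse (sel (suc ∘ row) (suc r) (sel val k (cells T))) ⟨
  length (reverse (sel (suc ∘ row) (suc r) (sel val k (cells T)))) ≡⟨ cong length (sel-reverse (suc ∘ row) (suc r) (sel val k (cells T))) ⟨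
  length (sel (suc ∘ row) (suc r) (reverse (sel val k (cells T)))) ≡⟨ cong (length ∘ sel (suc ∘ row) (suc r)) (sel-reverse val k (cells T)) ⟨
  length (sel (suc ∘ row) (suc r) (letter k T)) ≡⟨ count-map (suc ∘ row) (suc r) (letter k T) ⟨
  count (suc r) (map (suc ∘ row) (letter k T)) ≡⟨ cong (count (suc r)) (compRow-cells T k) ⟨
  count (suc r) (compRow T k) ∎
  where open ≡-Reasoning

tableau-ext : ∀ T U → shape T ≡ shape U →
  (∀ r {off es off′ fs} → nth T r ≡ just (off , es) → nth U r ≡ just (off′ , fs) → es ≡ fs) → T ≡ U
tableau-ext []       []       _ _ = refl
tableau-ext ((off , es) ∷ T) ((off′ , fs) ∷ U) s h =
  cong₂ _∷_ (cong₂ _,_ (cong proj₁ (∷-injectiveˡ s)) (h 0 refl refl)) (tableau-ext T U (∷-injectiveʳ s) (λ r → h (suc r)))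

-- A sorted row is determined by its multiplicities, and `count-row` reads these off the companion.
ι-injective : ∀ {d m T U} → IsLRTab d m T → IsLRTab d m U → shape T ≡ shape U → ι T ≡ ι U → T ≡ U
ι-injective {d} {m} {T} {U} lrT lrU s e = tableau-ext T U s λ r p q → sorted-count (row-sorted lrT p) (row-sorted lrU q) (counts p q)
  where
  lenT = proj₁ (proj₁ lrT)
  lenU = proj₁ (proj₁ lrU)
  rows : map (λ k → compRow T (suc k)) (upTo d) ≡ map (λ k → compRow U (suc k)) (upTo d)
  rows = trans (trans (cong (λ n → map (λ k → compRow T (suc k)) (upTo n)) (sym lenT)) (map-∘ (upTo (length T))))
    (trans (cong (map proj₂) e) (sym (trans (cong (λ n → map (λ k → compRow U (suc k)) (upTo n)) (sym lenU)) (map-∘ (upTo (length U))))))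
  compRow-≡ : ∀ {k} → k < d → compRow T (suc k) ≡ compRow U (suc k)
  compRow-≡ {k} l = just-injective (trans (sym (at (λ k → compRow T (suc k)))) (trans (cong (λ xs → nth xs k) rows) (at (λ k → compRow U (suc k)))))
    where
    at : (f : ℕ → List ℕ) → nth (map f (upTo d)) k ≡ just (f k)
    at f = nth-map⁺ f (upTo d) (nth-applyUpTo id l)
  counts : ∀ {r off es off′ fs} → nth T r ≡ just (off , es) → nth U r ≡ just (off′ , fs) → ∀ a → count a es ≡ count a fs
  counts p q zero = trans (count-none (All.map (λ (l , _) x≡0 → <-irrefl (sym x≡0) l) (row-range lrT p)))
    (sym (count-none (All.map (λ (l , _) x≡0 → <-irrefl (sym x≡0) l) (row-range lrU q))))
  counts {r} p q (suc k) with k <? d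
  ... | yes l = trans (count-row T p (suc k)) (trans (cong (count (suc r)) (compRow-≡ l)) (sym (count-row U q (suc k))))
  ... | no ¬l = trans (count-none (All.map (λ (_ , u) e → ¬l (≤-trans (≤-reflexive (sym e)) u)) (row-range lrT p)))
    (sym (count-none (All.map (λ (_ , u) e → ¬l (≤-trans (≤-reflexive (sym e)) u)) (row-range lrU q))))

-- Anti-normal form, evacuation and the orthogonal transpose combined

module Theorem {d m T Te} (lr : IsLRTab d m T) (rev : IsReversal d m T Te) where
  open Reversal lr rev

  dual = dual-equivalent-words L.box L.ss L.letters {Te} letters (proj₁ (proj₂ rev))

  op-word : KnuthEq (rowWord (ιop m Te)) (rowWord (ι T))
  op-word = ~-reflexive (trans (cong rowWord companion-op) (rowWord-companion Te (λ k → m ∸ length (compRow Te (suc k))) d))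
    ◅◅ ~-sym (proj₂ dual)
    ◅◅ ~-reflexive (sym (trans (cong (λ n → rowWord (map (λ k → 0 , compRow T (suc k)) (upTo n))) (proj₁ L.box)) (rowWord-companion T (λ _ → 0) d)))

  -- The shape conditions come from seeing `ιop m Te` as the rotation of the straight tableau
  -- `ι Tb`, the Knuth class from the row image of dual equivalence.
  anti-normal : IsAntiNormalForm d m (ι T) (ιop m Te)
  anti-normal = subst (IsAntiNormalForm d m (ι T)) rotated≡ (bullet-straight (companion-Straight rotated-LR) (ι T) (~-reflexive (cong rowWord rotated≡) ◅◅ op-word))
    where
    rotated≡ : bullet m d (map (λ k → 0 , compRow Tb (suc k)) (upTo d)) ≡ ιop m Te
    rotated≡ = trans (cong (bullet m d) (sym companion-Tb)) rotate-straight

  -- Rotation reverses the listing by letters and replaces `col` by `suc m ∸ col`; `complement m`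
  -- reverses the list back and subtracts once more. This leads from the rotation of `ι V` to the
  -- column word of `Te`, where dual equivalence applies.
  complement-byLetter : complement m (map (λ e → suc m ∸ col e) (byLetter d Tb)) ≡ map (λ e → suc m ∸ col e) (byLetter d Te)
  complement-byLetter = begin
    map comp (reverse (map f (byLetter d Tb))) ≡⟨ cong (map comp) (reverse-map f (byLetter d Tb)) ⟨
    map comp (map f (reverse (byLetter d Tb))) ≡⟨ map-∘ (reverse (byLetter d Tb)) ⟨
    map (comp ∘ f) (reverse (byLetter d Tb)) ≡⟨ cong (map (comp ∘ f)) reversed ⟩
    map (comp ∘ f) (map rot (byLetter d Te)) ≡⟨ map-∘ (byLetter d Te) ⟨
    map (comp ∘ f ∘ rot) (byLetter d Te) ≡⟨ map-cong (λ e → m∸[m∸n]≡n (m∸n≤m (suc m) (col e))) (byLetter d Te) ⟩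
    map f (byLetter d Te) ∎
    where
    open ≡-Reasoning
    comp = λ x → suc m ∸ x
    f : Cell → ℕ
    f e = suc m ∸ col e
    rot = rotCell (length Te) m d
    block : ∀ {k} → k < d → reverse (sel val (suc (d ∸ suc k)) (cells Tb)) ≡ map rot (sel val (suc k) (cells Te))
    block {k} k<d = begin
      reverse (sel val b (cells Tb)) ≡⟨ sel-reverse val b (cells Tb) ⟨
      sel val b (reverse (cells Tb)) ≡⟨ cong (sel val b) yamCells-Tb ⟩
      sel val b (map rot (cells Te)) ≡⟨ sel-map val rot b (cells Te) ⟩
      map rot (sel (val ∘ rot) b (cells Te)) ≡⟨ cong (map rot) (sel-cong (All.map (λ {e} → same {e}) letters)) ⟩
      map rot (sel val (suc k) (cells Te)) ∎
      where
      b = suc (d ∸ suc k)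
      b≡ : b ≡ suc d ∸ suc k
      b≡ = sym (+-∸-assoc 1 k<d)
      same : ∀ {e} → InRange d (val e) → (suc d ∸ val e ≡ b → val e ≡ suc k) × (val e ≡ suc k → suc d ∸ val e ≡ b)
      same (_ , u) = (λ p → ∸-cancelˡ-≡ (m≤n⇒m≤1+n u) (m≤n⇒m≤1+n k<d) (trans p b≡)) , (λ p → trans (cong (suc d ∸_) p) (sym b≡))
    reversed : reverse (byLetter d Tb) ≡ map rot (byLetter d Te)
    reversed = begin
      reverse (concatMap (λ k → sel val (suc k) (cells Tb)) (upTo d)) ≡⟨ reverse-concatMap _ (upTo d) ⟩
      concatMap (λ k → reverse (sel val (suc k) (cells Tb))) (reverse (upTo d)) ≡⟨ cong (concatMap _) (trans (cong reverse (sym (map-id (upTo d)))) (map-upTo-reverse id d)) ⟩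
      concatMap (λ k → reverse (sel val (suc k) (cells Tb))) (map (λ k → d ∸ suc k) (upTo d)) ≡⟨ concatMap-map _ (λ k → d ∸ suc k) (upTo d) ⟩
      concatMap (λ k → reverse (sel val (suc (d ∸ suc k)) (cells Tb))) (upTo d) ≡⟨ concatMap-cong-∈ (upTo d) (λ k∈ → block (∈-upTo⁻ k∈)) ⟩
      concatMap (λ k → map rot (sel val (suc k) (cells Te))) (upTo d) ≡⟨ map-concatMap rot _ (upTo d) ⟨
      map rot (byLetter d Te) ∎

  evac : IsEvac d m (ι T) (ι Tb)
  evac = ιop m Te , anti-normal , rotate-op

  module _ {V} (otV : IsOt d m Tb V) where
    module TV = Transpose rotated-LR otV

    -- Injectivity reduces the arbitrary `U` to `Tb`, and the companion of any orthogonal transpose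
    -- of `Tb` is computed from `columns`, that is, from `Tb` alone.
    companion-transpose : IsOtComp d m (shape Tb) (ι Tb) (ι V)
    companion-transpose U lrU sU eU V′ otV′ with refl ← ι-injective lrU rotated-LR sU eU =
      trans (Transpose.companion lrU otV′) (sym TV.companion)

    -- The witness is the rotation of `ι V` in the box with exchanged sides. Its reading word is
    -- followed through the column words of `Tb`, `Te` and `T` to that of `ι W`, which gives the
    -- equality of `ot evac` and `evac ot`.
    evac-transpose : ∀ {W} → IsOt d m T W → IsEvac m d (ι W) (ι V)
    evac-transpose {W} otW = bullet d m (ι V) ,
      subst (λ G → IsAntiNormalForm m d (ι W) (bullet d m G)) (sym TV.companion) (bullet-straight straight (ι W) word-≡) ,
      trans TV.companion (trans (sym (bullet-bullet-straight straight)) (cong (bullet d m ∘ bullet d m) (sym TV.companion)))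
      where
      straight = transpose-Straight rotated-LR
      word-≡ : KnuthEq (rowWord (bullet d m (map (λ k → 0 , rowOf (columns d m Tb) k) (upTo m)))) (rowWord (ι W))
      word-≡ = bullet-straight-~ straight (~-reflexive (cong rowWord (sym TV.companion)) ◅◅ TV.companion-word)
        ◅◅ ~-reflexive complement-byLetter
        ◅◅ ~-sym (proj₁ dual)
        ◅◅ ~-sym (Transpose.companion-word lr otW)

theorem5p11 : (d n : ℕ) → d ≤ n → (T : Tab) → IsLRTab d (n ∸ d) T →
    (Te : Tab) → IsReversal d (n ∸ d) T Te →
    IsAntiNormalForm d (n ∸ d) (ι T) (ιop (n ∸ d) Te)
    × ι (bullet (n ∸ d) d Te) ≡ bullet (n ∸ d) d (ιop (n ∸ d) Te)
    × IsEvac d (n ∸ d) (ι T) (ι (bullet (n ∸ d) d Te))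
    × ((V : Tab) → IsOt d (n ∸ d) (bullet (n ∸ d) d Te) V →
    IsOtComp d (n ∸ d) (shape (bullet (n ∸ d) d Te)) (ι (bullet (n ∸ d) d Te)) (ι V)
    × ((W : Tab) → IsOt d (n ∸ d) T W → IsEvac (n ∸ d) d (ι W) (ι V)))
theorem5p11 d n _ T lr Te rev = anti-normal , Reversal.rotate-op lr rev , evac ,
  λ V otV → companion-transpose otV , λ W otW → evac-transpose otV otW
  where open Theorem lr rev
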